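{- Let $\varepsilon>0$. Given a connected $n$-vertex graph $G$, a vertex $s\in V(G)$, and a clique cover $Q_1,\dots,Q_p$ of $G$, one can find a broadcast protocol for $(G,s)$ with at most $(1+\varepsilon)\cdot b(G,s)$ rounds in time $3^{2^{2p/\varepsilon}\,p}\cdot n^{O(1)}$.
   Context: All graphs are finite, undirected and loopless. Telephone model: at the start exactly one vertex, the source $s$, is informed; in each round every informed vertex may send the message to at most one of its uninformed neighbors, which is informed by the end of that round. For a connected graph $G$ and $s\in V(G)$, $b(G,s)$ is the minimum number of rounds needed to inform all vertices of $G$ starting from $s$. A broadcast protocol for $(G,s)$ with $t$ rounds is a spanning tree $T$ of $G$ rooted at $s$ together with a function $\tau\colon E(T)\to\{1,\dots,t\}$ that is a proper edge coloring of $T$ and such that for each $v\ne s$ the edge from $v$ to its parent has the minimum $\tau$-value among all edges of $T$ incident with $v$. Here $\tau(uv)$, with $u$ the parent of $v$, is the round in which $u$ forwards the message to $v$. A clique cover of $G$ is a partition of $V(G)$ into cliques $Q_1,\dots,Q_p$.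
   Formalization: The parameter ε ranges over the positive rational numbers rather than all positive reals. -}

module Defs where

open import Data.Bool.Base using (Bool; true; false; T; if_then_else_)
open import Data.Fin.Base using (Fin; toℕ)
open import Data.Fin.Subset using (Subset; _∈_; _∉_; Nonempty; ⁅_⁆; ⊤)
open import Data.Integer.Base using (+_; ∣_∣)
open import Data.List.Base as List using (List; []; _∷_; length)
import Data.List.Membership.Propositional as Mem
open import Data.List.Relation.Unary.Unique.Propositional using (Unique)
open import Data.Maybe.Base using (Maybe; just)
open import Data.Nat.Base using (ℕ; zero; suc; _+_; _*_; _^_; _≤_; _<_)
open import Data.Product.Base using (∃; ∃-syntax; _×_)
open import Data.Rational.Base as ℚ using (ℚ)
open import Data.Sum.Base using (_⊎_)
open import Data.Vec.Base as Vec using (Vec; []; _∷_)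
open import Function.Bundles using (_⇔_)
open import Relation.Binary.PropositionalEquality using (_≡_; _≢_)
open import Relation.Nullary.Negation using (¬_)

------------------------------------------------------------------------
-- Graphs

record Graph (n : ℕ) : Set where
  field
    adj        : Fin n → Fin n → Bool
    adj-sym    : ∀ u v → adj u v ≡ adj v u
    adj-irrefl : ∀ v → adj v v ≡ false

open Graph public

Adj : ∀ {n} → Graph n → Fin n → Fin n → Set
Adj G u v = T (adj G u v)

-- The list index records the visited vertices, both endpoints included.
data Walk {n} (G : Graph n) : Fin n → Fin n → List (Fin n) → Set where
  stop : ∀ v → Walk G v v (v ∷ [])
  step : ∀ {u v w vs} → Adj G u v → Walk G v w vs → Walk G u w (u ∷ vs)

Path : ∀ {n} → Graph n → Fin n → Fin n → List (Fin n) → Set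
Path G u v vs = Walk G u v vs × Unique vs

Connected : ∀ {n} → Graph n → Set
Connected G = ∀ u v → ∃[ vs ] Walk G u v vs

Acyclic : ∀ {n} → Graph n → Set
Acyclic G = ∀ u v vs → Path G u v vs → 3 ≤ length vs → ¬ Adj G v u

IsTree : ∀ {n} → Graph n → Set
IsTree G = Connected G × Acyclic G

-- u is the last vertex before v on a path from the root s to v.
IsParent : ∀ {n} → Graph n → Fin n → Fin n → Fin n → Set
IsParent T s u v = ∃[ vs ] Path T s u vs × Adj T u v × v Mem.∉ vs

record CliqueCover {n} (G : Graph n) (p : ℕ) : Set where
  field
    part     : Fin p → Subset n
    nonempty : ∀ i → Nonempty (part i)
    covers   : ∀ v → ∃[ i ] v ∈ part i
    disjoint : ∀ {i j v} → v ∈ part i → v ∈ part j → i ≡ j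
    clique   : ∀ {i u v} → u ∈ part i → v ∈ part i → u ≢ v → Adj G u v

------------------------------------------------------------------------
-- Broadcasting in the telephone model

-- One round, leading from the informed set S to the informed set S′.
record Round {n} (G : Graph n) (S S′ : Subset n) : Set where
  field
    send   : Fin n → Maybe (Fin n)
    valid  : ∀ {u v} → send u ≡ just v → u ∈ S × v ∉ S × Adj G u v
    result : ∀ v → v ∈ S′ ⇔ (v ∈ S ⊎ ∃[ u ] send u ≡ just v)

data Informed {n} (G : Graph n) (s : Fin n) : ℕ → Subset n → Set where
  start : Informed G s 0 ⁅ s ⁆
  next  : ∀ {t S S′} → Informed G s t S → Round G S S′ →
          Informed G s (suc t) S′

BroadcastsIn : ∀ {n} → Graph n → Fin n → ℕ → Set
BroadcastsIn G s t = Informed G s t ⊤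

-- b = b(G,s)
IsBroadcastTime : ∀ {n} → Graph n → Fin n → ℕ → Set
IsBroadcastTime G s b =
  BroadcastsIn G s b × (∀ t → BroadcastsIn G s t → b ≤ t)

-- The values of τ outside the edges of the tree are irrelevant.
record Protocol {n} (G : Graph n) (s : Fin n) (t : ℕ) : Set where
  field
    tree       : Graph n
    subgraph   : ∀ {u v} → Adj tree u v → Adj G u v
    isTree     : IsTree tree
    τ          : Fin n → Fin n → ℕ
    τ-sym      : ∀ {u v} → Adj tree u v → τ u v ≡ τ v u
    τ-range    : ∀ {u v} → Adj tree u v → 1 ≤ τ u v × τ u v ≤ t
    τ-proper   : ∀ {u v w} → Adj tree u v → Adj tree u w → v ≢ w →
                 τ u v ≢ τ u w
    parent-min : ∀ {u v w} → IsParent tree s u v → Adj tree v w →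
                 τ v u ≤ τ v w

------------------------------------------------------------------------
-- Model of computation: a first-order functional language over binary
-- trees (pure first-order Lisp).  Every evaluation step costs one unit and
-- is a constant-time operation on a random access or pointer machine;
-- literals are part of the program text and are referenced, not copied.

infixr 5 _∙_

data Tree : Set where
  nil : Tree
  _∙_ : Tree → Tree → Tree

-- Expressions over m functions of the given arities, with k variables in
-- scope.  The second branch of a case binds the left and right subtrees,
-- as variables 0 and 1.
data Exp {m : ℕ} (arity : Fin m → ℕ) (k : ℕ) : Set where
  var   : Fin k → Exp arity k
  lit   : Tree → Exp arity k
  cons  : Exp arity k → Exp arity k → Exp arity k
  case  : Exp arity k → Exp arity k → Exp arity (2 + k) → Exp arity k
  bind  : Exp arity k → Exp arity (1 + k) → Exp arity k
  call  : (f : Fin m) → Vec (Exp arity k) (arity f) → Exp arity k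

record Program : Set where
  field
    size  : ℕ
    arity : Fin size → ℕ
    body  : ∀ f → Exp arity (arity f)
    main  : Exp arity 1

open Program public

-- P , ρ ⊢ e ⇓ x [ c ]: in environment ρ, e evaluates to x at cost c.
data _,_⊢_⇓_[_] (P : Program) {k} (ρ : Vec Tree k) :
       Exp (arity P) k → Tree → ℕ → Set

data _,_⊢_⇓*_[_] (P : Program) {k} (ρ : Vec Tree k) :
       ∀ {l} → Vec (Exp (arity P) k) l → Vec Tree l → ℕ → Set

data _,_⊢_⇓_[_] P {k} ρ where
  ⇓var   : ∀ {i} → P , ρ ⊢ var i ⇓ Vec.lookup ρ i [ 1 ]
  ⇓lit   : ∀ {x} → P , ρ ⊢ lit x ⇓ x [ 1 ]
  ⇓cons  : ∀ {e₁ e₂ x y c d} →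
           P , ρ ⊢ e₁ ⇓ x [ c ] →
           P , ρ ⊢ e₂ ⇓ y [ d ] →
           P , ρ ⊢ cons e₁ e₂ ⇓ x ∙ y [ 1 + c + d ]
  ⇓case₀ : ∀ {e e₁ e₂ z c d} →
           P , ρ ⊢ e ⇓ nil [ c ] →
           P , ρ ⊢ e₁ ⇓ z [ d ] →
           P , ρ ⊢ case e e₁ e₂ ⇓ z [ 1 + c + d ]
  ⇓case₁ : ∀ {e e₁ e₂ x y z c d} →
           P , ρ ⊢ e ⇓ x ∙ y [ c ] →
           P , x ∷ y ∷ ρ ⊢ e₂ ⇓ z [ d ] →
           P , ρ ⊢ case e e₁ e₂ ⇓ z [ 1 + c + d ]
  ⇓bind  : ∀ {e₁ e₂ x z c d} →
           P , ρ ⊢ e₁ ⇓ x [ c ] →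
           P , x ∷ ρ ⊢ e₂ ⇓ z [ d ] →
           P , ρ ⊢ bind e₁ e₂ ⇓ z [ 1 + c + d ]
  ⇓call  : ∀ {f es xs z c d} →
           P , ρ ⊢ es ⇓* xs [ c ] →
           P , xs ⊢ body P f ⇓ z [ d ] →
           P , ρ ⊢ call f es ⇓ z [ 1 + c + d ]

data _,_⊢_⇓*_[_] P {k} ρ where
  ⇓[] : P , ρ ⊢ [] ⇓* [] [ 0 ]
  ⇓∷  : ∀ {l e x c d} {es : Vec (Exp (arity P) k) l} {xs} →
        P , ρ ⊢ e ⇓ x [ c ] →
        P , ρ ⊢ es ⇓* xs [ d ] →
        P , ρ ⊢ e ∷ es ⇓* x ∷ xs [ c + d ]

-- On input x, P halts with output y after c steps.
Computes : Program → Tree → Tree → ℕ → Set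
Computes P x y c = P , x ∷ [] ⊢ main P ⇓ y [ c ]

------------------------------------------------------------------------
-- Input and output encodings

encBool : Bool → Tree
encBool false = nil
encBool true  = nil ∙ nil

-- Unary; only vertex indices and round numbers are ever encoded.
encℕ : ℕ → Tree
encℕ zero    = nil
encℕ (suc k) = nil ∙ encℕ k

encFamily : ∀ {n} → (Fin n → Tree) → Tree
encFamily f = List.foldr _∙_ nil (List.tabulate f)

encMatrix : ∀ {m n} → (Fin m → Fin n → Tree) → Tree
encMatrix f = encFamily λ i → encFamily (f i)

encInput : ∀ {n p} (G : Graph n) → Fin n → CliqueCover G p → Tree
encInput G s Q =
  encMatrix (λ u v → encBool (adj G u v)) ∙
  encℕ (toℕ s) ∙
  encMatrix (λ i v → encBool (Vec.lookup (CliqueCover.part Q i) v))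

-- The matrix with entry τ(uv) ≥ 1 if uv is a tree edge, and 0 otherwise.
encProtocol : ∀ {n} {G : Graph n} {s t} → Protocol G s t → Tree
encProtocol π =
  encMatrix λ u v → encℕ (if adj tree u v then τ u v else 0)
  where open Protocol π

------------------------------------------------------------------------
-- Bounds

-- t ≤ (1 + ε) · b
WithinFactor : ℚ → ℕ → ℕ → Set
WithinFactor ε b t = (+ t) ℚ./ 1 ℚ.≤ (ℚ.1ℚ ℚ.+ ε) ℚ.* ((+ b) ℚ./ 1)

-- For ε > 0, the inequality k ≤ 3 ^ (2 ^ (2p/ε) · p) · m of real numbers.
-- Writing 2p/ε = x/y, it says that k ≤ 3 ^ ((u/v) · p) · m for every
-- rational u/v ≥ 2 ^ (x/y), both inequalities being cleared of roots.
WithinTime : ℚ → ℕ → ℕ → ℕ → Set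
WithinTime ε p m k =
  ∀ u v → 0 < v → 2 ^ x * v ^ y ≤ u ^ y → k ^ v ≤ 3 ^ (u * p) * m ^ v
  where
  x y : ℕ
  x = 2 * p * ℚ.↧ₙ ε
  y = ∣ ℚ.↥ ε ∣

{-# OPTIONS --safe #-}

-- Write L = ⌈log₂ n⌉, which is a lower bound for b(G,s), since a round at most
-- doubles the number of informed vertices.
--
-- A greedy strategy needs at most 2(p − 1) + L rounds.  Each informed vertex
-- prefers a neighbour in a clique without informed vertex, then a neighbour of
-- such a vertex, then a vertex of its own clique.  While some clique is
-- untouched, two consecutive rounds touch a new one; afterwards every round
-- doubles the informed part of each clique or fills the clique.  If
-- 2(p − 1) ≤ ε L, this is within the factor 1 + ε.
--
-- Otherwise p ≥ 2 and n ≤ 2 ^ L ≤ 2 ^ (2p/ε), and there is time for an exhaustive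
-- search.  Within a round the senders act one after the other, so that a
-- situation is a pair of nested sets: who was informed when the round began,
-- and who is informed by now.  There are 3 ^ n such pairs; one state is kept for
-- each, and removing duplicates by comparing all pairs costs 9 ^ n ≤ 3 ^ (n p)
-- up to a polynomial factor.

module Submission where

open import Defs
open import Data.Bool.Base using (Bool; true; false; T; not; _∧_; _∨_; if_then_else_)
import Data.Bool.Properties as Bool
open import Data.Empty using (⊥-elim)
open import Data.Fin.Base as Fin using (Fin; zero; suc; toℕ)
import Data.Fin.Properties as Fin
open import Data.Fin.Subset using (Subset; _∈_; _∉_; _⊆_; ⁅_⁆; ⊤; ∣_∣; _∩_)
import Data.Fin.Subset.Properties as Subset
import Data.Integer.Base as ℤ
import Data.Integer.Properties as ℤ
open import Data.List.Base as List using (List; []; _∷_; length)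
import Data.List.Membership.Propositional as List
import Data.List.Membership.Propositional.Properties as List
import Data.List.Properties as List
open import Data.List.Relation.Unary.All as All using (All; []; _∷_)
import Data.List.Relation.Unary.All.Properties as All
open import Data.List.Relation.Unary.AllPairs using (AllPairs; []; _∷_)
open import Data.List.Relation.Unary.Any as Any using (Any; here; there)
import Data.List.Relation.Unary.Any.Properties as Any
open import Data.List.Relation.Unary.Unique.Propositional using (Unique)
open import Data.Maybe.Base using (Maybe; just; nothing; is-just)
open import Data.Maybe.Properties using (just-injective)
open import Data.Nat.Base
  using (ℕ; zero; suc; _+_; _*_; _^_; _≤_; _<_; z≤n; s≤s; ⌈_/2⌉; >-nonZero)
open import Data.Nat.Induction using (<-wellFounded)
open import Data.Nat.Properties
open import Data.Nat.Tactic.RingSolver using (solve-∀)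
open import Data.Product.Base using (∃-syntax; Σ-syntax; ∃₂; _×_; _,_; proj₁; proj₂)
open import Data.Product.Properties using (,-injective)
open import Data.Rational.Base as ℚ using (ℚ; 0ℚ; mkℚ) renaming (_<_ to _<ℚ_)
import Data.Rational.Properties as ℚ
import Data.Rational.Unnormalised.Base as ℚᵘ
import Data.Rational.Unnormalised.Properties as ℚᵘ
open import Data.Sum.Base using (_⊎_; inj₁; inj₂)
open import Data.Unit.Base using (tt)
open import Data.Vec.Base as Vec using (Vec; []; _∷_; lookup; _[_]≔_)
import Data.Vec.Membership.Propositional as Vec
import Data.Vec.Membership.Propositional.Properties as Vec
import Data.Vec.Properties as Vec
import Data.Vec.Relation.Unary.All as VecAll
open import Data.Vec.Relation.Unary.AllPairs using ([]; _∷_)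
open import Data.Vec.Relation.Unary.Any using (here; there)
import Data.Vec.Relation.Unary.Unique.Propositional as VecUnique
import Data.Vec.Relation.Unary.Unique.Propositional.Properties as VecUnique
open import Function.Base using (_∘_; id; case_of_)
open import Function.Bundles using (Equivalence)
open import Induction.WellFounded using (Acc) renaming (acc to below)
open import Relation.Binary.Definitions using (DecidableEquality; tri<; tri≈; tri>)
open import Relation.Binary.PropositionalEquality
open import Relation.Nullary.Decidable
  using (Dec; yes; no; does; map′; _×-dec_; ¬?; dec-true; decidable-stable; toWitness)
open import Relation.Nullary.Negation using (¬_; contradiction)

-- The constant `c` is fixed before `ε`, so nothing that depends on `ε` may enter the polynomial
-- factor. Literals are referenced at unit cost, and this carries the only contact of the program
-- with `ε`: the test 2(p - 1) ≤ ε L multiplies nothing, but reads a periodic word, stored as a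
-- literal, that tells which of two unary numerals to shorten next.
--
-- Letting the senders of a round act in turn limits a state to n + 1 successors, where the joint
-- choices of all senders could be exponentially many. Both strategies are then one search over
-- lists of states: the greedy one keeps lists of length 1, the exhaustive one lists of length at
-- most 3 ^ n. With lists of length at most ℓ the cost is at most ℓ * ℓ times a polynomial, and one
-- polynomial serves for both.
--
-- The number b(G,s) is never computed. It enters through two facts on arbitrary broadcasts: L ≤
-- b(G,s), and the exhaustive search misses no reachable set of informed vertices. Conversely, the
-- output is a protocol because the cells store parents and rounds.

variable
  A B : Set
  k m n p : ℕ

-- Cost of evaluation, measured in calls

nodes  : ∀ {s} {arity : Fin s → ℕ} → Exp arity k → ℕ
nodes* : ∀ {s} {arity : Fin s → ℕ} → Vec (Exp arity k) m → ℕ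
nodes (var _)          = 1
nodes (lit _)          = 1
nodes (cons e₁ e₂)     = 1 + (nodes e₁ + nodes e₂)
nodes (case e e₁ e₂)   = 1 + (nodes e + (nodes e₁ + nodes e₂))
nodes (bind e₁ e₂)     = 1 + (nodes e₁ + nodes e₂)
nodes (call _ es)      = 1 + nodes* es
nodes* []       = 0
nodes* (e ∷ es) = nodes e + nodes* es

-- Within a single activation of a function body each node is evaluated at
-- most once, so the cost is at most K times the number of calls, plus the
-- size of the expression.  From here on only calls are counted.
module Calls (P : Program) (K : ℕ) (small : ∀ f → nodes (body P f) ≤ K) where

  infix 4 _⊩_↠_within_ _⊩*_↠_within_

  record _⊩_↠_within_ (ρ : Vec Tree k) (e : Exp (arity P) k)
                      (x : Tree) (q : ℕ) : Set where
    constructor run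
    field
      {cost} : ℕ
      eval   : P , ρ ⊢ e ⇓ x [ cost ]
      bound  : cost ≤ nodes e + K * q

  record _⊩*_↠_within_ (ρ : Vec Tree k) (es : Vec (Exp (arity P) k) m)
                       (xs : Vec Tree m) (q : ℕ) : Set where
    constructor run
    field
      {cost} : ℕ
      eval   : P , ρ ⊢ es ⇓* xs [ cost ]
      bound  : cost ≤ nodes* es + K * q

  infixr 5 _∷!_

  abstract
    private
      +-swap : ∀ a b q r → (a + K * q) + (b + K * r) ≡ (a + b) + K * (q + r)
      +-swap = lemma K
        where
        lemma : ∀ K a b q r → (a + K * q) + (b + K * r) ≡ (a + b) + K * (q + r)
        lemma = solve-∀

      +-bound : ∀ {c d} a b q r → c ≤ a + K * q → d ≤ b + K * r →
                c + d ≤ (a + b) + K * (q + r)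
      +-bound a b q r h h′ = ≤-trans (+-mono-≤ h h′) (≤-reflexive (+-swap a b q r))

    weaken : ∀ {ρ : Vec Tree k} {e x q r} → q ≤ r →
             ρ ⊩ e ↠ x within q → ρ ⊩ e ↠ x within r
    weaken {e = e} q≤r (run d h) =
      run d (≤-trans h (+-monoʳ-≤ (nodes e) (*-monoʳ-≤ K q≤r)))

    var! : ∀ {ρ : Vec Tree k} {i} → ρ ⊩ var i ↠ lookup ρ i within 0
    var! = run ⇓var (s≤s z≤n)

    lit! : ∀ {ρ : Vec Tree k} {x} → ρ ⊩ lit x ↠ x within 0
    lit! = run ⇓lit (s≤s z≤n)

    cons! : ∀ {ρ : Vec Tree k} {e₁ e₂ x y q r} →
            ρ ⊩ e₁ ↠ x within q → ρ ⊩ e₂ ↠ y within r →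
            ρ ⊩ cons e₁ e₂ ↠ x ∙ y within (q + r)
    cons! {e₁ = e₁} {e₂} {q = q} {r} (run d h) (run d′ h′) =
      run (⇓cons d d′) (s≤s (+-bound (nodes e₁) (nodes e₂) q r h h′))

    case₀ : ∀ {ρ : Vec Tree k} {e e₁ e₂ z q r} →
            ρ ⊩ e ↠ nil within q → ρ ⊩ e₁ ↠ z within r →
            ρ ⊩ case e e₁ e₂ ↠ z within (q + r)
    case₀ {e = e} {e₁} {e₂} {q = q} {r} (run d h) (run d′ h′) =
      run (⇓case₀ d d′) (s≤s (+-bound (nodes e) (nodes e₁ + nodes e₂) q r h
        (≤-trans h′ (+-monoˡ-≤ (K * r) (m≤m+n (nodes e₁) (nodes e₂))))))

    case₁ : ∀ {ρ : Vec Tree k} {e e₁ e₂ x y z q r} →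
            ρ ⊩ e ↠ x ∙ y within q → x ∷ y ∷ ρ ⊩ e₂ ↠ z within r →
            ρ ⊩ case e e₁ e₂ ↠ z within (q + r)
    case₁ {e = e} {e₁} {e₂} {q = q} {r} (run d h) (run d′ h′) =
      run (⇓case₁ d d′) (s≤s (+-bound (nodes e) (nodes e₁ + nodes e₂) q r h
        (≤-trans h′ (+-monoˡ-≤ (K * r) (m≤n+m (nodes e₂) (nodes e₁))))))

    bind! : ∀ {ρ : Vec Tree k} {e₁ e₂ x z q r} →
            ρ ⊩ e₁ ↠ x within q → x ∷ ρ ⊩ e₂ ↠ z within r →
            ρ ⊩ bind e₁ e₂ ↠ z within (q + r)
    bind! {e₁ = e₁} {e₂} {q = q} {r} (run d h) (run d′ h′) =
      run (⇓bind d d′) (s≤s (+-bound (nodes e₁) (nodes e₂) q r h h′))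

    -- The one `K` that `suc r` adds pays for the nodes of the body of `f`, so that only the nodes
    -- of the arguments stay visible in the bound.
    call! : ∀ {ρ : Vec Tree k} {f es xs z q r} →
            ρ ⊩* es ↠ xs within q → xs ⊩ body P f ↠ z within r →
            ρ ⊩ call f es ↠ z within (q + suc r)
    call! {f = f} {es} {q = q} {r} (run d h) (run d′ h′) =
      run (⇓call d d′) (s≤s (≤-trans
        (+-bound (nodes* es) 0 q (suc r) h (begin
          _                       ≤⟨ h′ ⟩
          nodes (body P f) + K * r ≤⟨ +-monoˡ-≤ (K * r) (small f) ⟩
          K + K * r               ≡⟨ *-suc K r ⟨
          K * suc r               ∎))
        (≤-reflexive (cong (_+ K * (q + suc r)) (+-identityʳ (nodes* es))))))
      where open ≤-Reasoning

    []! : ∀ {ρ : Vec Tree k} → ρ ⊩* [] ↠ [] within 0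
    []! = run ⇓[] z≤n

    _∷!_ : ∀ {ρ : Vec Tree k} {e x} {es : Vec _ m} {xs q r} →
           ρ ⊩ e ↠ x within q → ρ ⊩* es ↠ xs within r →
           ρ ⊩* e ∷ es ↠ x ∷ xs within (q + r)
    _∷!_ {e = e} {es = es} {q = q} {r} (run d h) (run d′ h′) =
      run (⇓∷ d d′) (+-bound (nodes e) (nodes* es) q r h h′)

-- The program

pattern half#      = zero
pattern log#       = suc half#
pattern test#      = suc log#
pattern names#     = suc test#
pattern eq#        = suc names#
pattern nth#       = suc eq#
pattern init#      = suc nth#
pattern zeros#     = suc init#
pattern meets#     = suc zeros#
pattern or#        = suc meets#
pattern good#      = suc or#
pattern semi#      = suc good#
pattern mate#      = suc semi#
pattern sends#     = suc mate#
pattern consAll#   = suc sends#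
pattern choose#    = suc consAll#
pattern succs#     = suc choose#
pattern same#      = suc succs#
pattern member#    = suc same#
pattern insert#    = suc member#
pattern expand#    = suc insert#
pattern sweep#     = suc expand#
pattern age#       = suc sweep#
pattern full#      = suc age#
pattern firstFull# = suc full#
pattern loop#      = suc firstFull#
pattern hit#       = suc loop#
pattern row#       = suc hit#
pattern matrix#    = suc row#

arities : Vec ℕ 29
arities = 1 ∷ 1 ∷ 5 ∷ 2 ∷ 2 ∷ 2 ∷ 2 ∷ 1 ∷ 2 ∷ 2 ∷ 2 ∷ 2 ∷ 3 ∷ 4 ∷ 2 ∷ 6 ∷ 5 ∷ 2 ∷
          2 ∷ 2 ∷ 6 ∷ 5 ∷ 1 ∷ 1 ∷ 1 ∷ 5 ∷ 3 ∷ 3 ∷ 3 ∷ []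

ar : Fin 29 → ℕ
ar = lookup arities

pattern v0  = var zero
pattern v1  = var (suc zero)
pattern v2  = var (suc (suc zero))
pattern v3  = var (suc (suc (suc zero)))
pattern v4  = var (suc (suc (suc (suc zero))))
pattern v5  = var (suc (suc (suc (suc (suc zero)))))
pattern v6  = var (suc (suc (suc (suc (suc (suc zero))))))
pattern v7  = var (suc (suc (suc (suc (suc (suc (suc zero)))))))
pattern v8  = var (suc (suc (suc (suc (suc (suc (suc (suc zero))))))))
pattern v9  = var (suc (suc (suc (suc (suc (suc (suc (suc (suc zero)))))))))
pattern v10 = var (suc (suc (suc (suc (suc (suc (suc (suc (suc (suc zero))))))))))

yes! : Tree
yes! = nil ∙ nil

-- Ends `sends#`, once `v0` holds the results that leave the first cell alone. The bit of the first
-- row, the bit of the second row and the cell lie two variables apart, and each test binds two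
-- more; this is why all three tests read `v5`.
extend : Exp ar 11
extend =
  case v5 v0
    (case v5 v2
      (case v5 (cons (cons v11 v6) v4) v6))
  where
  v11 : Exp ar 15
  v11 = var (suc (suc (suc (suc (suc (suc (suc (suc (suc (suc (suc zero)))))))))))

-- A state is a pair old ∙ cur of cell vectors: who knew the message when the
-- current round began, and who knows it by now.  A cell is nil for an
-- uninformed vertex, and otherwise the pair of the round in which the vertex
-- was informed and its parent.  An empty clique cover selects exhaustive
-- search, a nonempty one the greedy strategy.  The comment above a function
-- lists its arguments, from variable 0 on.
code : ∀ f → Exp ar (ar f)
code half# =
  case v0 (lit nil) (case v1 (cons v0 (lit nil)) (cons v2 (call half# (v1 ∷ []))))
code log# =
  case v0 (lit nil)
    (case v1 (lit nil) (cons (lit nil) (call log# (call half# (v4 ∷ []) ∷ []))))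
-- p, l, rest of the word, word (see Word), cover
code test# =
  case v2
    (call test# (v0 ∷ v1 ∷ v3 ∷ v3 ∷ v4 ∷ []))
    (case v0
      (case v2 v6 (call test# (v1 ∷ v5 ∷ v3 ∷ v7 ∷ v8 ∷ [])))
      (case v5 (lit nil) (call test# (v6 ∷ v1 ∷ v5 ∷ v9 ∷ v10 ∷ []))))
code names# =
  case v0 (lit nil) (cons v3 (call names# (v1 ∷ cons (lit nil) v3 ∷ [])))
code eq# =
  case v0
    (case v1 (lit yes!) (lit nil))
    (case v3 (lit nil) (call eq# (v3 ∷ v1 ∷ [])))
code nth# =
  case v0 (lit nil) (case v3 v0 (call nth# (v3 ∷ v1 ∷ [])))
code init# =
  case v0 (lit nil)
    (cons (case (call eq# (v0 ∷ v3 ∷ [])) (lit nil) (cons (lit nil) v5))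
          (call init# (v1 ∷ v3 ∷ [])))
code zeros# =
  case v0 (lit nil) (cons (lit nil) (call zeros# (v1 ∷ [])))
code meets# =
  case v0 (lit nil)
    (case v3 (lit nil)
      (case v2
        (call meets# (v3 ∷ v1 ∷ []))
        (case v2 (call meets# (v5 ∷ v3 ∷ [])) (lit yes!))))
code or# =
  case v0 (lit nil)
    (case v3 (lit nil)
      (cons (case v2 v0 (lit yes!)) (call or# (v3 ∷ v1 ∷ []))))
-- cover, cur ↦ the union of the cliques without informed vertex
code good# =
  case v0
    (call zeros# (v1 ∷ []))
    (case (call meets# (v0 ∷ v3 ∷ []))
      (call or# (v0 ∷ call good# (v1 ∷ v3 ∷ []) ∷ []))
      (call good# (v3 ∷ v5 ∷ [])))
-- adjacency matrix, vertex set ↦ the neighbours of the set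
code semi# =
  case v0 (lit nil)
    (cons (call meets# (v0 ∷ v3 ∷ [])) (call semi# (v1 ∷ v3 ∷ [])))
-- cover, u, default ↦ the clique of u
code mate# =
  case v0 v2
    (case (call nth# (v0 ∷ v3 ∷ []))
      (call mate# (v1 ∷ v3 ∷ v4 ∷ []))
      v2)
-- new cell x, two rows, cur ↦ all ways of writing x over a nil of cur at a
-- position that lies in both rows
code sends# =
  case v1 (lit nil)
    (case v4 (lit nil)
      (case v7 (lit nil)
        (bind (call consAll# (v0 ∷ call sends# (v6 ∷ v5 ∷ v3 ∷ v1 ∷ []) ∷ []))
          extend)))
code consAll# =
  case v1 (lit nil) (cons (cons v2 v0) (call consAll# (v2 ∷ v1 ∷ [])))
-- adjacency matrix, cover, row of u, u, new cell, cur
code choose# =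
  case v1
    (cons v5 (call sends# (v4 ∷ v2 ∷ v2 ∷ v5 ∷ [])))
    (bind (call good# (v3 ∷ v7 ∷ []))
      (case (call sends# (v7 ∷ v5 ∷ v0 ∷ v8 ∷ []))
        (case (call sends# (v7 ∷ v5 ∷ call semi# (v3 ∷ v0 ∷ []) ∷ v8 ∷ []))
          (case (call sends# (v7 ∷ v5 ∷ call mate# (v4 ∷ v6 ∷ v5 ∷ []) ∷ v8 ∷ []))
            (cons v8 (lit nil))
            (cons v0 (lit nil)))
          (cons v0 (lit nil)))
        (cons v0 (lit nil))))
-- adjacency matrix, cover, u, round, state
code succs# =
  case v4 (lit nil)
    (case (call nth# (v0 ∷ v4 ∷ []))
      (cons v6 (lit nil))
      (call consAll# (v2 ∷
        call choose# (v4 ∷ v5 ∷ call nth# (v4 ∷ v6 ∷ []) ∷ v6 ∷ cons v7 v6 ∷ v3 ∷ []) ∷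
        [])))
code same# =
  case v0 (lit yes!)
    (case v3 (lit yes!)
      (case v2
        (case v0 (call same# (v3 ∷ v1 ∷ [])) (lit nil))
        (case v2 (lit nil) (call same# (v7 ∷ v5 ∷ [])))))
code member# =
  case v1 (lit nil)
    (case v2 (lit nil)
      (case v2 (lit nil)
        (case (call same# (v2 ∷ v0 ∷ []))
          (call member# (v6 ∷ v5 ∷ []))
          (case (call same# (v5 ∷ v3 ∷ []))
            (call member# (v8 ∷ v7 ∷ []))
            (lit yes!)))))
code insert# =
  case v0 v1
    (call insert# (v1 ∷ case (call member# (v0 ∷ v3 ∷ [])) (cons v0 v3) v5 ∷ []))
-- adjacency matrix, cover, u, round, list, accumulator
code expand# =
  case v4 v5
    (call expand# (v2 ∷ v3 ∷ v4 ∷ v5 ∷ v1 ∷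
      call insert# (call succs# (v2 ∷ v3 ∷ v4 ∷ v5 ∷ v0 ∷ []) ∷ v7 ∷ []) ∷ []))
-- adjacency matrix, cover, names, round, list
code sweep# =
  case v2 v4
    (call sweep# (v2 ∷ v3 ∷ v1 ∷ v5 ∷
      call expand# (v2 ∷ v3 ∷ v0 ∷ v5 ∷ v6 ∷ lit nil ∷ []) ∷ []))
code age# =
  case v0 (lit nil)
    (case v0 (lit nil) (cons (cons v1 v1) (call age# (v3 ∷ []))))
code full# =
  case v0 (lit yes!) (case v0 (lit nil) (call full# (v3 ∷ [])))
code firstFull# =
  case v0 (lit nil)
    (case v0 (lit nil) (case (call full# (v1 ∷ [])) (call firstFull# (v3 ∷ [])) v3))
-- adjacency matrix, cover, names, round, list
code loop# =
  bind (call firstFull# (v4 ∷ []))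
    (case v0
      (call loop# (v1 ∷ v2 ∷ v3 ∷ cons (lit nil) v4 ∷
        call sweep# (v1 ∷ v2 ∷ v3 ∷ cons (lit nil) v4 ∷ call age# (v5 ∷ []) ∷ []) ∷
        []))
      (call matrix# (v5 ∷ v5 ∷ v2 ∷ [])))
-- cell, u, default ↦ the round of the cell if its parent is u
code hit# =
  case v0 v2 (case (call eq# (v1 ∷ v3 ∷ [])) v4 v2)
-- names, u, cur
code row# =
  case v0 (lit nil)
    (cons
      (call hit# (call nth# (v4 ∷ v0 ∷ []) ∷ v3 ∷
        call hit# (call nth# (v4 ∷ v3 ∷ []) ∷ v0 ∷ lit nil ∷ []) ∷ []))
      (call row# (v1 ∷ v3 ∷ v4 ∷ [])))
-- remaining names, names, cur
code matrix# =
  case v0 (lit nil)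
    (cons (call row# (v3 ∷ v0 ∷ v4 ∷ [])) (call matrix# (v1 ∷ v3 ∷ v4 ∷ [])))

-- Lists double as unary numerals: the tail of the cover stands for p - 1, the rows of the adjacency
-- matrix for n. `W` is passed twice, once to be consumed and once to restart from. The test returns
-- the cover to search with, which is how the strategy gets selected.
start! : Tree → Exp ar 1
start! W =
  case v0 (lit nil)
    (case v1 (lit nil)
      (case v1 (lit nil)
        (bind (call test# (v1 ∷ call log# (v4 ∷ []) ∷ lit W ∷ lit W ∷ v3 ∷ []))
          (bind (call names# (v5 ∷ lit nil ∷ []))
            (bind (call init# (v0 ∷ v4 ∷ []))
              (call loop# (v7 ∷ v2 ∷ v1 ∷ lit nil ∷ cons (cons v0 v0) (lit nil) ∷ [])))))))

program : Tree → Program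
program W = record { size = 29 ; arity = ar ; body = code ; main = start! W }

abstract
  maxNodes : ℕ
  maxNodes = 64

  code-small : ∀ f → nodes (code f) ≤ maxNodes
  code-small = toWitness {a? = Fin.all? (λ f → nodes (code f) ≤? 64)} tt

  -- A literal counts as one node however large it is, so one bound serves for every `W`, and thus
  -- for every `ε`.
  start-small : ∀ W → nodes (start! W) ≤ maxNodes
  start-small W = toWitness {a? = nodes (start! W) ≤? 64} tt

-- The functions computed by the program

encV : (A → Tree) → Vec A m → Tree
encV e []       = nil
encV e (x ∷ xs) = e x ∙ encV e xs

encL : (A → Tree) → List A → Tree
encL e []       = nil
encL e (x ∷ xs) = e x ∙ encL e xs

isNode : Tree → Bool
isNode nil     = false
isNode (_ ∙ _) = true

Cell : ℕ → Set
Cell n = Maybe (ℕ × Fin n)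

State : ℕ → Set
State n = Vec (Cell n) n × Vec (Cell n) n

Matrix : ℕ → ℕ → Set
Matrix m n = Vec (Vec Bool n) m

encVertex : Fin n → Tree
encVertex u = encℕ (toℕ u)

encCell : Cell n → Tree
encCell nothing        = nil
encCell (just (k , u)) = encℕ k ∙ encVertex u

encState : State n → Tree
encState (old , cur) = encV encCell old ∙ encV encCell cur

encRows : Matrix m n → Tree
encRows = encV (encV encBool)

informed : Vec (Cell n) m → Subset m
informed = Vec.map is-just

_≟S_ : DecidableEquality (Subset m)
_≟S_ = Vec.≡-dec Bool._≟_

shape : State n → Subset n × Subset n
shape (old , cur) = informed old , informed cur

_≟Shape_ : DecidableEquality (Subset m × Subset n)
(s , t) ≟Shape (s′ , t′) = map′ (λ (p , q) → cong₂ _,_ p q) ,-injective (s ≟S s′ ×-dec t ≟S t′)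

meets : (A → Tree) → Vec Bool m → Vec A m → Bool
meets e []       []       = false
meets e (a ∷ as) (b ∷ bs) = (a ∧ isNode (e b)) ∨ meets e as bs

good : Matrix p m → Vec (Cell n) m → Vec Bool m
good []       cur = Vec.replicate _ false
good (q ∷ qs) cur =
  if meets encCell q cur then good qs cur else Vec.zipWith _∨_ q (good qs cur)

semi : Matrix m n → Vec Bool n → Vec Bool m
semi A g = Vec.map (λ row → meets encBool row g) A

mate : Matrix p n → Fin n → Vec Bool n → Vec Bool n
mate []       u d = d
mate (q ∷ qs) u d = if lookup q u then q else mate qs u d

sends : ℕ × Fin n → Vec Bool m → Vec Bool m → Vec (Cell n) m →
        List (Vec (Cell n) m)
sends x []       []       []       = []
sends x (a ∷ as) (b ∷ bs) (c ∷ cs) =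
  let rest = List.map (c ∷_) (sends x as bs cs) in
  if a ∧ b ∧ not (is-just c) then (just x ∷ cs) ∷ rest else rest

firstOr : List A → A → A
firstOr []      d = d
firstOr (x ∷ _) d = x

-- The two modes differ only here: the exhaustive one offers idling and every possible send, whereas
-- the greedy list is a singleton, so that a greedy search carries a single state.
choose : Matrix n n → Matrix p n → Fin n → ℕ × Fin n →
         Vec (Cell n) n → List (Vec (Cell n) n)
choose A []           u x cur = cur ∷ sends x (lookup A u) (lookup A u) cur
choose A qs@(_ ∷ _) u x cur =
  firstOr (sends x row g cur)
    (firstOr (sends x row (semi A g) cur)
      (firstOr (sends x row (mate qs u row) cur) cur)) ∷ []
  where
  row = lookup A u
  g   = good qs cur

succs : Matrix n n → Matrix p n → ℕ → Fin n → State n → List (State n)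
succs A qs r u (old , cur) with lookup old u
... | nothing = (old , cur) ∷ []
... | just _  = List.map (old ,_) (choose A qs u (r , u) cur)

member? : (st : State n) (l : List (State n)) →
          Dec (Any (λ st′ → shape st ≡ shape st′) l)
member? st = Any.any? λ st′ → shape st ≟Shape shape st′

-- Of several states with the same shape it is enough to keep the first: later moves and the test
-- for completion see only who is informed, while rounds and parents matter for the output alone.
insert : List (State n) → List (State n) → List (State n)
insert []         acc = acc
insert (st ∷ sts) acc = insert sts (if does (member? st acc) then acc else st ∷ acc)

expand : (State n → List (State n)) → List (State n) → List (State n) → List (State n)
expand f []       acc = acc
expand f (st ∷ l) acc = expand f l (insert (f st) acc)

sweep : Matrix n n → Matrix p n → ℕ → Vec (Fin n) m → List (State n) → List (State n)
sweep A qs r []       l = l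
sweep A qs r (u ∷ us) l = sweep A qs r us (expand (succs A qs r u) l [])

age : List (State n) → List (State n)
age = List.map λ st → proj₂ st , proj₂ st

firstFull : List (State n) → Maybe (Vec (Cell n) n)
firstFull []                = nothing
firstFull ((old , cur) ∷ l) = if does (informed cur ≟S ⊤) then just cur else firstFull l

hit : Cell n → Fin n → ℕ → ℕ
hit nothing        u d = d
hit (just (k , w)) u d = if does (w Fin.≟ u) then k else d

-- The root is its own parent with round 0, so it puts on the diagonal the same 0 that stands for
-- non-edges.
entry : Vec (Cell n) n → Fin n → Fin n → ℕ
entry cur u v = hit (lookup cur v) u (hit (lookup cur u) v 0)

initial : Fin n → Vec (Fin n) m → Vec (Cell n) m
initial s = Vec.map λ u → if does (u Fin.≟ s) then just (0 , s) else nothing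

-- Sizes of the lists of states

length-insert : ∀ (sts acc : List (State n)) → length acc ≤ length (insert sts acc)
length-insert []         acc = ≤-refl
length-insert (st ∷ sts) acc with does (member? st acc)
... | true  = length-insert sts acc
... | false = ≤-trans (n≤1+n _) (length-insert sts (st ∷ acc))

-- Accumulators never lose states, so a length bound for the final list covers every membership test
-- made on the way.
length-expand : ∀ f (l acc : List (State n)) → length acc ≤ length (expand f l acc)
length-expand f []       acc = ≤-refl
length-expand f (st ∷ l) acc =
  ≤-trans (length-insert (f st) acc) (length-expand f l (insert (f st) acc))

length-sends : ∀ x (as bs : Vec Bool m) (cs : Vec (Cell n) m) →
               length (sends x as bs cs) ≤ m
length-sends x []       []       []       = z≤n
length-sends x (a ∷ as) (b ∷ bs) (c ∷ cs)
  with ih ← ≤-trans (≤-reflexive (List.length-map (c ∷_) (sends x as bs cs)))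
                    (length-sends x as bs cs)
  with a ∧ b ∧ not (is-just c)
... | true  = s≤s ih
... | false = m≤n⇒m≤1+n ih

length-choose : ∀ A (qs : Matrix p n) u x cur → length (choose A qs u x cur) ≤ suc n
length-choose A []       u x cur = s≤s (length-sends x (lookup A u) (lookup A u) cur)
length-choose A (_ ∷ _) u x cur = s≤s z≤n

length-succs : ∀ A (qs : Matrix p n) r u st → length (succs A qs r u st) ≤ suc n
length-succs A qs r u (old , cur) with lookup old u
... | nothing = s≤s z≤n
... | just _  = ≤-trans (≤-reflexive (List.length-map (old ,_) (choose A qs u (r , u) cur)))
                        (length-choose A qs u (r , u) cur)

-- Every sender rebuilds the list from an empty accumulator, so the last length does not control the
-- intermediate ones; the cost of a sweep depends on them all.
Bounded : ℕ → Matrix n n → Matrix p n → ℕ → Vec (Fin n) m → List (State n) → Set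
Bounded ℓ A qs r []       l = length l ≤ ℓ
Bounded ℓ A qs r (u ∷ us) l =
  length l ≤ ℓ × Bounded ℓ A qs r us (expand (succs A qs r u) l [])

Bounded⇒≤ : ∀ {ℓ A r l} {qs : Matrix p n} (us : Vec (Fin n) m) →
            Bounded ℓ A qs r us l → length l ≤ ℓ
Bounded⇒≤ []       h       = h
Bounded⇒≤ (_ ∷ _) (h , _) = h

-- Numbers of calls

sendsCalls semiCalls goodCalls mateCalls chooseCalls succsCalls : ℕ → ℕ
sendsCalls n = n * (n + 2)
semiCalls n = n * (n + 2)
goodCalls n = suc n * (2 * n + 3)
mateCalls n = n * (n + 2)
chooseCalls n = goodCalls n + semiCalls n + mateCalls n + 3 * sendsCalls n + 6
succsCalls n = chooseCalls n + 3 * n + 5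

memberCalls insertCalls expandCalls sweepCalls : ℕ → ℕ → ℕ
memberCalls n ℓ = ℓ * (2 * n + 3)
insertCalls n ℓ = suc n * (memberCalls n ℓ + 2)
expandCalls n ℓ = ℓ * (succsCalls n + insertCalls n ℓ + 3)
sweepCalls n ℓ = n * (expandCalls n ℓ + 2)

rowCalls : ℕ → ℕ
rowCalls n = n * (4 * n + 7)

-- Comparison with a line of rational slope

-- A word with letters "p" (nil) and "l" (yes!) that follows the line
-- a · i ≡ b · j: started at a point of the line and repeated forever, it tells
-- on which side of the line a point lies, at a cost independent of a and b.
data Word (a b : ℕ) : ℕ → ℕ → Tree → Set where
  end : ∀ {i j} → a * i ≡ b * j → Word a b i j nil
  p∷_ : ∀ {i j w} → a * i ≤ b * j → Word a b (suc i) j w → Word a b i j (nil ∙ w)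
  l∷_ : ∀ {i j w} → b * j < a * i → Word a b i (suc j) w → Word a b i j (yes! ∙ w)

-- The two inequalities keep the walk within one step of the line. After a + b steps they leave only
-- the point (b , a), which lies on the line; `f` counts the steps still to go.
word-from : ∀ {a b} f i j → 0 < b → f + (i + j) ≡ a + b →
            a * i ≤ b * j + a → b * j < a * i + b → ∃[ w ] Word a b i j w
word-from {a} {b} zero i j 0<b sum lo hi with <-cmp j a
... | tri≈ _ refl _ = nil , end (trans (cong (a *_) i≡b) (*-comm a b))
  where
  i≡b : i ≡ b
  i≡b = +-cancelˡ-≡ a i b (trans (+-comm a i) sum)
... | tri< j<a _ _ = contradiction lo (<⇒≱ (begin-strict
    b * j + a           <⟨ +-monoˡ-< a (*-monoʳ-< b {{>-nonZero 0<b}} j<a) ⟩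
    b * a + a           ≡⟨ cong (_+ a) (*-comm b a) ⟩
    a * b + a           ≡⟨ trans (+-comm (a * b) a) (sym (*-suc a b)) ⟩
    a * suc b           ≤⟨ *-monoʳ-≤ a b<i ⟩
    a * i               ∎))
  where
  open ≤-Reasoning
  b<i : b < i
  b<i = +-cancelʳ-< j b i (begin-strict
    b + j <⟨ +-monoʳ-< b j<a ⟩
    b + a ≡⟨ +-comm b a ⟩
    a + b ≡⟨ sum ⟨
    i + j ∎)
... | tri> _ _ a<j = contradiction hi (≤⇒≯ (begin
    a * i + b           ≤⟨ +-monoˡ-≤ b (*-monoʳ-≤ a (<⇒≤ i<b)) ⟩
    a * b + b           ≡⟨ cong (_+ b) (*-comm a b) ⟩
    b * a + b           ≡⟨ trans (+-comm (b * a) b) (sym (*-suc b a)) ⟩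
    b * suc a           ≤⟨ *-monoʳ-≤ b a<j ⟩
    b * j               ∎))
  where
  open ≤-Reasoning
  i<b : i < b
  i<b = +-cancelʳ-< a i b (begin-strict
    i + a <⟨ +-monoʳ-< i a<j ⟩
    i + j ≡⟨ sum ⟩
    a + b ≡⟨ +-comm a b ⟩
    b + a ∎)
word-from {a} {b} (suc f) i j 0<b sum lo hi with a * i ≤? b * j
... | yes ai≤bj = _ , (p∷ ai≤bj) (proj₂ (word-from f (suc i) j 0<b
    (trans (+-suc f (i + j)) sum)
    (≤-trans (≤-reflexive (*-suc a i)) (≤-trans (+-monoʳ-≤ a ai≤bj) (≤-reflexive (+-comm a (b * j)))))
    (≤-trans hi (+-monoˡ-≤ b (*-monoʳ-≤ a (n≤1+n i))))))
... | no ai≰bj = _ , (l∷ ≰⇒> ai≰bj) (proj₂ (word-from f i (suc j) 0<b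
    (trans (trans (cong (f +_) (+-suc i j)) (+-suc f (i + j))) sum)
    (≤-trans lo (+-monoˡ-≤ a (*-monoʳ-≤ b (n≤1+n j))))
    (≤-trans (s≤s (≤-reflexive (trans (*-suc b j) (+-comm b (b * j))))) (+-monoˡ-< b (≰⇒> ai≰bj)))))

-- Exposing the first letter shows that the word is nonempty; an empty one would make `test#`
-- restart forever.
word : ∀ a b → 0 < b → ∃[ w ] Word a b 0 0 (nil ∙ w)
word a (suc b) 0<b
  with w , d ← word-from {a} (a + b) 1 0 0<b (trans (+-comm (a + b) 1) (sym (+-suc a b)))
      (≤-trans (≤-reflexive (*-identityʳ a)) (m≤n+m a (suc b * 0)))
      (≤-trans (s≤s (≤-reflexive (*-zeroʳ (suc b)))) (≤-trans (s≤s z≤n) (m≤n+m (suc b) (a * 1))))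
  = w , (p∷ ≤-reflexive (trans (*-zeroʳ a) (sym (*-zeroʳ (suc b))))) d

-- With `P` and `L` letters of the two kinds consumed in total, aP - bL agrees with ai - bj for the
-- current point (i , j) of the word. At the end of the word both vanish, so the point may go back
-- to the origin.
restart : ∀ a b {P L i j} → a * P + b * j ≡ b * L + a * i → a * i ≡ b * j →
          a * P + b * 0 ≡ b * L + a * 0
restart a b {P} {L} {i} {j} inv eq = begin
  a * P + b * 0 ≡⟨ trans (cong (a * P +_) (*-zeroʳ b)) (+-identityʳ (a * P)) ⟩
  a * P         ≡⟨ +-cancelʳ-≡ (b * j) (a * P) (b * L) (trans inv (cong (b * L +_) eq)) ⟩
  b * L         ≡⟨ trans (cong (b * L +_) (*-zeroʳ a)) (+-identityʳ (b * L)) ⟨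
  b * L + a * 0 ∎
  where open ≡-Reasoning

step-p : ∀ a b {L j} P i → a * P + b * j ≡ b * L + a * i →
         a * suc P + b * j ≡ b * L + a * suc i
step-p a b {L} {j} P i inv = trans (left a P (b * j)) (trans (cong (a +_) inv) (right a i (b * L)))
  where
  left : ∀ a P c → a * suc P + c ≡ a + (a * P + c)
  left = solve-∀
  right : ∀ a i c → a + (c + a * i) ≡ c + a * suc i
  right = solve-∀

step-l : ∀ a b {P i} L j → a * P + b * j ≡ b * L + a * i →
         a * P + b * suc j ≡ b * suc L + a * i
step-l a b {P} {i} L j inv = sym (step-p b a {P} {i} L j (sym inv))

-- Counts a restart that is about to happen as one call. The word is nonempty, so no two restarts
-- are consecutive and every consumed letter accounts for at most two calls.
isNil : Tree → ℕ
isNil nil     = 1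
isNil (_ ∙ _) = 0

isNil≤1 : ∀ x → isNil x ≤ 1
isNil≤1 nil     = ≤-refl
isNil≤1 (_ ∙ _) = z≤n

-- Halving and the binary logarithm

⌈n/2⌉-double : ∀ n → n ≤ ⌈ n /2⌉ + ⌈ n /2⌉
⌈n/2⌉-double zero          = z≤n
⌈n/2⌉-double (suc zero)    = s≤s z≤n
⌈n/2⌉-double (suc (suc n)) =
  ≤-trans (s≤s (s≤s (⌈n/2⌉-double n))) (≤-reflexive (cong suc (sym (+-suc _ _))))

⌈n/2⌉-half : ∀ n b → n ≤ b + b → ⌈ n /2⌉ ≤ b
⌈n/2⌉-half zero          b       h = z≤n
⌈n/2⌉-half (suc zero)    (suc b) h = s≤s z≤n
⌈n/2⌉-half (suc (suc n)) (suc b) (s≤s h) with subst (suc n ≤_) (+-suc b b) h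
... | s≤s h′ = s≤s (⌈n/2⌉-half n b h′)

doubling : ∀ b → 2 ^ b + 2 ^ b ≡ 2 ^ suc b
doubling b = cong (2 ^ b +_) (sym (+-identityʳ (2 ^ b)))

data Log : ℕ → ℕ → Set where
  none : Log 0 0
  one  : Log 1 0
  more : ∀ {l} → Log ⌈ 2 + n /2⌉ l → Log (2 + n) (suc l)

log : ∀ f n → n ≤ f → ∃[ l ] Log n l
log f       zero          h       = 0 , none
log f       (suc zero)    h       = 0 , one
log (suc f) (suc (suc n)) (s≤s h) with log f ⌈ 2 + n /2⌉ (≤-trans (s≤s (⌈n/2⌉≤n n)) h)
... | l , lg = suc l , more lg

n≤2^log : ∀ {l} → Log n l → n ≤ 2 ^ l
n≤2^log none = z≤n
n≤2^log one  = s≤s z≤n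
n≤2^log (more {n} {l} lg) = ≤-trans (⌈n/2⌉-double (2 + n))
  (≤-trans (+-mono-≤ (n≤2^log lg) (n≤2^log lg)) (≤-reflexive (doubling l)))

log-minimal : ∀ {l} → Log n l → ∀ b → n ≤ 2 ^ b → l ≤ b
log-minimal none          b       h = z≤n
log-minimal one           b       h = z≤n
log-minimal (more _)      zero    (s≤s ())
log-minimal (more {n} lg) (suc b) h = s≤s (log-minimal lg b
  (⌈n/2⌉-half (2 + n) (2 ^ b) (≤-trans h (≤-reflexive (sym (doubling b))))))

-- The indices are the current round, the current states, the number of rounds
-- to come and the final cells.
data Search (ℓ : ℕ) (A : Matrix n n) (qs : Matrix p n) :
            ℕ → List (State n) → ℕ → Vec (Cell n) n → Set where
  found : ∀ {r l cur} → length l ≤ ℓ → firstFull l ≡ just cur → Search ℓ A qs r l 0 cur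
  round : ∀ {r l j cur} → length l ≤ ℓ → firstFull l ≡ nothing →
          Bounded ℓ A qs (suc r) (Vec.allFin n) (age l) →
          Search ℓ A qs (suc r) (sweep A qs (suc r) (Vec.allFin n) (age l)) j cur →
          Search ℓ A qs r l (suc j) cur

logCalls testCalls : ℕ → ℕ
logCalls n = n * (n + 2)
testCalls n = 2 * (n + n)

roundCalls searchCalls mainCalls : ℕ → ℕ → ℕ
roundCalls n ℓ = ℓ * (n + 2) + ℓ + sweepCalls n ℓ + 4
-- Either strategy takes at most 2(p - 1) + L rounds, and this is at most 3n.
searchCalls n ℓ = 3 * n * roundCalls n ℓ + (ℓ * (n + 2) + n * (rowCalls n + 2) + 2)
mainCalls n ℓ = testCalls n + logCalls n + n + n * (n + 2) + searchCalls n ℓ + 5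

-- Encodings of input and output

encFamily≡encV : ∀ (e : A → Tree) (f : Fin n → A) → encFamily (e ∘ f) ≡ encV e (Vec.tabulate f)
encFamily≡encV {n = zero}  e f = refl
encFamily≡encV {n = suc n} e f = cong (e (f zero) ∙_) (encFamily≡encV e (f ∘ suc))

encFamily-cong : ∀ {f g : Fin n → Tree} → (∀ i → f i ≡ g i) → encFamily f ≡ encFamily g
encFamily-cong {zero}  h = refl
encFamily-cong {suc n} h = cong₂ _∙_ (h zero) (encFamily-cong (h ∘ suc))

encMatrix≡encV : ∀ (e : A → Tree) (f : Fin m → Fin n → A) →
                 encMatrix (λ i j → e (f i j)) ≡
                 encV (λ i → encV (e ∘ f i) (Vec.allFin n)) (Vec.allFin m)
encMatrix≡encV e f = trans
  (encFamily-cong λ i → encFamily≡encV (e ∘ f i) id)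
  (encFamily≡encV (λ i → encV (e ∘ f i) (Vec.allFin _)) id)

adjacency : Graph n → Matrix n n
adjacency G = Vec.tabulate λ u → Vec.tabulate (adj G u)

cover : {G : Graph n} → CliqueCover G p → Matrix p n
cover Q = Vec.tabulate (CliqueCover.part Q)

encMatrix≡encRows : ∀ (A : Fin m → Fin n → Bool) →
                    encMatrix (λ i j → encBool (A i j)) ≡
                    encRows (Vec.tabulate λ i → Vec.tabulate (A i))
encMatrix≡encRows A = trans
  (encFamily-cong λ i → encFamily≡encV encBool (A i))
  (encFamily≡encV (encV encBool) (λ i → Vec.tabulate (A i)))

encInput≡ : ∀ (G : Graph n) s (Q : CliqueCover G p) →
            encInput G s Q ≡ encRows (adjacency G) ∙ encVertex s ∙ encRows (cover Q)
encInput≡ G s Q = cong₂ _∙_ (encMatrix≡encRows (adj G)) (cong (encVertex s ∙_) (trans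
  (encMatrix≡encRows λ i v → lookup (part i) v)
  (cong encRows (Vec.tabulate-cong λ i → Vec.tabulate∘lookup (part i)))))
  where open CliqueCover Q

encOutput : Vec (Cell n) n → Tree
encOutput cur = encMatrix λ u v → encℕ (entry cur u v)

firstState : Fin n → State n
firstState {n} s = initial s (Vec.allFin n) , initial s (Vec.allFin n)

encV≡encL : ∀ (e : A → Tree) (xs : Vec A m) → encV e xs ≡ encL e (Vec.toList xs)
encV≡encL e []       = refl
encV≡encL e (x ∷ xs) = cong (e x ∙_) (encV≡encL e xs)

-- Evaluation of the program, function by function

module Runs (W : Tree) where

  open Calls (program W) maxNodes code-small public

  half-run : ∀ (xs : List A) (e : A → Tree) →
             ∃[ ys ] length ys ≡ ⌈ length xs /2⌉ ×
             (encL e xs ∷ [] ⊩ code half# ↠ encL e ys within length xs)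
  half-run []           e = [] , refl , case₀ var! lit!
  half-run (x ∷ [])     e =
    x ∷ [] , refl , weaken z≤n (case₁ var! (case₀ var! (cons! var! lit!)))
  half-run (x ∷ y ∷ xs) e with ys , eq , d ← half-run xs e =
    x ∷ ys , cong suc eq ,
    weaken (n≤1+n _) (case₁ var! (case₁ var! (cons! var! (call! (var! ∷! []!) d))))

  eq-run : ∀ (u v : Fin n) →
           encVertex u ∷ encVertex v ∷ [] ⊩ code eq# ↠ encBool (does (u Fin.≟ v)) within n
  eq-run zero    zero    = weaken z≤n (case₀ var! (case₀ var! lit!))
  eq-run zero    (suc v) = weaken z≤n (case₀ var! (case₁ var! lit!))
  eq-run (suc u) zero    = weaken z≤n (case₁ var! (case₀ var! lit!))
  eq-run (suc u) (suc v) =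
    case₁ var! (case₁ var! (call! (var! ∷! var! ∷! []!) (eq-run u v)))

  nth-run : ∀ (e : A → Tree) (xs : Vec A n) i →
            encV e xs ∷ encVertex i ∷ [] ⊩ code nth# ↠ e (lookup xs i) within n
  nth-run e (x ∷ xs) zero    = weaken z≤n (case₁ var! (case₀ var! var!))
  nth-run e (x ∷ xs) (suc i) =
    case₁ var! (case₁ var! (call! (var! ∷! var! ∷! []!) (nth-run e xs i)))

  names-run : ∀ (e : A → Tree) (xs : Vec A m) j (f : Fin m → Fin n) →
              (∀ i → toℕ (f i) ≡ j + toℕ i) →
              encV e xs ∷ encℕ j ∷ [] ⊩ code names# ↠
              encV encVertex (Vec.tabulate f) within m
  names-run e []       j f h = case₀ var! lit!
  names-run e (x ∷ xs) j f h rewrite trans (h zero) (+-identityʳ j) =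
    case₁ var! (cons! var! (call! (var! ∷! cons! lit! var! ∷! []!)
      (names-run e xs (suc j) (f ∘ suc) λ i → trans (h (suc i)) (+-suc j (toℕ i)))))

  init-run : ∀ (us : Vec (Fin n) m) s →
             encV encVertex us ∷ encVertex s ∷ [] ⊩ code init# ↠
             encV encCell (initial s us) within m * (n + 2)
  init-run []       s = case₀ var! lit!
  init-run {n} (u ∷ us) s
    with does (u Fin.≟ s) | eq-run u s | init-run us s
  ... | true  | d | ih = weaken (≤-reflexive (bound _ n)) (case₁ var! (cons!
          (case₁ (call! (var! ∷! var! ∷! []!) d) (cons! lit! var!))
          (call! (var! ∷! var! ∷! []!) ih)))
    where
    bound : ∀ a n → suc n + 0 + suc a ≡ n + 2 + a
    bound = solve-∀
  ... | false | d | ih = weaken (≤-reflexive (bound _ n)) (case₁ var! (cons!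
          (case₀ (call! (var! ∷! var! ∷! []!) d) lit!)
          (call! (var! ∷! var! ∷! []!) ih)))
    where
    bound : ∀ a n → suc n + 0 + suc a ≡ n + 2 + a
    bound = solve-∀

  zeros-run : ∀ (e : A → Tree) (xs : Vec A m) →
              encV e xs ∷ [] ⊩ code zeros# ↠ encV encBool (Vec.replicate m false) within m
  zeros-run e []       = case₀ var! lit!
  zeros-run e (x ∷ xs) =
    case₁ var! (cons! lit! (call! (var! ∷! []!) (zeros-run e xs)))

  meets-run : ∀ (e : A → Tree) (as : Vec Bool m) (bs : Vec A m) →
              encV encBool as ∷ encV e bs ∷ [] ⊩ code meets# ↠
              encBool (meets e as bs) within m
  meets-run e []           []       = case₀ var! lit!
  meets-run e (false ∷ as) (b ∷ bs) =
    case₁ var! (case₁ var! (case₀ var! (call! (var! ∷! var! ∷! []!) (meets-run e as bs))))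
  meets-run e (true ∷ as)  (b ∷ bs) with e b
  ... | nil   = case₁ var! (case₁ var! (case₁ var! (case₀ var!
                  (call! (var! ∷! var! ∷! []!) (meets-run e as bs)))))
  ... | _ ∙ _ = weaken z≤n (case₁ var! (case₁ var! (case₁ var! (case₁ var! lit!))))

  or-run : ∀ (as bs : Vec Bool m) →
           encV encBool as ∷ encV encBool bs ∷ [] ⊩ code or# ↠
           encV encBool (Vec.zipWith _∨_ as bs) within m
  or-run []           []       = case₀ var! lit!
  or-run (false ∷ as) (b ∷ bs) = case₁ var! (case₁ var! (cons! (case₀ var! var!)
    (call! (var! ∷! var! ∷! []!) (or-run as bs))))
  or-run (true ∷ as)  (b ∷ bs) = case₁ var! (case₁ var! (cons! (case₁ var! lit!)
    (call! (var! ∷! var! ∷! []!) (or-run as bs))))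

  good-run : ∀ (qs : Matrix p n) (cur : Vec (Cell n) n) →
             encRows qs ∷ encV encCell cur ∷ [] ⊩ code good# ↠
             encV encBool (good qs cur) within suc p * (2 * n + 3)
  good-run {n = n} [] cur =
    weaken (≤-trans (m≤m+n (suc n) (n + 2)) (≤-reflexive (bound n)))
      (case₀ var! (call! (var! ∷! []!) (zeros-run encCell cur)))
    where
    bound : ∀ n → suc n + (n + 2) ≡ 2 * n + 3 + 0
    bound = solve-∀
  good-run {n = n} (q ∷ qs) cur
    with meets encCell q cur | meets-run encCell q cur | good-run qs cur
  ... | true  | d | ih =
    weaken (≤-trans (m≤m+n _ (suc n)) (≤-reflexive (bound n _)))
      (case₁ var! (case₁ (call! (var! ∷! var! ∷! []!) d)
        (call! (var! ∷! var! ∷! []!) ih)))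
    where
    bound : ∀ n a → suc n + suc a + suc n ≡ 2 * n + 3 + a
    bound = solve-∀
  ... | false | d | ih =
    weaken (≤-reflexive (bound n _))
      (case₁ var! (case₀ (call! (var! ∷! var! ∷! []!) d)
        (call! (var! ∷! call! (var! ∷! var! ∷! []!) ih ∷! []!) (or-run q (good qs cur)))))
    where
    bound : ∀ n a → suc n + (suc a + 0 + suc n) ≡ 2 * n + 3 + a
    bound = solve-∀

  semi-run : ∀ (A : Matrix m n) g →
             encRows A ∷ encV encBool g ∷ [] ⊩ code semi# ↠
             encV encBool (semi A g) within m * (n + 2)
  semi-run []        g = case₀ var! lit!
  semi-run {n = n} (row ∷ A) g =
    weaken (≤-reflexive (bound n _))
      (case₁ var! (cons! (call! (var! ∷! var! ∷! []!) (meets-run encBool row g))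
        (call! (var! ∷! var! ∷! []!) (semi-run A g))))
    where
    bound : ∀ n a → suc n + suc a ≡ n + 2 + a
    bound = solve-∀

  mate-run : ∀ (qs : Matrix p n) u d →
             encRows qs ∷ encVertex u ∷ encV encBool d ∷ [] ⊩ code mate# ↠
             encV encBool (mate qs u d) within p * (n + 2)
  mate-run []       u d = case₀ var! var!
  mate-run {p = suc p} {n} (q ∷ qs) u d with lookup q u | nth-run encBool q u
  ... | true  | r =
    weaken (≤-trans (m≤m+n _ (suc (p * (n + 2)))) (≤-reflexive (bound n _)))
      (case₁ var! (case₁ (call! (var! ∷! var! ∷! []!) r) var!))
    where
    bound : ∀ n a → suc n + 0 + suc a ≡ n + 2 + a
    bound = solve-∀
  ... | false | r =
    weaken (≤-reflexive (bound n _))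
      (case₁ var! (case₀ (call! (var! ∷! var! ∷! []!) r)
        (call! (var! ∷! var! ∷! var! ∷! []!) (mate-run qs u d))))
    where
    bound : ∀ n a → suc n + suc a ≡ n + 2 + a
    bound = solve-∀

  consAll-run : ∀ c (e : A → Tree) (e′ : B → Tree) (g : A → B) →
                (∀ x → e′ (g x) ≡ c ∙ e x) → ∀ xs →
                c ∷ encL e xs ∷ [] ⊩ code consAll# ↠ encL e′ (List.map g xs) within length xs
  consAll-run c e e′ g h []       = case₀ var! lit!
  consAll-run c e e′ g h (x ∷ xs) rewrite h x =
    case₁ var! (cons! (cons! var! var!)
      (call! (var! ∷! var! ∷! []!) (consAll-run c e e′ g h xs)))

  sends-run : ∀ x (as bs : Vec Bool m) (cs : Vec (Cell n) m) →
              encCell (just x) ∷ encV encBool as ∷ encV encBool bs ∷ encV encCell cs ∷ [] ⊩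
              code sends# ↠ encL (encV encCell) (sends x as bs cs) within sendsCalls m
  sends-run         x []       []       []       = case₀ var! lit!
  sends-run {suc m} x (a ∷ as) (b ∷ bs) (c ∷ cs) =
    case₁ var! (case₁ var! (case₁ var! (weaken bound (bind!
      (call! (var! ∷! call! (var! ∷! var! ∷! var! ∷! var! ∷! []!) (sends-run x as bs cs) ∷! []!)
        (consAll-run (encCell c) (encV encCell) (encV encCell) (c ∷_) (λ _ → refl)
          (sends x as bs cs)))
      (branch a b c)))))
    where
    branch : ∀ a b c {rest : List (Vec (Cell _) (suc m))} {z₁ z₂ z₃ z₄ z₅} →
             encL (encV encCell) rest ∷ encCell c ∷ encV encCell cs ∷
             encBool b ∷ z₁ ∷ encBool a ∷ z₂ ∷ encCell (just x) ∷ z₃ ∷ z₄ ∷ z₅ ∷ [] ⊩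
             extend ↠ encL (encV encCell)
               (if a ∧ b ∧ not (is-just c) then (just x ∷ cs) ∷ rest else rest) within 0
    branch false b     c        = case₀ var! var!
    branch true  false c        = case₁ var! (case₀ var! var!)
    branch true  true  nothing  = case₁ var! (case₁ var! (case₀ var! (cons! (cons! var! var!) var!)))
    branch true  true  (just _) = case₁ var! (case₁ var! (case₁ var! var!))
    bound : suc (sendsCalls m) + 0 + suc (length (sends x as bs cs)) + 0 ≤ sendsCalls (suc m)
    bound = ≤-trans
      (+-monoˡ-≤ 0 (+-monoʳ-≤ (suc (sendsCalls m) + 0)
        (≤-trans (s≤s (length-sends x as bs cs)) (m≤m+n (suc m) (m + 1)))))
      (≤-reflexive (arith m))
      where
      arith : ∀ m → suc (m * (m + 2)) + 0 + (suc m + (m + 1)) + 0 ≡ suc m * (suc m + 2)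
      arith = solve-∀

  private
    firstOr-run : ∀ {e e₁ : Exp ar k} {ρ : Vec Tree k}
                  (f : A → Tree) {q r} l d →
                  ρ ⊩ e ↠ encL f l within q →
                  (l ≡ [] → ρ ⊩ e₁ ↠ encL f (d ∷ []) within r) →
                  ρ ⊩ case e e₁ (cons v0 (lit nil)) ↠ encL f (firstOr l d ∷ []) within (q + r)
    firstOr-run f []      d run-l run-d = case₀ run-l (run-d refl)
    firstOr-run f (x ∷ l) d run-l run-d = weaken (+-monoʳ-≤ _ z≤n) (case₁ run-l (cons! var! lit!))

  choose-run : ∀ A (qs : Matrix p n) → p ≤ n → ∀ u x cur →
               encRows A ∷ encRows qs ∷ encV encBool (lookup A u) ∷ encVertex u ∷
               encCell (just x) ∷ encV encCell cur ∷ [] ⊩ code choose# ↠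
               encL (encV encCell) (choose A qs u x cur) within chooseCalls n
  choose-run {n = n} A [] _ u x cur =
    weaken (≤-trans (m≤n+m _ (goodCalls n + semiCalls n + mateCalls n + 2 * sendsCalls n + 5))
                    (≤-reflexive (bound (goodCalls n) (semiCalls n) (mateCalls n) (sendsCalls n))))
      (case₀ var! (cons! var! (call! (var! ∷! var! ∷! var! ∷! var! ∷! []!)
        (sends-run x (lookup A u) (lookup A u) cur))))
    where
    bound : ∀ g s m t → g + s + m + 2 * t + 5 + suc t ≡ g + s + m + 3 * t + 6
    bound = solve-∀
  choose-run {p = p} {n} A qs@(_ ∷ _) p≤n u x cur =
    weaken (≤-reflexive (bound (goodCalls n) (semiCalls n) (mateCalls n) (sendsCalls n)))
      (case₁ var! (bind!
        (call! (var! ∷! var! ∷! []!)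
          (weaken (*-monoˡ-≤ (2 * n + 3) (s≤s p≤n)) (good-run qs cur)))
        (firstOr-run (encV encCell) (sends x row g cur) d₁
          (call! (var! ∷! var! ∷! var! ∷! var! ∷! []!) (sends-run x row g cur)) λ _ →
          firstOr-run (encV encCell) (sends x row (semi A g) cur) d₂
            (call! (var! ∷! var! ∷! call! (var! ∷! var! ∷! []!) (semi-run A g) ∷! var! ∷! []!)
              (sends-run x row (semi A g) cur)) λ _ →
          firstOr-run (encV encCell) (sends x row (mate qs u row) cur) cur
            (call! (var! ∷! var! ∷! call! (var! ∷! var! ∷! var! ∷! []!)
                      (weaken (*-monoˡ-≤ (n + 2) p≤n) (mate-run qs u row)) ∷!
                    var! ∷! []!)
              (sends-run x row (mate qs u row) cur)) λ _ →
          cons! var! lit!)))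
    where
    row = lookup A u
    g   = good qs cur
    d₂  = firstOr (sends x row (mate qs u row) cur) cur
    d₁  = firstOr (sends x row (semi A g) cur) d₂
    bound : ∀ g s m t → suc g + (suc t + ((suc s + 0 + suc t) + ((suc m + 0 + suc t) + 0))) ≡
                        g + s + m + 3 * t + 6
    bound = solve-∀

  succs-run : ∀ A (qs : Matrix p n) → p ≤ n → ∀ r u st →
              encRows A ∷ encRows qs ∷ encVertex u ∷ encℕ r ∷ encState st ∷ [] ⊩ code succs# ↠
              encL encState (succs A qs r u st) within succsCalls n
  succs-run {n = n} A qs p≤n r u (old , cur)
    with lookup old u | nth-run encCell old u
  ... | nothing | d =
    weaken (≤-trans (m≤n+m (suc n + 0) (chooseCalls n + 2 * n + 4))
                    (≤-reflexive (bound n (chooseCalls n))))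
      (case₁ var! (case₀ (call! (var! ∷! var! ∷! []!) d) (cons! var! lit!)))
    where
    bound : ∀ n c → c + 2 * n + 4 + (suc n + 0) ≡ c + 3 * n + 5
    bound = solve-∀
  ... | just _  | d =
    weaken (≤-trans (+-monoʳ-≤ (suc n) (+-monoʳ-≤ (suc n + 0 + suc (chooseCalls n) + 0)
                      (s≤s (length-choose A qs u (r , u) cur))))
                    (≤-reflexive (bound n (chooseCalls n))))
      (case₁ var! (case₁ (call! (var! ∷! var! ∷! []!) d)
        (call! (var! ∷! call! (var! ∷! var! ∷!
                  call! (var! ∷! var! ∷! []!) (nth-run (encV encBool) A u) ∷!
                  var! ∷! cons! var! var! ∷! var! ∷! []!)
                  (choose-run A qs p≤n u (r , u) cur) ∷! []!)
          (consAll-run (encV encCell old) (encV encCell) encState (old ,_) (λ _ → refl)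
            (choose A qs u (r , u) cur)))))
    where
    bound : ∀ n c → suc n + (suc n + 0 + suc c + 0 + suc (suc n)) ≡ c + 3 * n + 5
    bound = solve-∀

  same-run : ∀ (xs ys : Vec (Cell n) m) →
             encV encCell xs ∷ encV encCell ys ∷ [] ⊩ code same# ↠
             encBool (does (informed xs ≟S informed ys)) within m
  same-run []             []             = case₀ var! lit!
  same-run (nothing ∷ xs) (nothing ∷ ys) = case₁ var! (case₁ var! (case₀ var! (case₀ var!
    (call! (var! ∷! var! ∷! []!) (same-run xs ys)))))
  same-run (nothing ∷ xs) (just _ ∷ ys)  =
    weaken z≤n (case₁ var! (case₁ var! (case₀ var! (case₁ var! lit!))))
  same-run (just _ ∷ xs)  (nothing ∷ ys) =
    weaken z≤n (case₁ var! (case₁ var! (case₁ var! (case₀ var! lit!))))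
  same-run (just _ ∷ xs)  (just _ ∷ ys)  = case₁ var! (case₁ var! (case₁ var! (case₁ var!
    (call! (var! ∷! var! ∷! []!) (same-run xs ys)))))

  member-run : ∀ (st : State n) l →
               encState st ∷ encL encState l ∷ [] ⊩ code member# ↠
               encBool (does (member? st l)) within length l * (2 * n + 3)
  member-run st [] = case₀ var! lit!
  member-run {n} st@(old , cur) ((old′ , cur′) ∷ l)
    with does (informed old ≟S informed old′) | same-run old old′
       | does (informed cur ≟S informed cur′) | same-run cur cur′
       | member-run st l
  ... | false | d | _ | _ | ih =
    weaken (≤-trans (m≤m+n _ (suc n)) (≤-reflexive (bound n _)))
      (case₁ var! (case₁ var! (case₁ var! (case₀ (call! (var! ∷! var! ∷! []!) d)
        (call! (var! ∷! var! ∷! []!) ih)))))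
    where
    bound : ∀ n a → suc n + suc a + suc n ≡ 2 * n + 3 + a
    bound = solve-∀
  ... | true | d | false | d′ | ih =
    weaken (≤-reflexive (bound n _))
      (case₁ var! (case₁ var! (case₁ var! (case₁ (call! (var! ∷! var! ∷! []!) d)
        (case₀ (call! (var! ∷! var! ∷! []!) d′) (call! (var! ∷! var! ∷! []!) ih))))))
    where
    bound : ∀ n a → suc n + (suc n + suc a) ≡ 2 * n + 3 + a
    bound = solve-∀
  ... | true | d | true | d′ | ih =
    weaken (≤-trans (m≤m+n _ (suc _)) (≤-reflexive (bound n _)))
      (case₁ var! (case₁ var! (case₁ var! (case₁ (call! (var! ∷! var! ∷! []!) d)
        (case₁ (call! (var! ∷! var! ∷! []!) d′) lit!)))))
    where
    bound : ∀ n a → suc n + (suc n + 0) + suc a ≡ 2 * n + 3 + a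
    bound = solve-∀

  insert-run : ∀ {ℓ} (sts acc : List (State n)) → length (insert sts acc) ≤ ℓ →
               encL encState sts ∷ encL encState acc ∷ [] ⊩ code insert# ↠
               encL encState (insert sts acc) within length sts * (memberCalls n ℓ + 2)
  insert-run []         acc _ = case₀ var! var!
  insert-run {n} {ℓ} (st ∷ sts) acc h
    with weaken (*-monoˡ-≤ (2 * n + 3) (≤-trans (length-insert (st ∷ sts) acc) h))
                (member-run st acc)
  ... | d with does (member? st acc)
  ... | true  = weaken (≤-reflexive (bound (memberCalls n ℓ) _))
    (case₁ var! (call! (var! ∷! case₁ (call! (var! ∷! var! ∷! []!) d) var! ∷! []!)
      (insert-run sts acc h)))
    where
    bound : ∀ m a → suc m + 0 + 0 + suc a ≡ m + 2 + a
    bound = solve-∀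
  ... | false = weaken (≤-reflexive (bound (memberCalls n ℓ) _))
    (case₁ var! (call! (var! ∷! case₀ (call! (var! ∷! var! ∷! []!) d) (cons! var! var!) ∷! []!)
      (insert-run sts (st ∷ acc) h)))
    where
    bound : ∀ m a → suc m + 0 + 0 + suc a ≡ m + 2 + a
    bound = solve-∀

  expand-run : ∀ {ℓ} A (qs : Matrix p n) → p ≤ n → ∀ r u l acc →
               length (expand (succs A qs r u) l acc) ≤ ℓ →
               encRows A ∷ encRows qs ∷ encVertex u ∷ encℕ r ∷
               encL encState l ∷ encL encState acc ∷ [] ⊩ code expand# ↠
               encL encState (expand (succs A qs r u) l acc) within
               length l * (succsCalls n + insertCalls n ℓ + 3)
  expand-run         A qs p≤n r u []       acc h = case₀ var! var!
  expand-run {n = n} {ℓ} A qs p≤n r u (st ∷ l) acc h =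
    weaken (≤-reflexive (bound (succsCalls n) (insertCalls n ℓ) _))
      (case₁ var! (call! (var! ∷! var! ∷! var! ∷! var! ∷! var! ∷!
          call! (call! (var! ∷! var! ∷! var! ∷! var! ∷! var! ∷! []!)
                   (succs-run A qs p≤n r u st) ∷! var! ∷! []!)
            (weaken (*-monoˡ-≤ (memberCalls n ℓ + 2) (length-succs A qs r u st))
              (insert-run (succs A qs r u st) acc
                (≤-trans (length-expand (succs A qs r u) l _) h))) ∷! []!)
        (expand-run A qs p≤n r u l (insert (succs A qs r u st) acc) h)))
    where
    bound : ∀ s i a → suc s + 0 + suc i + 0 + suc a ≡ s + i + 3 + a
    bound = solve-∀

  sweep-run : ∀ {ℓ} A (qs : Matrix p n) → p ≤ n → ∀ r (us : Vec (Fin n) m) l →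
              Bounded ℓ A qs r us l →
              encRows A ∷ encRows qs ∷ encV encVertex us ∷ encℕ r ∷ encL encState l ∷ [] ⊩
              code sweep# ↠ encL encState (sweep A qs r us l) within m * (expandCalls n ℓ + 2)
  sweep-run A qs p≤n r []       l h       = case₀ var! var!
  sweep-run {n = n} {ℓ = ℓ} A qs p≤n r (u ∷ us) l (h , h′) =
    weaken (≤-reflexive (bound (expandCalls n ℓ) _))
      (case₁ var! (call! (var! ∷! var! ∷! var! ∷! var! ∷!
          call! (var! ∷! var! ∷! var! ∷! var! ∷! var! ∷! lit! ∷! []!)
            (weaken (*-monoˡ-≤ (succsCalls n + insertCalls n ℓ + 3) h)
              (expand-run A qs p≤n r u l [] (Bounded⇒≤ us h′))) ∷! []!)
        (sweep-run A qs p≤n r us (expand (succs A qs r u) l []) h′)))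
    where
    bound : ∀ e a → suc e + 0 + suc a ≡ e + 2 + a
    bound = solve-∀

  age-run : ∀ (l : List (State n)) →
            encL encState l ∷ [] ⊩ code age# ↠ encL encState (age l) within length l
  age-run []       = case₀ var! lit!
  age-run (st ∷ l) = case₁ var! (case₁ var! (cons! (cons! var! var!)
    (call! (var! ∷! []!) (age-run l))))

  full-run : ∀ (cur : Vec (Cell n) m) →
             encV encCell cur ∷ [] ⊩ code full# ↠ encBool (does (informed cur ≟S ⊤)) within m
  full-run []              = case₀ var! lit!
  full-run (nothing ∷ cur) = weaken z≤n (case₁ var! (case₀ var! lit!))
  full-run (just _ ∷ cur)  =
    case₁ var! (case₁ var! (call! (var! ∷! []!) (full-run cur)))

  -- Here `nil` can stand for `nothing` because a vector of cells is nonempty when `n` is positive;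
  -- this is what `0 < n` does in `loop-run`.
  encFound : Maybe (Vec (Cell n) n) → Tree
  encFound nothing    = nil
  encFound (just cur) = encV encCell cur

  firstFull-run : ∀ (l : List (State n)) →
                  encL encState l ∷ [] ⊩ code firstFull# ↠ encFound (firstFull l) within
                  length l * (n + 2)
  firstFull-run [] = case₀ var! lit!
  firstFull-run {n} ((old , cur) ∷ l)
    with does (informed cur ≟S ⊤) | full-run cur | firstFull-run l
  ... | true  | d | ih =
    weaken (≤-trans (m≤m+n _ (suc _)) (≤-reflexive (bound n _)))
      (case₁ var! (case₁ var! (case₁ (call! (var! ∷! []!) d) var!)))
    where
    bound : ∀ n a → suc n + 0 + suc a ≡ n + 2 + a
    bound = solve-∀
  ... | false | d | ih =
    weaken (≤-reflexive (bound n _))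
      (case₁ var! (case₁ var! (case₀ (call! (var! ∷! []!) d) (call! (var! ∷! []!) ih))))
    where
    bound : ∀ n a → suc n + suc a ≡ n + 2 + a
    bound = solve-∀

  hit-run : ∀ (c : Cell n) u d →
            encCell c ∷ encVertex u ∷ encℕ d ∷ [] ⊩ code hit# ↠ encℕ (hit c u d) within suc n
  hit-run nothing        u d = weaken z≤n (case₀ var! var!)
  hit-run (just (k , w)) u d with does (w Fin.≟ u) | eq-run w u
  ... | true  | e =
    weaken (≤-reflexive (+-identityʳ _))
      (case₁ var! (case₁ (call! (var! ∷! var! ∷! []!) e) var!))
  ... | false | e =
    weaken (≤-reflexive (+-identityʳ _))
      (case₁ var! (case₀ (call! (var! ∷! var! ∷! []!) e) var!))

  row-run : ∀ (us : Vec (Fin n) m) u cur →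
            encV encVertex us ∷ encVertex u ∷ encV encCell cur ∷ [] ⊩ code row# ↠
            encV (encℕ ∘ entry cur u) us within m * (4 * n + 7)
  row-run []       u cur = case₀ var! lit!
  row-run {n} (v ∷ us) u cur =
    weaken (≤-reflexive (bound n _))
      (case₁ var! (cons!
        (call! (call! (var! ∷! var! ∷! []!) (nth-run encCell cur v) ∷! var! ∷!
                call! (call! (var! ∷! var! ∷! []!) (nth-run encCell cur u) ∷! var! ∷! lit! ∷! []!)
                  (hit-run (lookup cur u) v 0) ∷! []!)
          (hit-run (lookup cur v) u (hit (lookup cur u) v 0)))
        (call! (var! ∷! var! ∷! var! ∷! []!) (row-run us u cur))))
    where
    bound : ∀ n a → suc n + (suc n + 0 + suc (suc n) + 0) + suc (suc n) + suc a ≡ 4 * n + 7 + a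
    bound = solve-∀

  matrix-run : ∀ (us′ : Vec (Fin n) m) (us : Vec (Fin n) n) cur →
               encV encVertex us′ ∷ encV encVertex us ∷ encV encCell cur ∷ [] ⊩ code matrix# ↠
               encV (λ u → encV (encℕ ∘ entry cur u) us) us′ within m * (rowCalls n + 2)
  matrix-run []        us cur = case₀ var! lit!
  matrix-run {n} (u ∷ us′) us cur =
    weaken (≤-reflexive (bound (rowCalls n) _))
      (case₁ var! (cons! (call! (var! ∷! var! ∷! var! ∷! []!) (row-run us u cur))
        (call! (var! ∷! var! ∷! var! ∷! []!) (matrix-run us′ us cur))))
    where
    bound : ∀ r a → suc r + suc a ≡ r + 2 + a
    bound = solve-∀

  private
    arithP : ∀ p l → 2 + 2 * (p + l) ≡ 2 * (suc p + l)
    arithP = solve-∀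
    arithL : ∀ p l → 2 + 2 * (p + l) ≡ 2 * (p + suc l)
    arithL = solve-∀

  log-run : ∀ {M l} (xs : List A) (e : A → Tree) → length xs ≤ M → length xs ≡ m → Log m l →
            encL e xs ∷ [] ⊩ code log# ↠ encℕ l within l * (M + 2)
  log-run []           e ≤M refl none = case₀ var! lit!
  log-run (x ∷ [])     e ≤M refl one  = case₁ var! (case₀ var! lit!)
  log-run {M = M} (x ∷ y ∷ xs) e ≤M refl (more {l = l} lg) with half-run (x ∷ y ∷ xs) e
  ... | ys , eq , d =
    weaken (≤-trans (+-monoˡ-≤ (suc (l * (M + 2))) (+-monoˡ-≤ 0 (s≤s ≤M)))
                    (≤-reflexive (bound M (l * (M + 2)))))
      (case₁ var! (case₁ var! (cons! lit! (call! (call! (var! ∷! []!) d ∷! []!)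
        (log-run ys e (≤-trans (≤-reflexive eq) (≤-trans (⌈n/2⌉≤n (2 + length xs)) ≤M)) eq lg)))))
    where
    bound : ∀ m a → suc m + 0 + suc a ≡ m + 2 + a
    bound = solve-∀

  -- When a letter asks for a numeral that is used up, the side of the line on which the word stands
  -- settles the comparison, since what is left of the other numeral can only strengthen it. `N`
  -- bounds the number of calls.
  test-run : ∀ {a b w₀} (e : A → Tree) cover → W ≡ nil ∙ w₀ → Word a b 0 0 W →
             ∀ N (xs : Vec A p) l {w} → isNil w + 2 * (p + l) ≤ N →
             ∀ P L {i j} → Word a b i j w → a * P + b * j ≡ b * L + a * i →
             ∃[ mode ]
               (encV e xs ∷ encℕ l ∷ w ∷ W ∷ cover ∷ [] ⊩ code test# ↠ mode within N) ×
               (mode ≡ cover × a * (P + p) ≤ b * (L + l) ⊎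
                mode ≡ nil × b * (L + l) < a * (P + p))
  test-run e cover refl W-ok zero    xs l () P L (end _) inv
  test-run {a = a} {b} e cover refl W-ok (suc N) xs l (s≤s h) P L {i} {j} (end eq) inv
    with mode , d , spec ← test-run e cover refl W-ok N xs l h P L W-ok
           (restart a b inv eq)
    = mode , case₀ var! (call! (var! ∷! var! ∷! var! ∷! var! ∷! var! ∷! []!) d) , spec
  test-run {a = a} {b} e cover refl W-ok N [] l h P L {i} {j} ((p∷ ai≤bj) _) inv =
    cover , weaken z≤n (case₁ var! (case₀ var! (case₀ var! var!))) ,
    inj₁ (refl , (begin
      a * (P + 0) ≡⟨ cong (a *_) (+-identityʳ P) ⟩
      a * P       ≤⟨ +-cancelʳ-≤ (b * j) (a * P) (b * L)
                       (≤-trans (≤-reflexive inv) (+-monoʳ-≤ (b * L) ai≤bj)) ⟩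
      b * L       ≤⟨ *-monoʳ-≤ b (m≤m+n L l) ⟩
      b * (L + l) ∎))
    where open ≤-Reasoning
  test-run {p = suc p} {a = a} {b} e cover refl W-ok (suc N) (x ∷ xs) l h P L {i} {j}
    ((p∷_ {w = w} _) w-ok) inv
    with mode , d , spec ← test-run e cover refl W-ok N xs l {w}
           (≤-pred (≤-trans (+-monoˡ-≤ (2 * (p + l)) (s≤s (isNil≤1 w)))
             (≤-trans (≤-reflexive (arithP p l)) h)))
           (suc P) L w-ok (step-p a b P i inv)
    = mode
    , case₁ var! (case₀ var! (case₁ var!
        (call! (var! ∷! var! ∷! var! ∷! var! ∷! var! ∷! []!) d)))
    , subst (λ k → mode ≡ cover × a * k ≤ b * (L + l) ⊎ mode ≡ nil × b * (L + l) < a * k)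
        (sym (+-suc P p)) spec
  test-run {p = p} {a = a} {b} e cover refl W-ok N xs zero h P L {i} {j} ((l∷ bj<ai) _) inv =
    nil , weaken z≤n (case₁ var! (case₁ var! (case₀ var! lit!))) ,
    inj₂ (refl , (begin-strict
      b * (L + 0) ≡⟨ cong (b *_) (+-identityʳ L) ⟩
      b * L       <⟨ +-cancelʳ-< (a * i) (b * L) (a * P) (begin-strict
                       b * L + a * i ≡⟨ inv ⟨
                       a * P + b * j <⟨ +-monoʳ-< (a * P) bj<ai ⟩
                       a * P + a * i ∎) ⟩
      a * P       ≤⟨ *-monoʳ-≤ a (m≤m+n P p) ⟩
      a * (P + p) ∎))
    where open ≤-Reasoning
  test-run {p = p} {a = a} {b} e cover refl W-ok zero xs (suc l) h P L ((l∷ _) _) inv =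
    contradiction (≤-trans (≤-reflexive (sym (arith p l))) h) λ ()
    where
    arith : ∀ p l → 2 * (p + suc l) ≡ suc (suc (2 * (p + l)))
    arith = solve-∀
  test-run {p = p} {a = a} {b} e cover refl W-ok (suc N) xs (suc l) h P L {i} {j}
    ((l∷_ {w = w} _) w-ok) inv
    with mode , d , spec ← test-run e cover refl W-ok N xs l {w}
           (≤-pred (≤-trans (+-monoˡ-≤ (2 * (p + l)) (s≤s (isNil≤1 w)))
             (≤-trans (≤-reflexive (arithL p l)) h)))
           P (suc L) w-ok (step-l a b L j inv)
    = mode
    , case₁ var! (case₁ var! (case₁ var!
        (call! (var! ∷! var! ∷! var! ∷! var! ∷! var! ∷! []!) d)))
    , subst (λ k → mode ≡ cover × a * (P + p) ≤ b * k ⊎ mode ≡ nil × b * k < a * (P + p))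
        (sym (+-suc L l)) spec

  loop-run : ∀ {ℓ} A (qs : Matrix p n) → p ≤ n → 0 < n → ∀ {r l j cur} →
             Search ℓ A qs r l j cur →
             encRows A ∷ encRows qs ∷ encV encVertex (Vec.allFin n) ∷ encℕ r ∷
             encL encState l ∷ [] ⊩ code loop# ↠ encOutput cur within
             j * roundCalls n ℓ + (ℓ * (n + 2) + n * (rowCalls n + 2) + 2)
  loop-run {n = suc n} {ℓ} A qs p≤n 0<n {l = l} {cur = c ∷ cs} (found small eq)
    with d ← weaken (*-monoˡ-≤ (suc n + 2) small) (firstFull-run l)
    rewrite eq | encMatrix≡encV encℕ (entry (c ∷ cs)) =
    weaken (≤-reflexive (bound (ℓ * (suc n + 2)) _))
      (bind! (call! (var! ∷! []!) d) (case₁ var!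
        (call! (var! ∷! var! ∷! var! ∷! []!)
          (matrix-run (Vec.allFin (suc n)) (Vec.allFin (suc n)) (c ∷ cs)))))
    where
    bound : ∀ a b → suc a + suc b ≡ a + b + 2
    bound = solve-∀
  loop-run {n = n} {ℓ} A qs p≤n 0<n {r} {l} (round {j = j} small eq small′ s)
    with d ← weaken (*-monoˡ-≤ (n + 2) small) (firstFull-run l)
    rewrite eq =
    weaken (≤-reflexive (bound (ℓ * (n + 2)) ℓ (sweepCalls n ℓ) _ _))
      (bind! (call! (var! ∷! []!) d) (case₀ var!
        (call! (var! ∷! var! ∷! var! ∷! cons! lit! var! ∷!
            call! (var! ∷! var! ∷! var! ∷! cons! lit! var! ∷!
                call! (var! ∷! []!) (weaken small (age-run l)) ∷! []!)
              (sweep-run A qs p≤n (suc r) (Vec.allFin n) (age l) small′) ∷! []!)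
          (loop-run A qs p≤n 0<n s))))
    where
    bound : ∀ a ℓ s j e → suc a + (suc ℓ + 0 + suc s + 0 + suc (j + e)) ≡
                          a + ℓ + s + 4 + j + e
    bound = solve-∀

  main-run : ∀ {ℓ p′ l w₀ A ct cl} {qs : Matrix (suc p) n} (mode : Matrix p′ n) {s j cur} →
             p′ ≤ n → 0 < n →
             encRows A ∷ [] ⊩ code log# ↠ encℕ l within cl →
             encRows (Vec.tail qs) ∷ encℕ l ∷ W ∷ W ∷ encRows qs ∷ [] ⊩
               code test# ↠ encRows mode within ct →
             Search ℓ A mode 0 (firstState s ∷ []) j cur → W ≡ nil ∙ w₀ →
             (encRows A ∙ encVertex s ∙ encRows qs) ∷ [] ⊩
               start! W ↠ encOutput cur within
               ct + cl + n + n * (n + 2) + (j * roundCalls n ℓ + (ℓ * (n + 2) + n * (rowCalls n + 2) + 2)) + 5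
  main-run {n = n} {ℓ} {A = A} {qs = q ∷ qs} mode {s} p′≤n 0<n log-d test-d search eq
    with loop-run A mode p′≤n 0<n search
  ... | loop-d =
    weaken (≤-reflexive (bound _ _ n (n * (n + 2)) _))
      (case₁ var! (case₁ var! (case₁ var!
        (bind! (call! (var! ∷! call! (var! ∷! []!) log-d ∷! lit! ∷! lit! ∷! var! ∷! []!) test-d)
        (bind! (call! (var! ∷! lit! ∷! []!)
                 (names-run (encV encBool) A 0 id λ _ → refl))
        (bind! (call! (var! ∷! var! ∷! []!) (init-run (Vec.allFin n) s))
        (call! (var! ∷! var! ∷! var! ∷! lit! ∷! cons! (cons! var! var!) lit! ∷! []!)
          loop-d)))))))
    where
    bound : ∀ t l n i s → suc l + 0 + suc t + (suc n + (suc i + suc s)) ≡ t + l + n + i + s + 5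
    bound = solve-∀

-- Rounds, sender by sender

lookup-[]≔ : ∀ (xs : Vec A n) v x w →
             (w ≡ v × lookup (xs [ v ]≔ x) w ≡ x) ⊎
             (w ≢ v × lookup (xs [ v ]≔ x) w ≡ lookup xs w)
lookup-[]≔ xs v x w with w Fin.≟ v
... | yes refl = inj₁ (refl , Vec.lookup∘update w xs x)
... | no w≢v   = inj₂ (w≢v , Vec.lookup∘update′ w≢v xs x)

∣[]≔∣ : ∀ (C : Subset n) v → lookup C v ≡ false → ∣ C [ v ]≔ true ∣ ≡ suc ∣ C ∣
∣[]≔∣ (false ∷ C) zero    h = refl
∣[]≔∣ (true ∷ C)  (suc v) h = cong suc (∣[]≔∣ C v h)
∣[]≔∣ (false ∷ C) (suc v) h = ∣[]≔∣ C v h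

true≢false : {P : Set} {b : Bool} → b ≡ true → b ≡ false → P
true≢false refl ()

data Step (G : Graph n) (O : Subset n) (u : Fin n) (C : Subset n) : Subset n → Set where
  idle : Step G O u C C
  send : ∀ {v} → lookup O u ≡ true → lookup C v ≡ false → adj G u v ≡ true →
         Step G O u C (C [ v ]≔ true)

data Sweep (G : Graph n) (O : Subset n) : Vec (Fin n) m → Subset n → Subset n → Set where
  []  : ∀ {C} → Sweep G O [] C C
  _∷_ : ∀ {u} {us : Vec (Fin n) m} {C C′ C″} → Step G O u C C′ → Sweep G O us C′ C″ →
        Sweep G O (u ∷ us) C C″

data Reach (G : Graph n) (s : Fin n) : ℕ → Subset n → Set where
  start : Reach G s 0 ⁅ s ⁆
  next  : ∀ {t S S′} → Reach G s t S → Sweep G S (Vec.allFin n) S S′ → Reach G s (suc t) S′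

⇒∈ : ∀ {S : Subset n} {v} → lookup S v ≡ true → v ∈ S
⇒∈ {S = S} {v} = Vec.lookup⇒[]= v S

T⇒true : ∀ {b} → T b → b ≡ true
T⇒true {true} _ = refl

true⇒T : ∀ {b} → b ≡ true → T b
true⇒T refl = tt

⊆[]≔ : ∀ (C : Subset n) v {w} → w ∈ C → w ∈ C [ v ]≔ true
⊆[]≔ C v {w} w∈ with lookup-[]≔ C v true w
... | inj₁ (_ , e) = ⇒∈ e
... | inj₂ (_ , e) = ⇒∈ (trans e (Vec.[]=⇒lookup w∈))

module _ {G : Graph n} {S S′ : Subset n} (R : Round G S S′) where
  open Round R using (valid; result)

  private
    stay : ∀ {C u v} → (∀ {w} → w ∈ C → w ∈ S′) → Round.send R u ≡ just v →
           ∀ {w} → w ∈ C [ v ]≔ true → w ∈ S′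
    stay {C} {u} {v} C⊆ eq {w} w∈ with lookup-[]≔ C v true w
    ... | inj₁ (refl , _) = Equivalence.from (result w) (inj₂ (u , eq))
    ... | inj₂ (_ , e)    = C⊆ (⇒∈ (trans (sym e) (Vec.[]=⇒lookup w∈)))

  -- If two senders choose the same vertex, then only the first one sends.
  sequential : ∀ (us : Vec (Fin n) m) C → (∀ {v} → v ∈ C → v ∈ S′) →
               ∃[ C′ ] Sweep G S us C C′ × (∀ {v} → v ∈ C → v ∈ C′) ×
               (∀ {v} → v ∈ C′ → v ∈ S′) ×
               (∀ {u v} → u Vec.∈ us → Round.send R u ≡ just v → v ∈ C′)
  sequential []       C C⊆ = C , [] , id , C⊆ , λ ()
  sequential (u ∷ us) C C⊆ with Round.send R u in eq
  ... | nothing with C′ , sw , ⊆C′ , C′⊆ , h ← sequential us C C⊆ =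
    C′ , idle ∷ sw , ⊆C′ , C′⊆ , λ where
      (here refl) e → case trans (sym eq) e of λ ()
      (there i)   e → h i e
  ... | just v with lookup C v in eqv
  ...   | true with C′ , sw , ⊆C′ , C′⊆ , h ← sequential us C C⊆ =
    C′ , idle ∷ sw , ⊆C′ , C′⊆ , λ where
      (here refl) e → subst (_∈ C′) (just-injective (trans (sym eq) e)) (⊆C′ (⇒∈ eqv))
      (there i)   e → h i e
  ...   | false with C′ , sw , ⊆C′ , C′⊆ , h ← sequential us (C [ v ]≔ true) (stay C⊆ eq) =
    C′ , send (Vec.[]=⇒lookup (proj₁ (valid eq))) eqv (T⇒true (proj₂ (proj₂ (valid eq)))) ∷ sw ,
    ⊆C′ ∘ ⊆[]≔ C v , C′⊆ , λ where
      (here refl) e → subst (_∈ C′) (just-injective (trans (sym eq) e))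
                        (⊆C′ (⇒∈ (Vec.lookup∘update v C true)))
      (there i)   e → h i e

  Round⇒Sweep : Sweep G S (Vec.allFin n) S S′
  Round⇒Sweep
    with C′ , sw , ⊆C′ , C′⊆ , h ← sequential (Vec.allFin n) S
           (λ {v} v∈ → Equivalence.from (result v) (inj₁ v∈)) =
    subst (Sweep G S (Vec.allFin n) S) (Subset.⊆-antisym C′⊆ S′⊆) sw
    where
    S′⊆ : S′ ⊆ C′
    S′⊆ {v} v∈ with Equivalence.to (result v) v∈
    ... | inj₁ v∈S     = ⊆C′ v∈S
    ... | inj₂ (u , e) = h (Vec.∈-allFin⁺ u) e

-- Carries lower bounds from sweeps over to b(G,s). That the output is a legal protocol rests on
-- `Scheme` instead.
Informed⇒Reach : ∀ {G : Graph n} {s t S} → Informed G s t S → Reach G s t S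
Informed⇒Reach start      = start
Informed⇒Reach (next i R) = next (Informed⇒Reach i) (Round⇒Sweep R)

-- The second summand counts the listed vertices of `O`, each of which adds at most one. Over a full
-- round this is the number of vertices informed at its start, whence the doubling.
∣Sweep∣ : ∀ {G : Graph n} {O C C′} {us : Vec (Fin n) m} → Sweep G O us C C′ →
          ∣ C′ ∣ ≤ ∣ C ∣ + ∣ Vec.map (lookup O) us ∣
∣Sweep∣ [] = m≤m+n _ 0
∣Sweep∣ {O = O} {C} {us = u ∷ us} (idle ∷ sw) =
  ≤-trans (∣Sweep∣ sw) (+-monoʳ-≤ ∣ C ∣ (Subset.∣p∣≤∣x∷p∣ (lookup O u) (Vec.map (lookup O) us)))
∣Sweep∣ {O = O} {C} {us = u ∷ us} (send {v} Ou Cv _ ∷ sw) rewrite Ou =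
  ≤-trans (∣Sweep∣ sw) (≤-reflexive (trans (cong (_+ ∣ Vec.map (lookup O) us ∣) (∣[]≔∣ C v Cv))
    (sym (+-suc ∣ C ∣ _))))

∣Reach∣ : ∀ {G : Graph n} {s t S} → Reach G s t S → ∣ S ∣ ≤ 2 ^ t
∣Reach∣ {s = s} start = ≤-reflexive (Subset.∣⁅x⁆∣≡1 s)
∣Reach∣ (next {t} {S} r sw) = ≤-trans (∣Sweep∣ sw) (≤-trans
  (+-mono-≤ (∣Reach∣ r) (≤-trans (≤-reflexive (cong ∣_∣ (Vec.map-lookup-allFin S))) (∣Reach∣ r)))
  (≤-reflexive (doubling t)))

-- Protocols from parents and rounds

record Scheme (G : Graph n) (s : Fin n) (t : ℕ) : Set where
  field
    par      : Fin n → Fin n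
    rnd      : Fin n → ℕ
    par-root : par s ≡ s
    rnd-root : rnd s ≡ 0
    par-adj  : ∀ {v} → v ≢ s → Adj G (par v) v
    par-rnd  : ∀ {v} → v ≢ s → rnd (par v) < rnd v
    distinct : ∀ {v w} → par v ≡ par w → rnd v ≡ rnd w → v ≡ w
    rnd-max  : ∀ v → rnd v ≤ t

  label : Fin n → Fin n → ℕ
  label u v =
    if does (par v Fin.≟ u) then rnd v else if does (par u Fin.≟ v) then rnd u else 0

  Child : Fin n → Fin n → Set
  Child u v = v ≢ s × par v ≡ u

  nonzero : ℕ → Bool
  nonzero zero    = false
  nonzero (suc _) = true

  rnd⇒≢root : ∀ {v k} → rnd v ≡ suc k → v ≢ s
  rnd⇒≢root e refl = 0≢1+n (trans (sym rnd-root) e)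

  child-< : ∀ {u v} → Child u v → rnd u < rnd v
  child-< (v≢s , refl) = par-rnd v≢s

  -- Rounds increase from parent to child, so both vertices must be the root. This makes `label`
  -- independent of the endpoint that is asked first.
  mutual-parents : ∀ {u v} → par u ≡ v → par v ≡ u → u ≡ v
  mutual-parents {u} {v} pu pv with u Fin.≟ s | v Fin.≟ s
  ... | yes refl | _        = trans (sym par-root) pu
  ... | no _     | yes refl = trans (sym pv) par-root
  ... | no u≢s   | no v≢s   =
    contradiction (child-< (u≢s , pu)) (<-asym (child-< (v≢s , pv)))

  label-sym : ∀ u v → label u v ≡ label v u
  label-sym u v with par v Fin.≟ u | par u Fin.≟ v
  ... | yes p | yes q = cong rnd (sym (mutual-parents q p))
  ... | yes _ | no _  = refl
  ... | no _  | yes _ = refl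
  ... | no _  | no _  = refl

  label-child : ∀ {u v} → Child u v → label u v ≡ rnd v
  label-child {u} {v} (_ , p) with par v Fin.≟ u
  ... | yes _ = refl
  ... | no ¬p = contradiction p ¬p

  label-parent : ∀ {u v} → Child v u → label u v ≡ rnd u
  label-parent {u} {v} c = trans (label-sym u v) (label-child c)

  edge : ∀ {u v} → T (nonzero (label u v)) → Child u v ⊎ Child v u
  edge {u} {v} h with par v Fin.≟ u
  ... | yes p with rnd v in e
  ...   | suc _ = inj₁ (rnd⇒≢root e , p)
  edge {u} {v} h | no _ with par u Fin.≟ v
  ... | yes q with rnd u in e
  ...   | suc _ = inj₂ (rnd⇒≢root e , q)

  treeGraph : Graph n
  treeGraph = record
    { adj        = λ u v → nonzero (label u v)
    ; adj-sym    = λ u v → cong nonzero (label-sym u v)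
    ; adj-irrefl = λ v → cong nonzero (loopless v)
    }
    where
    loopless : ∀ v → label v v ≡ 0
    loopless v with par v Fin.≟ v
    ... | no _ = refl
    ... | yes p with v Fin.≟ s
    ...   | yes refl = rnd-root
    ...   | no v≢s   = contradiction (child-< (v≢s , p)) (<-irrefl refl)

  child-adj : ∀ {u v} → Child u v → Adj treeGraph u v
  child-adj {u} {v} c with rnd v | label-child c | child-< c
  ... | suc _ | e | _ rewrite e = tt

  parent-adj : ∀ {u v} → Child u v → Adj treeGraph v u
  parent-adj {u} {v} c = subst T (adj-sym treeGraph u v) (child-adj c)

  private
    infixr 5 _++_

    _++_ : ∀ {x y z vs ws} → Walk treeGraph x y vs → Walk treeGraph y z ws →
           ∃[ us ] Walk treeGraph x z us
    stop _   ++ w = _ , w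
    step e v ++ w = _ , step e (proj₂ (v ++ w))

  root-to : ∀ v → Acc _<_ (rnd v) →
            ∃[ vs ] Walk treeGraph s v vs × ∃[ ws ] Walk treeGraph v s ws
  root-to v (below rec) with v Fin.≟ s
  ... | yes refl = _ , stop s , _ , stop s
  ... | no v≢s with _ , down , _ , up ← root-to (par v) (rec (par-rnd v≢s)) =
    _ , proj₂ (down ++ step (child-adj (v≢s , refl)) (stop v)) ,
    _ , step (parent-adj (v≢s , refl)) up

  connected : Connected treeGraph
  connected u v with _ , _ , _ , up ← root-to u (<-wellFounded _)
                   | _ , down , _ ← root-to v (<-wellFounded _) = up ++ down

  first∈ : ∀ {x z vs} → Walk treeGraph x z vs → x List.∈ vs
  first∈ (stop _)   = here refl
  first∈ (step _ _) = here refl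

  closed : ∀ {x vs} → Walk treeGraph x x vs → Unique vs → vs ≡ x ∷ []
  closed (stop _)   _       = refl
  closed (step e w) (x∉ ∷ _) = contradiction refl (All.lookup x∉ (last∈ w))
    where
    last∈ : ∀ {x z vs} → Walk treeGraph x z vs → z List.∈ vs
    last∈ (stop _)   = here refl
    last∈ (step _ w) = there (last∈ w)

  -- A path that has once gone from a parent to a child keeps descending.
  descend : ∀ {x y z vs} → Child x y → Walk treeGraph y z vs → x List.∉ vs → Unique vs →
            rnd x < rnd z × ((z ≡ y × vs ≡ y ∷ []) ⊎ par z List.∈ vs)
  descend c (stop _) _ _ = child-< c , inj₁ (refl , refl)
  descend c (step e w) x∉ (y∉ ∷ u) with edge e
  ... | inj₂ (_ , refl) =
    contradiction (there (subst (List._∈ _) (proj₂ c) (first∈ w))) x∉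
  ... | inj₁ c′ with descend c′ w (λ y∈ → All.lookup y∉ y∈ refl) u
  ...   | lt , inj₁ (refl , refl) = <-trans (child-< c) lt , inj₂ (here (proj₂ c′))
  ...   | lt , inj₂ p∈            = <-trans (child-< c) lt , inj₂ (there p∈)

  -- A path climbs first and then descends for good. If it descends at all, it enters `z` from its
  -- parent; otherwise the rounds decrease all along.
  ascend : ∀ {x z vs} → Walk treeGraph x z vs → Unique vs →
           par z List.∈ vs ⊎ rnd z ≤ rnd x
  ascend (stop _) _ = inj₂ ≤-refl
  ascend (step e w) (x∉ ∷ u) with edge e
  ... | inj₁ c with descend c w (λ x∈ → All.lookup x∉ x∈ refl) u
  ...   | _ , inj₁ (refl , _) = inj₁ (here (proj₂ c))
  ...   | _ , inj₂ p∈         = inj₁ (there p∈)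
  ascend (step e w) (x∉ ∷ u) | inj₂ c with ascend w u
  ...   | inj₁ p∈ = inj₁ (there p∈)
  ...   | inj₂ le = inj₂ (≤-trans le (<⇒≤ (child-< c)))

  -- The closing edge is compared with the first edge of the path. According to which of the two
  -- lead from parent to child, the path returns to `u`, or the rounds increase around a cycle, or
  -- the path is a single edge.
  acyclic : Acyclic treeGraph
  acyclic u v _ (stop _ , _) (s≤s ()) _
  acyclic u v _ (step e w , u∉ ∷ uniq) 3≤ back with edge e | edge back
  ... | inj₁ c | inj₂ (_ , refl)
    with descend c w (λ u∈ → All.lookup u∉ u∈ refl) uniq
  ...   | _ , inj₁ (_ , refl) = contradiction 3≤ λ { (s≤s (s≤s ())) }
  ...   | _ , inj₂ p∈         = All.lookup u∉ p∈ refl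
  acyclic u v _ (step e w , u∉ ∷ uniq) 3≤ back | inj₁ c | inj₁ c′ =
    <-asym (child-< c′) (proj₁ (descend c w (λ u∈ → All.lookup u∉ u∈ refl) uniq))
  acyclic u v _ (step e w , u∉ ∷ uniq) 3≤ back | inj₂ c | inj₂ c′ with ascend w uniq
  ... | inj₁ p∈ = All.lookup u∉ (subst (List._∈ _) (proj₂ c′) p∈) refl
  ... | inj₂ le = <-irrefl refl (<-trans (child-< c′) (≤-<-trans le (child-< c)))
  acyclic u v _ (step e w , u∉ ∷ uniq) 3≤ back | inj₂ (_ , refl) | inj₁ (_ , refl)
    with closed w uniq
  ... | refl = contradiction 3≤ λ { (s≤s (s≤s ())) }

  -- Otherwise `u` would be a child of `v`, and a path from the root enters `u` from its parent,
  -- contrary to `v` being off the path.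
  parent-child : ∀ {u v} → IsParent treeGraph s u v → Child u v
  parent-child (_ , (w , uniq) , e , v∉) with edge e
  ... | inj₁ c = c
  parent-child (_ , (stop _ , uniq) , e , v∉) | inj₂ (u≢s , _) = contradiction refl u≢s
  parent-child (_ , (step e′ w , s∉ ∷ uniq) , e , v∉) | inj₂ (u≢s , refl) with edge e′
  ... | inj₂ (s≢s , _) = contradiction refl s≢s
  ... | inj₁ c with descend c w (λ s∈ → All.lookup s∉ s∈ refl) uniq
  ...   | _ , inj₁ (refl , _) = contradiction (here (proj₂ c)) v∉
  ...   | _ , inj₂ p∈         = contradiction (there p∈) v∉

  label-range : ∀ {u v} → Adj treeGraph u v → 1 ≤ label u v × label u v ≤ t
  label-range {u} {v} e with edge e
  ... | inj₁ c rewrite label-child c  = ≤-trans (s≤s z≤n) (child-< c) , rnd-max v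
  ... | inj₂ c rewrite label-parent c = ≤-trans (s≤s z≤n) (child-< c) , rnd-max u

  label-proper : ∀ {u v w} → Adj treeGraph u v → Adj treeGraph u w → v ≢ w →
                 label u v ≢ label u w
  label-proper {u} {v} {w} e f v≢w eq with edge e | edge f
  ... | inj₁ c | inj₁ d = v≢w (distinct (trans (proj₂ c) (sym (proj₂ d)))
          (trans (sym (label-child c)) (trans eq (label-child d))))
  ... | inj₁ c | inj₂ d =
    <-irrefl (trans (sym (label-parent d)) (trans (sym eq) (label-child c))) (child-< c)
  ... | inj₂ c | inj₁ d =
    <-irrefl (trans (sym (label-parent c)) (trans eq (label-child d))) (child-< d)
  ... | inj₂ c | inj₂ d = v≢w (trans (sym (proj₂ c)) (proj₂ d))

  label-min : ∀ {u v w} → IsParent treeGraph s u v → Adj treeGraph v w → label v u ≤ label v w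
  label-min {u} {v} {w} h e with parent-child h | edge e
  ... | c | inj₁ d rewrite label-parent c | label-child d = <⇒≤ (child-< d)
  ... | c | inj₂ d rewrite label-parent c | label-parent d = ≤-refl

  protocol : Protocol G s t
  protocol = record
    { tree       = treeGraph
    ; subgraph   = λ {u} {v} e → case edge e of λ where
        (inj₁ (v≢s , refl)) → par-adj v≢s
        (inj₂ (u≢s , refl)) → subst T (adj-sym G v u) (par-adj u≢s)
    ; isTree     = connected , acyclic
    ; τ          = label
    ; τ-sym      = λ {u} {v} _ → label-sym u v
    ; τ-range    = label-range
    ; τ-proper   = label-proper
    ; parent-min = label-min
    }

  encProtocol≡ : encProtocol protocol ≡ encMatrix λ u v → encℕ (label u v)
  encProtocol≡ = encFamily-cong λ u → encFamily-cong λ v → cong encℕ (if-nonzero (label u v))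
    where
    if-nonzero : ∀ k → (if nonzero k then k else 0) ≡ k
    if-nonzero zero    = refl
    if-nonzero (suc _) = refl

-- Invariants of the states

lookup-adjacency : ∀ (G : Graph n) u v → lookup (lookup (adjacency G) u) v ≡ adj G u v
lookup-adjacency G u v = trans
  (cong (λ row → lookup row v) (Vec.lookup∘tabulate (λ u → Vec.tabulate (adj G u)) u))
  (Vec.lookup∘tabulate (adj G u) v)

lookup-ext : ∀ {xs ys : Vec A n} → (∀ i → lookup xs i ≡ lookup ys i) → xs ≡ ys
lookup-ext {xs = xs} {ys} h =
  trans (sym (Vec.tabulate∘lookup xs)) (trans (Vec.tabulate-cong h) (Vec.tabulate∘lookup ys))

lookup-informed : ∀ (cur : Vec (Cell n) m) v → lookup (informed cur) v ≡ is-just (lookup cur v)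
lookup-informed cur v = Vec.lookup-map v is-just cur

informed⇒just : ∀ (cur : Vec (Cell n) m) {v} → lookup (informed cur) v ≡ true →
                ∃[ c ] lookup cur v ≡ just c
informed⇒just cur {v} h with lookup cur v | lookup-informed cur v
... | just c  | _ = c , refl
... | nothing | e = true≢false h e

just⇒informed : ∀ (cur : Vec (Cell n) m) {v c} → lookup cur v ≡ just c →
                lookup (informed cur) v ≡ true
just⇒informed cur {v} h = trans (lookup-informed cur v) (cong is-just h)

uninformed⇒nothing : ∀ (cur : Vec (Cell n) m) {v} → lookup (informed cur) v ≡ false →
                     lookup cur v ≡ nothing
uninformed⇒nothing cur {v} h with lookup cur v | lookup-informed cur v
... | nothing | _ = refl
... | just _  | e = true≢false e h

nothing⇒uninformed : ∀ (cur : Vec (Cell n) m) {v} → lookup cur v ≡ nothing →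
                     lookup (informed cur) v ≡ false
nothing⇒uninformed cur {v} h = trans (lookup-informed cur v) (cong is-just h)

Put : ℕ × Fin n → Vec Bool m → Vec Bool m → Vec (Cell n) m → Vec (Cell n) m → Set
Put x as bs cs ds = ∃[ v ] lookup as v ≡ true × lookup bs v ≡ true ×
                    lookup cs v ≡ nothing × ds ≡ cs [ v ]≔ just x

sends-sound : ∀ x (as bs : Vec Bool m) (cs : Vec (Cell n) m) →
              All (Put x as bs cs) (sends x as bs cs)
sends-sound x []       []       []       = []
sends-sound x (a ∷ as) (b ∷ bs) (c ∷ cs)
  with rest ← All.map⁺ {P = Put x (a ∷ as) (b ∷ bs) (c ∷ cs)} {f = c ∷_} (All.map
         (λ { (v , h₁ , h₂ , h₃ , e) → suc v , h₁ , h₂ , h₃ , cong (c ∷_) e })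
         (sends-sound x as bs cs))
  with a | b | c
... | true  | true  | nothing = (zero , refl , refl , refl , refl) ∷ rest
... | true  | true  | just _  = rest
... | true  | false | _       = rest
... | false | _     | _       = rest

sends-complete : ∀ x (as bs : Vec Bool m) (cs : Vec (Cell n) m) v →
                 lookup as v ≡ true → lookup bs v ≡ true → lookup cs v ≡ nothing →
                 (cs [ v ]≔ just x) List.∈ sends x as bs cs
sends-complete x (true ∷ as) (true ∷ bs) (nothing ∷ cs) zero refl refl refl = here refl
sends-complete x (a ∷ as)    (b ∷ bs)    (c ∷ cs)       (suc v) h₁ h₂ h₃
  with rest ← Any.map⁺ {f = c ∷_} (Any.map (cong (c ∷_)) (sends-complete x as bs cs v h₁ h₂ h₃))
  with a ∧ b ∧ not (is-just c)
... | true  = there rest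
... | false = rest

firstOr-All : ∀ {P : A → Set} {l d} → All P l → P d → P (firstOr l d)
firstOr-All []      h = h
firstOr-All (h ∷ _) _ = h

data Choice (row : Vec Bool n) (x : ℕ × Fin n) (cur : Vec (Cell n) n) :
            Vec (Cell n) n → Set where
  keep : Choice row x cur cur
  put  : ∀ {v} → lookup row v ≡ true → lookup cur v ≡ nothing →
         Choice row x cur (cur [ v ]≔ just x)

Put⇒Choice : ∀ {x row bs} {cur cur′ : Vec (Cell n) n} →
             Put x row bs cur cur′ → Choice row x cur cur′
Put⇒Choice (v , h₁ , _ , h₂ , refl) = put h₁ h₂

sends-choice : ∀ x row bs (cur : Vec (Cell n) n) → All (Choice row x cur) (sends x row bs cur)
sends-choice x row bs cur = All.map (Put⇒Choice {bs = bs}) (sends-sound x row bs cur)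

choose-sound : ∀ A (qs : Matrix p n) u x cur →
               All (Choice (lookup A u) x cur) (choose A qs u x cur)
choose-sound A []         u x cur = keep ∷ sends-choice x (lookup A u) (lookup A u) cur
choose-sound A qs@(_ ∷ _) u x cur =
  firstOr-All (sends-choice x row g cur)
    (firstOr-All (sends-choice x row (semi A g) cur)
      (firstOr-All (sends-choice x row (mate qs u row) cur) keep)) ∷ []
  where
  row = lookup A u
  g   = good qs cur

record Valid (G : Graph n) (s : Fin n) (r : ℕ) (cur : Vec (Cell n) n) : Set where
  field
    root      : lookup cur s ≡ just (0 , s)
    parent    : ∀ {v k u} → lookup cur v ≡ just (k , u) → v ≢ s →
                Adj G u v × ∃₂ λ j w → lookup cur u ≡ just (j , w) × j < k
    injective : ∀ {v w c} → lookup cur v ≡ just c → lookup cur w ≡ just c → v ≡ w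
    latest    : ∀ {v k u} → lookup cur v ≡ just (k , u) → k ≤ r

-- Round r is in progress, and the vertices us are still to take their turns.
record Turn (G : Graph n) (s : Fin n) (r : ℕ) (us : Vec (Fin n) m) (st : State n) : Set where
  field
    valid : Valid G s r (proj₂ st)
    -- Makes the pair `(r , u)` new at the moment when `u` sends, as injectivity requires.
    fresh : ∀ {v u} → lookup (proj₂ st) v ≡ just (r , u) → ¬ u Vec.∈ us
    older : ∀ {v k u} → lookup (proj₁ st) v ≡ just (k , u) →
            k < r × lookup (proj₂ st) v ≡ just (k , u)

keeps : ∀ (cur : Vec (Cell n) n) {v w x c} → lookup cur v ≡ nothing →
        lookup cur w ≡ just c → lookup (cur [ v ]≔ x) w ≡ just c
keeps cur {v} {w} {x} hv hw with lookup-[]≔ cur v x w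
... | inj₁ (refl , _) = case trans (sym hv) hw of λ ()
... | inj₂ (_ , e)    = trans e hw

module _ {G : Graph n} {s : Fin n} {r : ℕ} {us : Vec (Fin n) m} {u : Fin n}
         (u∉us : ¬ u Vec.∈ us) where

  turn-keep : ∀ {st} → Turn G s r (u ∷ us) st → Turn G s r us st
  turn-keep t = record { Turn t ; fresh = λ e i → Turn.fresh t e (there i) }

  turn-put : ∀ {old cur v c} → Turn G s r (u ∷ us) (old , cur) → lookup old u ≡ just c →
             adj G u v ≡ true → lookup cur v ≡ nothing →
             Turn G s r us (old , cur [ v ]≔ just (r , u))
  turn-put {old} {cur} {v} {c} t hu e hv = record
    { valid = record
      { root      = keeps cur hv V.root
      ; parent    = parent′
      ; injective = injective′
      ; latest    = latest′
      }
    ; fresh = fresh′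
    ; older = λ h → proj₁ (Turn.older t h) , keeps cur hv (proj₂ (Turn.older t h))
    }
    where
    module V = Valid (Turn.valid t)
    cur′ = cur [ v ]≔ just (r , u)
    parent′ : ∀ {w k x} → lookup cur′ w ≡ just (k , x) → w ≢ s →
              Adj G x w × ∃₂ λ j y → lookup cur′ x ≡ just (j , y) × j < k
    parent′ {w} h w≢s with lookup-[]≔ cur v (just (r , u)) w
    ... | inj₁ (refl , e′) with refl ← trans (sym e′) h =
      true⇒T e , proj₁ c , proj₂ c , keeps cur hv (proj₂ (Turn.older t hu)) , proj₁ (Turn.older t hu)
    ... | inj₂ (_ , e′) with a , j , y , hx , lt ← V.parent (trans (sym e′) h) w≢s =
      a , j , y , keeps cur hv hx , lt
    injective′ : ∀ {w x d} → lookup cur′ w ≡ just d → lookup cur′ x ≡ just d → w ≡ x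
    injective′ {w} {x} hw hx
      with lookup-[]≔ cur v (just (r , u)) w | lookup-[]≔ cur v (just (r , u)) x
    ... | inj₁ (refl , _) | inj₁ (refl , _) = refl
    ... | inj₁ (refl , e) | inj₂ (_ , e′) =
      contradiction (here refl) (Turn.fresh t (trans (sym e′) (trans hx (trans (sym hw) e))))
    ... | inj₂ (_ , e) | inj₁ (refl , e′) =
      contradiction (here refl) (Turn.fresh t (trans (sym e) (trans hw (trans (sym hx) e′))))
    ... | inj₂ (_ , e) | inj₂ (_ , e′) = V.injective (trans (sym e) hw) (trans (sym e′) hx)
    latest′ : ∀ {w k x} → lookup cur′ w ≡ just (k , x) → k ≤ r
    latest′ {w} h with lookup-[]≔ cur v (just (r , u)) w
    ... | inj₁ (_ , e) with refl ← trans (sym e) h = ≤-refl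
    ... | inj₂ (_ , e) = V.latest (trans (sym e) h)
    fresh′ : ∀ {w x} → lookup cur′ w ≡ just (r , x) → ¬ x Vec.∈ us
    fresh′ {w} h i with lookup-[]≔ cur v (just (r , u)) w
    ... | inj₁ (_ , e) with refl ← trans (sym e) h = u∉us i
    ... | inj₂ (_ , e) = Turn.fresh t (trans (sym e) h) (there i)

  succs-turn : ∀ (qs : Matrix p n) st → Turn G s r (u ∷ us) st →
               All (Turn G s r us) (succs (adjacency G) qs r u st)
  succs-turn qs (old , cur) t with lookup old u in eq
  ... | nothing = turn-keep t ∷ []
  ... | just c  = All.map⁺ (All.map turn (choose-sound (adjacency G) qs u (r , u) cur))
    where
    turn : ∀ {cur′} → Choice (lookup (adjacency G) u) (r , u) cur cur′ → Turn G s r us (old , cur′)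
    turn keep              = turn-keep t
    turn (put {v} h₁ h₂) =
      turn-put t eq (trans (sym (lookup-adjacency G u v)) h₁) h₂

insert-All : ∀ {P : State n → Set} sts {acc} → All P sts → All P acc → All P (insert sts acc)
insert-All []         []       h = h
insert-All (st ∷ sts) {acc} (p ∷ ps) h with does (member? st acc)
... | true  = insert-All sts ps h
... | false = insert-All sts ps (p ∷ h)

expand-All : ∀ {P Q : State n → Set} {f} → (∀ st → P st → All Q (f st)) →
             ∀ l {acc} → All P l → All Q acc → All Q (expand f l acc)
expand-All h []       []       a = a
expand-All {f = f} h (st ∷ l) (p ∷ ps) a = expand-All h l ps (insert-All (f st) (h st p) a)

sweep-turn : ∀ {G : Graph n} {s r} (qs : Matrix p n) {us : Vec (Fin n) m} → VecUnique.Unique us →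
             ∀ {l} → All (Turn G s r us) l → All (Turn G s r []) (sweep (adjacency G) qs r us l)
sweep-turn qs []       h = h
sweep-turn qs (u∉ ∷ uniq) {l} h = sweep-turn qs uniq
  (expand-All (succs-turn (λ i → VecAll.lookup u∉ i refl) qs) l h [])

age-turn : ∀ {G : Graph n} {s r} {us : Vec (Fin n) m} {l} →
           All (Valid G s r ∘ proj₂) l → All (Turn G s (suc r) us) (age l)
age-turn h = All.map⁺ (All.map turn h)
  where
  turn : ∀ {G : Graph n} {s r} {us : Vec (Fin n) m} {cur} →
         Valid G s r cur → Turn G s (suc r) us (cur , cur)
  turn v = record
    { valid = record { Valid v ; latest = λ e → m≤n⇒m≤1+n (Valid.latest v e) }
    ; fresh = λ e → contradiction (Valid.latest v e) 1+n≰n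
    ; older = λ e → s≤s (Valid.latest v e) , e
    }

round-valid : ∀ {G : Graph n} {s r} (qs : Matrix p n) {l} → All (Valid G s r ∘ proj₂) l →
              All (Valid G s (suc r) ∘ proj₂) (sweep (adjacency G) qs (suc r) (Vec.allFin n) (age l))
round-valid qs h = All.map Turn.valid (sweep-turn qs (VecUnique.tabulate⁺ id) (age-turn h))

lookup-initial : ∀ (s v : Fin n) → lookup (initial s (Vec.allFin n)) v ≡
                 (if does (v Fin.≟ s) then just (0 , s) else nothing)
lookup-initial s v = trans (Vec.lookup-map v _ (Vec.allFin _))
  (cong (λ v → if does (v Fin.≟ s) then just (0 , s) else nothing) (Vec.lookup-allFin v))

initial-just : ∀ (s : Fin n) {v c} → lookup (initial s (Vec.allFin n)) v ≡ just c →
               v ≡ s × c ≡ (0 , s)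
initial-just s {v} h with v Fin.≟ s | trans (sym (lookup-initial s v)) h
... | yes refl | refl = refl , refl

initial-root : ∀ (s : Fin n) → lookup (initial s (Vec.allFin n)) s ≡ just (0 , s)
initial-root s with s Fin.≟ s | lookup-initial s s
... | yes _  | e = e
... | no s≢s | _ = contradiction refl s≢s

initial-valid : ∀ (G : Graph n) s → Valid G s 0 (initial s (Vec.allFin n))
initial-valid G s = record
  { root      = initial-root s
  ; parent    = λ h v≢s → contradiction (proj₁ (initial-just s h)) v≢s
  ; injective = λ h h′ → trans (proj₁ (initial-just s h)) (sym (proj₁ (initial-just s h′)))
  ; latest    = λ h → ≤-reflexive (cong proj₁ (proj₂ (initial-just s h)))
  }

informed-initial : ∀ (s : Fin n) → informed (initial s (Vec.allFin n)) ≡ ⁅ s ⁆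
informed-initial s = Subset.⊆-antisym
  (λ {v} i → subst (_∈ ⁅ s ⁆) (sym (proj₁ (initial-just s
    (proj₂ (informed⇒just (initial s (Vec.allFin _)) (Vec.[]=⇒lookup i)))))) (Subset.x∈⁅x⁆ s))
  (λ {v} i → subst (_∈ _) (sym (Subset.x∈⁅y⁆⇒x≡y s i))
    (⇒∈ (just⇒informed (initial s (Vec.allFin _)) (initial-root s))))

full⇒informed : ∀ {cur : Vec (Cell n) m} → informed cur ≡ ⊤ → ∀ v → ∃[ c ] lookup cur v ≡ just c
full⇒informed {cur = cur} h v =
  informed⇒just cur (trans (cong (λ S → lookup S v) h) (Vec.[]=⇒lookup (Subset.∈⊤ {x = v})))

module _ {G : Graph n} {s : Fin n} {t : ℕ} {cur : Vec (Cell n) n}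
         (valid : Valid G s t cur) (full : informed cur ≡ ⊤) where

  open Valid valid

  private
    cell : Fin n → ℕ × Fin n
    cell v = proj₁ (full⇒informed full v)

    cell≡ : ∀ v → lookup cur v ≡ just (cell v)
    cell≡ v = proj₂ (full⇒informed full v)

    root≡ : cell s ≡ (0 , s)
    root≡ = just-injective (trans (sym (cell≡ s)) root)

  scheme : Scheme G s t
  scheme = record
    { par      = proj₂ ∘ cell
    ; rnd      = proj₁ ∘ cell
    ; par-root = cong proj₂ root≡
    ; rnd-root = cong proj₁ root≡
    ; par-adj  = λ {v} v≢s → proj₁ (parent (cell≡ v) v≢s)
    ; par-rnd  = λ {v} v≢s → let _ , j , w , e , lt = parent (cell≡ v) v≢s in
                 subst (λ c → proj₁ c < proj₁ (cell v))
                   (just-injective (trans (sym e) (cell≡ (proj₂ (cell v))))) lt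
    ; distinct = λ {v} {w} p q → injective (cell≡ v)
                   (trans (cell≡ w) (cong just (sym (cong₂ _,_ q p))))
    ; rnd-max  = λ v → latest (cell≡ v)
    }

  scheme-output : encProtocol (Scheme.protocol scheme) ≡ encOutput cur
  scheme-output = trans (Scheme.encProtocol≡ scheme)
    (encFamily-cong λ u → encFamily-cong λ v → cong encℕ (label≡entry u v))
    where
    label≡entry : ∀ u v → Scheme.label scheme u v ≡ entry cur u v
    label≡entry u v = sym (cong₂ (λ c d → hit c u (hit d v 0)) (cell≡ v) (cell≡ u))

-- Exhaustive search

Distinct : List (State n) → Set
Distinct = AllPairs λ st st′ → shape st ≢ shape st′

insert-distinct : ∀ sts {l : List (State n)} → Distinct l → Distinct (insert sts l)
insert-distinct []         d = d
insert-distinct (st ∷ sts) {l} d with member? st l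
... | yes _ = insert-distinct sts d
... | no ¬m = insert-distinct sts (All.¬Any⇒All¬ l ¬m ∷ d)

expand-distinct : ∀ f l {l′ : List (State n)} → Distinct l′ → Distinct (expand f l l′)
expand-distinct f []       d = d
expand-distinct f (st ∷ l) d = expand-distinct f l (insert-distinct (f st) d)

Nested : State n → Set
Nested (old , cur) = ∀ {v} → lookup (informed old) v ≡ true → lookup (informed cur) v ≡ true

turn-nested : ∀ {G : Graph n} {s r} {us : Vec (Fin n) m} {st} → Turn G s r us st → Nested st
turn-nested {st = old , cur} t h with _ , e ← informed⇒just old h =
  just⇒informed cur (proj₂ (Turn.older t e))

-- Only three of the four combinations of the bits of old and cur occur.
code₃ : Bool → Bool → Fin 3
code₃ _     false = zero
code₃ false true  = suc zero
code₃ true  true  = suc (suc zero)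

code₃-injective : ∀ {a b c d} → (a ≡ true → b ≡ true) → (c ≡ true → d ≡ true) →
                  code₃ a b ≡ code₃ c d → a ≡ c × b ≡ d
code₃-injective {true}  {false} h h′ e = case h refl of λ ()
code₃-injective {_}     {_}     {true} {false} h h′ e = case h′ refl of λ ()
code₃-injective {false} {false} {false} {false} h h′ e = refl , refl
code₃-injective {false} {true}  {false} {true}  h h′ e = refl , refl
code₃-injective {false} {true}  {true}  {true}  h h′ ()
code₃-injective {true}  {true}  {true}  {true}  h h′ e = refl , refl

shapeCode : State n → Fin (3 ^ n)
shapeCode (old , cur) =
  Fin.funToFin λ v → code₃ (lookup (informed old) v) (lookup (informed cur) v)

shapeCode-injective : ∀ (st st′ : State n) → Nested st → Nested st′ →
                      shapeCode st ≡ shapeCode st′ → shape st ≡ shape st′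
shapeCode-injective (old , cur) (old′ , cur′) h h′ e =
  cong₂ _,_ (lookup-ext (proj₁ ∘ bits)) (lookup-ext (proj₂ ∘ bits))
  where
  digit : State n → Fin n → Fin 3
  digit (old , cur) v = code₃ (lookup (informed old) v) (lookup (informed cur) v)
  bits : ∀ v → lookup (informed old) v ≡ lookup (informed old′) v ×
               lookup (informed cur) v ≡ lookup (informed cur′) v
  bits v = code₃-injective h h′ (begin
    digit (old , cur) v
      ≡⟨ Fin.finToFun-funToFin (digit (old , cur)) v ⟨
    Fin.finToFun (shapeCode (old , cur)) v
      ≡⟨ cong (λ i → Fin.finToFun i v) e ⟩
    Fin.finToFun (shapeCode (old′ , cur′)) v
      ≡⟨ Fin.finToFun-funToFin (digit (old′ , cur′)) v ⟩
    digit (old′ , cur′) v ∎)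
    where open ≡-Reasoning

distinct-length : ∀ {l : List (State n)} → All Nested l → Distinct l → length l ≤ 3 ^ n
distinct-length {l = l} nested distinct =
  Fin.injective⇒≤ {f = shapeCode ∘ List.lookup l} λ {i} {j} → inj nested distinct i j
  where
  inj : ∀ {l : List (State n)} → All Nested l → Distinct l → ∀ i j →
        shapeCode (List.lookup l i) ≡ shapeCode (List.lookup l j) → i ≡ j
  inj (h ∷ hs) (d ∷ ds) zero    zero    e = refl
  inj {l = st ∷ l} (h ∷ hs) (d ∷ ds) zero    (suc j) e = contradiction
    (shapeCode-injective st (List.lookup l j) h (All.lookup hs (List.∈-lookup j)) e)
    (All.lookup d (List.∈-lookup j))
  inj {l = st ∷ l} (h ∷ hs) (d ∷ ds) (suc i) zero    e = contradiction
    (shapeCode-injective st (List.lookup l i) h (All.lookup hs (List.∈-lookup i)) (sym e))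
    (All.lookup d (List.∈-lookup i))
  inj (h ∷ hs) (d ∷ ds) (suc i) (suc j) e = cong suc (inj hs ds i j e)

-- No growth accumulates along the sweep: each intermediate list by itself consists of nested pairs
-- with distinct shapes.
bounded : ∀ {G : Graph n} {s r} (qs : Matrix p n) {us : Vec (Fin n) m} → VecUnique.Unique us →
          ∀ {l} → All (Turn G s r us) l → length l ≤ 3 ^ n →
          Bounded (3 ^ n) (adjacency G) qs r us l
bounded qs []          h len = len
bounded {G = G} {r = r} qs (u∉ ∷ uniq) {l} h len =
  len , bounded qs uniq turns
    (distinct-length (All.map turn-nested turns)
      (expand-distinct (succs (adjacency G) qs r _) l []))
  where
  turns = expand-All (succs-turn (λ i → VecAll.lookup u∉ i refl) qs) l h []

bounded⇒final : ∀ {ℓ A r} {qs : Matrix p n} (us : Vec (Fin n) m) {l} →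
                Bounded ℓ A qs r us l → length (sweep A qs r us l) ≤ ℓ
bounded⇒final []       h       = h
bounded⇒final (_ ∷ us) (_ , h) = bounded⇒final us h

Has : Subset n × Subset n → List (State n) → Set
Has K = Any λ st → K ≡ shape st

insert-keeps : ∀ {K} sts {l : List (State n)} → Has K l → Has K (insert sts l)
insert-keeps []         h = h
insert-keeps (st ∷ sts) {l} h with does (member? st l)
... | true  = insert-keeps sts h
... | false = insert-keeps sts (there h)

insert-adds : ∀ {K} sts {l : List (State n)} → Has K sts → Has K (insert sts l)
insert-adds (st ∷ sts) {l} (here refl) with member? st l
... | yes m = insert-keeps sts m
... | no _  = insert-keeps sts (here refl)
insert-adds (st ∷ sts) {l} (there h) = insert-adds sts h

expand-keeps : ∀ {K} f l {l′ : List (State n)} → Has K l′ → Has K (expand f l l′)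
expand-keeps f []       h = h
expand-keeps f (st ∷ l) h = expand-keeps f l (insert-keeps (f st) h)

expand-adds : ∀ {K} f {l l′ : List (State n)} → Any (Has K ∘ f) l → Has K (expand f l l′)
expand-adds f {st ∷ l} (here h)  = expand-keeps f l (insert-adds (f st) h)
expand-adds f {st ∷ l} (there h) = expand-adds f h

succs-complete : ∀ {G : Graph n} {r u C} (st : State n) →
                 Step G (informed (proj₁ st)) u (informed (proj₂ st)) C →
                 Has (informed (proj₁ st) , C) (succs (adjacency G) [] r u st)
succs-complete {G = G} {r} {u} (old , cur) move with lookup old u in eq
... | nothing with move
...   | idle       = here refl
...   | send h _ _ = true≢false h (nothing⇒uninformed old eq)
succs-complete {G = G} {r} {u} (old , cur) move | just _ with move
... | idle = here refl
... | send {v} _ hv e = there (Any.map⁺ (Any.map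
  (λ { refl → cong (informed old ,_) (sym (Vec.map-[]≔ is-just cur v)) })
  (sends-complete (r , u) row row cur v e′ e′ (uninformed⇒nothing cur hv))))
  where
  row = lookup (adjacency G) u
  e′  = trans (lookup-adjacency G u v) e

sweep-complete : ∀ {G : Graph n} {r O C C′} {us : Vec (Fin n) m} {l} → Sweep G O us C C′ →
                 Has (O , C) l → Has (O , C′) (sweep (adjacency G) [] r us l)
sweep-complete [] h = h
sweep-complete {G = G} {r} {us = u ∷ _} {l} (move ∷ sw) h = sweep-complete sw
  (expand-adds (succs (adjacency G) [] r u) (Any.map
    (λ { {st} refl → succs-complete st move }) h))

firstFull-just : ∀ l {cur : Vec (Cell n) n} → firstFull l ≡ just cur →
                 informed cur ≡ ⊤ × ∃[ old ] (old , cur) List.∈ l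
firstFull-just ((old , cur) ∷ l) h with informed cur ≟S ⊤ | h
... | yes e | refl = e , old , here refl
... | no _  | h′   with e , old′ , i ← firstFull-just l h′ = e , old′ , there i

firstFull-nothing : ∀ (l : List (State n)) → firstFull l ≡ nothing →
                    ¬ Any (λ st → ⊤ ≡ informed (proj₂ st)) l
firstFull-nothing ((old , cur) ∷ l) h i with informed cur ≟S ⊤ | h | i
... | no ¬e | _  | here e  = ¬e (sym e)
... | no _  | h′ | there i = firstFull-nothing l h′ i

module _ (G : Graph n) (s : Fin n) where

  record Complete (r : ℕ) (l : List (State n)) : Set where
    field
      valid : All (Valid G s r ∘ proj₂) l
      small : length l ≤ 3 ^ n
      all   : ∀ {S} → Reach G s r S → Any (λ st → S ≡ informed (proj₂ st)) l

  complete-first : Complete 0 (firstState s ∷ [])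
  complete-first = record
    { valid = initial-valid G s ∷ []
    ; small = m^n>0 3 n
    ; all   = λ { start → here (sym (informed-initial s)) }
    }

  complete-bounded : ∀ {r l} → Complete r l →
                     Bounded (3 ^ n) (adjacency G) [] (suc r) (Vec.allFin n) (age l)
  complete-bounded {l = l} c = bounded [] (VecUnique.tabulate⁺ id) (age-turn (Complete.valid c))
    (≤-trans (≤-reflexive (List.length-map _ l)) (Complete.small c))

  complete-round : ∀ {r l} → Complete r l →
                   Complete (suc r) (sweep (adjacency G) [] (suc r) (Vec.allFin n) (age l))
  complete-round c = record
    { valid = round-valid [] (Complete.valid c)
    ; small = bounded⇒final (Vec.allFin n) (complete-bounded c)
    ; all   = λ { (next reach sw) → Any.map (cong proj₂) (sweep-complete sw
                (Any.map⁺ (Any.map (λ { refl → refl }) (Complete.all c reach)))) }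
    }

  -- A known broadcast in `j + r` rounds supplies the fuel. The first round with a full state is
  -- optimal, because `Complete` would have put any earlier full set on an earlier list.
  exhaustive : ∀ j {r l} → Complete r l → Reach G s (j + r) ⊤ →
               ∃₂ λ i cur → Search (3 ^ n) (adjacency G) [] r l i cur × i ≤ j ×
               Valid G s (i + r) cur × informed cur ≡ ⊤ ×
               (∀ b → Reach G s b ⊤ → r ≤ b → i + r ≤ b)
  exhaustive j {r} {l} c reach with firstFull l in eq
  ... | just cur with e , old , i ← firstFull-just l eq =
    0 , cur , found (Complete.small c) eq , z≤n , All.lookup (Complete.valid c) i , e ,
    λ _ _ → id
  exhaustive zero    {r} {l} c reach | nothing =
    contradiction (Complete.all c reach) (firstFull-nothing l eq)
  exhaustive (suc j) {r} {l} c reach | nothing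
    with i , cur , search , i≤j , v , e , least ← exhaustive j (complete-round c)
           (subst (λ t → Reach G s t ⊤) (sym (+-suc j r)) reach) =
    suc i , cur , round (Complete.small c) eq (complete-bounded c) search , s≤s i≤j ,
    subst (λ t → Valid G s t cur) (+-suc i r) v , e , least′
    where
    least′ : ∀ b → Reach G s b ⊤ → r ≤ b → suc i + r ≤ b
    least′ b reach r≤b with m≤n⇒m<n∨m≡n r≤b
    ... | inj₁ r<b  = ≤-trans (≤-reflexive (sym (+-suc i r))) (least b reach r<b)
    ... | inj₂ refl = contradiction (Complete.all c reach) (firstFull-nothing l eq)

-- The greedy strategy

isNode-encBool : ∀ b → isNode (encBool b) ≡ b
isNode-encBool false = refl
isNode-encBool true  = refl

isNode-encCell : ∀ (c : Cell n) → isNode (encCell c) ≡ is-just c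
isNode-encCell nothing  = refl
isNode-encCell (just _) = refl

meets-sound : ∀ (e : A → Tree) as (bs : Vec A m) → meets e as bs ≡ true →
              ∃[ v ] lookup as v ≡ true × isNode (e (lookup bs v)) ≡ true
meets-sound e []           []       ()
meets-sound e (false ∷ as) (b ∷ bs) h with v , h₁ , h₂ ← meets-sound e as bs h =
  suc v , h₁ , h₂
meets-sound e (true ∷ as)  (b ∷ bs) h with isNode (e b) in eq
... | true  = zero , refl , eq
... | false with v , h₁ , h₂ ← meets-sound e as bs h = suc v , h₁ , h₂

meets-complete : ∀ (e : A → Tree) as (bs : Vec A m) v → lookup as v ≡ true →
                 isNode (e (lookup bs v)) ≡ true → meets e as bs ≡ true
meets-complete e (true ∷ as) (b ∷ bs) zero    h₁ h₂ rewrite h₂ = refl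
meets-complete e (a ∷ as)    (b ∷ bs) (suc v) h₁ h₂ =
  trans (cong ((a ∧ isNode (e b)) ∨_) (meets-complete e as bs v h₁ h₂)) (Bool.∨-zeroʳ _)

good-sound : ∀ (qs : Matrix p n) (cur : Vec (Cell n) n) v → lookup (good qs cur) v ≡ true →
             ∃[ i ] lookup (lookup qs i) v ≡ true × meets encCell (lookup qs i) cur ≡ false
good-sound []       cur v h = true≢false h (Vec.lookup-replicate v false)
good-sound (q ∷ qs) cur v h with meets encCell q cur in eq
... | true with i , h₁ , h₂ ← good-sound qs cur v h = suc i , h₁ , h₂
... | false with lookup q v in eq′ | trans (sym (Vec.lookup-zipWith _∨_ v q (good qs cur))) h
...   | true  | _  = zero , eq′ , eq
...   | false | h′ with i , h₁ , h₂ ← good-sound qs cur v h′ = suc i , h₁ , h₂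

good-complete : ∀ (qs : Matrix p n) (cur : Vec (Cell n) n) v i →
                lookup (lookup qs i) v ≡ true → meets encCell (lookup qs i) cur ≡ false →
                lookup (good qs cur) v ≡ true
good-complete (q ∷ qs) cur v zero h₁ h₂ rewrite h₂ =
  trans (Vec.lookup-zipWith _∨_ v q (good qs cur)) (cong (_∨ lookup (good qs cur) v) h₁)
good-complete (q ∷ qs) cur v (suc i) h₁ h₂ with meets encCell q cur
... | true  = good-complete qs cur v i h₁ h₂
... | false = trans (Vec.lookup-zipWith _∨_ v q (good qs cur))
  (trans (cong (lookup q v ∨_) (good-complete qs cur v i h₁ h₂)) (Bool.∨-zeroʳ _))

mate-sound : ∀ (qs : Matrix p n) u d i → lookup (lookup qs i) u ≡ true →
             ∃[ j ] lookup (lookup qs j) u ≡ true × mate qs u d ≡ lookup qs j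
mate-sound (q ∷ qs) u d i h with lookup q u in eq
... | true = zero , eq , refl
mate-sound (q ∷ qs) u d zero    h | false = true≢false h eq
mate-sound (q ∷ qs) u d (suc i) h | false with j , h₁ , h₂ ← mate-sound qs u d i h =
  suc j , h₁ , h₂

∉⇒false : ∀ {C : Subset n} {v} → v ∉ C → lookup C v ≡ false
∉⇒false {C = C} {v} h with lookup C v in eq
... | true  = contradiction (⇒∈ eq) h
... | false = refl

false⇒∉ : ∀ {C : Subset n} {v} → lookup C v ≡ false → v ∉ C
false⇒∉ h v∈ = true≢false (Vec.[]=⇒lookup v∈) h

sweep-⊆ : ∀ {G : Graph n} {O C C′} {us : Vec (Fin n) m} → Sweep G O us C C′ → C ⊆ C′
sweep-⊆ []                     = id
sweep-⊆ (idle ∷ sw)            = sweep-⊆ sw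
sweep-⊆ {C = C} (send _ _ _ ∷ sw) = sweep-⊆ sw ∘ ⊆[]≔ C _

module Greedy {G : Graph n} (conn : Connected G) (s : Fin n) {p : ℕ}
              (Q : CliqueCover G (suc p)) where

  open CliqueCover Q

  private
    adjs : Matrix n n
    adjs = adjacency G

    qs : Matrix (suc p) n
    qs = cover Q

  clq : Fin n → Fin (suc p)
  clq v = proj₁ (covers v)

  clq∈ : ∀ v → v ∈ part (clq v)
  clq∈ v = proj₂ (covers v)

  clq-unique : ∀ {v i} → v ∈ part i → clq v ≡ i
  clq-unique {v} = disjoint (clq∈ v)

  clique-adj : ∀ {u v} → clq u ≡ clq v → u ≢ v → Adj G u v
  clique-adj {u} {v} e = clique (subst (λ i → u ∈ part i) e (clq∈ u)) (clq∈ v)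

  Touched : Subset n → Fin (suc p) → Set
  Touched C i = ∃[ v ] v ∈ C × clq v ≡ i

  touched? : ∀ C i → Dec (Touched C i)
  touched? C i = Fin.any? λ v → (v Subset.∈? C) ×-dec (clq v Fin.≟ i)

  Good : Subset n → Fin n → Set
  Good C v = ¬ Touched C (clq v)

  good⇒∉ : ∀ {C v} → Good C v → v ∉ C
  good⇒∉ h v∈ = h (_ , v∈ , refl)

  private
    lookup-qs : ∀ i v → lookup (lookup qs i) v ≡ lookup (part i) v
    lookup-qs i v = cong (λ q → lookup q v) (Vec.lookup∘tabulate part i)

    good⇒Good : ∀ (cur : Vec (Cell n) n) {v} → lookup (good qs cur) v ≡ true → Good (informed cur) v
    good⇒Good cur {v} h (w , w∈ , e) with i , h₁ , h₂ ← good-sound qs cur v h =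
      true≢false
        (meets-complete encCell (lookup qs i) cur w
          (trans (lookup-qs i w) (Vec.[]=⇒lookup (subst (λ j → w ∈ part j)
            (trans e (clq-unique (⇒∈ (trans (sym (lookup-qs i v)) h₁)))) (clq∈ w))))
          (trans (isNode-encCell (lookup cur w))
            (trans (sym (lookup-informed cur w)) (Vec.[]=⇒lookup w∈))))
        h₂

    Good⇒good : ∀ (cur : Vec (Cell n) n) {v} → Good (informed cur) v → lookup (good qs cur) v ≡ true
    Good⇒good cur {v} h = good-complete qs cur v (clq v)
      (trans (lookup-qs (clq v) v) (Vec.[]=⇒lookup (clq∈ v)))
      (Bool.¬-not untouched)
      where
      untouched : meets encCell (lookup qs (clq v)) cur ≢ true
      untouched m with w , h₁ , h₂ ← meets-sound encCell (lookup qs (clq v)) cur m =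
        h (w , ⇒∈ (trans (lookup-informed cur w) (trans (sym (isNode-encCell (lookup cur w))) h₂)) ,
           clq-unique (⇒∈ (trans (sym (lookup-qs (clq v) w)) h₁)))

    row≡ : ∀ {u v} → Adj G u v → lookup (lookup adjs u) v ≡ true
    row≡ {u} {v} e = trans (lookup-adjacency G u v) (T⇒true e)

    semi⇒ : ∀ {g v} → lookup (semi adjs g) v ≡ true → ∃[ w ] Adj G v w × lookup g w ≡ true
    semi⇒ {g} {v} h
      with w , h₁ , h₂ ← meets-sound encBool (lookup adjs v) g
             (trans (sym (Vec.lookup-map v (λ row → meets encBool row g) adjs)) h) =
      w , true⇒T (trans (sym (lookup-adjacency G v w)) h₁) ,
      trans (sym (isNode-encBool (lookup g w))) h₂

    ⇒semi : ∀ {g v w} → Adj G v w → lookup g w ≡ true → lookup (semi adjs g) v ≡ true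
    ⇒semi {g} {v} {w} e h = trans (Vec.lookup-map v (λ row → meets encBool row g) adjs)
      (meets-complete encBool (lookup adjs v) g w (row≡ e) (trans (isNode-encBool (lookup g w)) h))

    mate≡ : ∀ u {d} v → lookup (mate qs u d) v ≡ lookup (part (clq u)) v
    mate≡ u {d} v
      with j , h , e ← mate-sound qs u d (clq u)
             (trans (lookup-qs (clq u) u) (Vec.[]=⇒lookup (clq∈ u)))
      rewrite e | clq-unique (⇒∈ (trans (sym (lookup-qs j u)) h)) = lookup-qs j v

  -- All that the analysis keeps of a greedy send. If a target of some preference is available, a
  -- target of at least that preference gets informed. The last field asks that all cliques be
  -- touched, for then the first two preferences have no targets.
  record Move (u : Fin n) (C C′ : Subset n) : Set where
    field
      to-good : ∀ {v} → Adj G u v → Good C v → ∃[ v′ ] v′ ∈ C′ × Good C v′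
      to-semi : ∀ {v w} → v ∉ C → Adj G u v → Adj G v w → Good C w →
                ∃[ v′ ] v′ ∈ C′ × (Good C v′ ⊎ ∃[ w′ ] Adj G v′ w′ × Good C w′)
      to-mate : (∀ i → Touched C i) → ∀ {v} → v ∉ C → Adj G u v → clq u ≡ clq v →
                ∃[ v′ ] v′ ∉ C × v′ ∈ C′ × clq u ≡ clq v′

  private
    ∉⇒nothing : ∀ (cur : Vec (Cell n) n) {v} → v ∉ informed cur → lookup cur v ≡ nothing
    ∉⇒nothing cur h = uninformed⇒nothing cur (∉⇒false h)

    put∈ : ∀ (cur : Vec (Cell n) n) v {x} → v ∈ informed (cur [ v ]≔ just x)
    put∈ cur v {x} = ⇒∈ (just⇒informed (cur [ v ]≔ just x) (Vec.lookup∘update v cur (just x)))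

    no-target : ∀ {u x row′ cur v} → sends x (lookup adjs u) row′ cur ≡ [] → Adj G u v →
           lookup row′ v ≡ true → ¬ v ∉ informed cur
    no-target {u} {x} {row′} {cur} {v} eq e h v∉
      with subst (cur [ v ]≔ just x List.∈_) eq
             (sends-complete x (lookup adjs u) row′ cur v (row≡ e) h (∉⇒nothing cur v∉))
    ... | ()

    first : ∀ (x : ℕ × Fin n) (row row′ : Vec Bool n) (cur : Vec (Cell n) n) {y l} →
            sends x row row′ cur ≡ y ∷ l → Put x row row′ cur y
    first x row row′ cur eq
      with h ∷ _ ← subst (All (Put x row row′ cur)) eq (sends-sound x row row′ cur) = h

  choose-greedy : ∀ u x cur → ∃[ cur′ ] choose adjs qs u x cur ≡ cur′ ∷ [] ×
                  Move u (informed cur) (informed cur′)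
  choose-greedy u x cur = _ , refl , move
    where
    row = lookup adjs u
    g   = good qs cur
    l₃  = sends x row (mate qs u row) cur
    l₂  = sends x row (semi adjs g) cur
    move : Move u (informed cur)
             (informed (firstOr (sends x row g cur) (firstOr l₂ (firstOr l₃ cur))))
    move with sends x row g cur in eq
    ... | y ∷ _ with v , _ , hg , hv , refl ← first x row g cur eq = record
      { to-good = λ _ _ → v , put∈ cur v , good⇒Good cur hg
      ; to-semi = λ _ _ _ _ → v , put∈ cur v , inj₁ (good⇒Good cur hg)
      ; to-mate = λ all _ _ _ → contradiction (all (clq v)) (good⇒Good cur hg)
      }
    ... | [] with sends x row (semi adjs g) cur in eq₂
    ...   | y ∷ _ with v , _ , hg , hv , refl ← first x row (semi adjs g) cur eq₂ with w , vw , hw ← semi⇒ {g} hg = record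
      { to-good = λ e h → contradiction (good⇒∉ h) (no-target eq e (Good⇒good cur h))
      ; to-semi = λ _ _ _ _ → v , put∈ cur v , inj₂ (w , vw , good⇒Good cur hw)
      ; to-mate = λ all _ _ _ → contradiction (all (clq w)) (good⇒Good cur hw)
      }
    move | [] | [] with sends x row (mate qs u row) cur in eq₃
    ... | y ∷ _ with v , _ , hm , hv , refl ← first x row (mate qs u row) cur eq₃ = record
      { to-good = λ e h → contradiction (good⇒∉ h) (no-target eq e (Good⇒good cur h))
      ; to-semi = λ v∉ e e′ h → contradiction v∉ (no-target eq₂ e (⇒semi e′ (Good⇒good cur h)))
      ; to-mate = λ _ _ _ _ → v , false⇒∉ (nothing⇒uninformed cur hv) , put∈ cur v ,
                  sym (clq-unique (⇒∈ (trans (sym (mate≡ u v)) hm)))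
      }
    ... | [] = record
      { to-good = λ e h → contradiction (good⇒∉ h) (no-target eq e (Good⇒good cur h))
      ; to-semi = λ v∉ e e′ h → contradiction v∉ (no-target eq₂ e (⇒semi e′ (Good⇒good cur h)))
      ; to-mate = λ _ {v} v∉ e h → contradiction v∉ (no-target eq₃ e
                    (trans (mate≡ u v) (Vec.[]=⇒lookup (subst (λ i → v ∈ part i) (sym h) (clq∈ v)))))
      }

  data GSweep (O : Subset n) : Vec (Fin n) m → Subset n → Subset n → Set where
    []   : ∀ {C} → GSweep O [] C C
    skip : ∀ {u} {us : Vec (Fin n) m} {C C′} → u ∉ O → GSweep O us C C′ →
           GSweep O (u ∷ us) C C′
    act  : ∀ {u} {us : Vec (Fin n) m} {C C′ C″} → u ∈ O → Step G O u C C′ → Move u C C′ →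
           GSweep O us C′ C″ → GSweep O (u ∷ us) C C″

  GSweep⇒Sweep : ∀ {O C C′} {us : Vec (Fin n) m} → GSweep O us C C′ → Sweep G O us C C′
  GSweep⇒Sweep []              = []
  GSweep⇒Sweep (skip _ sw)     = idle ∷ GSweep⇒Sweep sw
  GSweep⇒Sweep (act _ st _ sw) = st ∷ GSweep⇒Sweep sw

  succs-greedy : ∀ r u (old cur : Vec (Cell n) n) →
                 ∃[ cur′ ] succs adjs qs r u (old , cur) ≡ (old , cur′) ∷ [] ×
                 (∀ {us : Vec (Fin n) m} {C} → GSweep (informed old) us (informed cur′) C →
                  GSweep (informed old) (u ∷ us) (informed cur) C)
  succs-greedy r u old cur with lookup old u in eq
  ... | nothing = cur , refl , skip (false⇒∉ (nothing⇒uninformed old eq))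
  ... | just _
    with cur′ , e , mv ← choose-greedy u (r , u) cur
    with ch ∷ [] ← subst (All (Choice (lookup adjs u) (r , u) cur)) e
                     (choose-sound adjs qs u (r , u) cur) =
    cur′ , cong (List.map (old ,_)) e , act u∈ (choice⇒step ch) mv
    where
    u∈ : u ∈ informed old
    u∈ = ⇒∈ (just⇒informed old eq)
    choice⇒step : ∀ {cur₁} → Choice (lookup adjs u) (r , u) cur cur₁ →
                  Step G (informed old) u (informed cur) (informed cur₁)
    choice⇒step keep = idle
    choice⇒step (put {v} h₁ h₂) = subst (Step G (informed old) u (informed cur))
      (sym (Vec.map-[]≔ is-just cur v))
      (send (Vec.[]=⇒lookup u∈) (nothing⇒uninformed cur h₂)
        (trans (sym (lookup-adjacency G u v)) h₁))

  greedy-sweep : ∀ {r old} (us : Vec (Fin n) m) cur →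
                 ∃[ cur′ ] sweep adjs qs r us ((old , cur) ∷ []) ≡ (old , cur′) ∷ [] ×
                 GSweep (informed old) us (informed cur) (informed cur′) ×
                 Bounded 1 adjs qs r us ((old , cur) ∷ [])
  greedy-sweep []       cur = cur , refl , [] , ≤-refl
  greedy-sweep {r = r} {old} (u ∷ us) cur
    with cur₁ , e₁ , extend-sweep ← succs-greedy r u old cur
    with cur′ , e , sw , b ← greedy-sweep {r = r} {old} us cur₁
    rewrite e₁ = cur′ , e , extend-sweep sw , ≤-refl , b

  -- Greedy rounds while some clique is untouched

  Shrink : Subset n → Subset n → Set
  Shrink C C′ = ∃[ i ] ¬ Touched C i × Touched C′ i

  Frontier : Subset n → Set
  Frontier C = ∃₂ λ x w → x ∈ C × Adj G x w × Good C w

  touched-⊆ : ∀ {C C′ i} → C ⊆ C′ → Touched C i → Touched C′ i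
  touched-⊆ h (v , v∈ , e) = v , h v∈ , e

  shrinkʳ : ∀ {C C′ C″} → C′ ⊆ C″ → Shrink C C′ → Shrink C C″
  shrinkʳ h (i , ¬t , t) = i , ¬t , touched-⊆ h t

  shrinkˡ : ∀ {C C′ C″} → C ⊆ C′ → Shrink C′ C″ → Shrink C C″
  shrinkˡ h (i , ¬t , t) = i , ¬t ∘ touched-⊆ h , t

  good-or-shrink : ∀ {C} C′ {w} → Good C w → Good C′ w ⊎ Shrink C C′
  good-or-shrink C′ {w} g with touched? C′ (clq w)
  ... | yes t = inj₂ (clq w , g , t)
  ... | no ¬t = inj₁ ¬t

  step-⊆ : ∀ {O u C C′} → Step G O u C C′ → C ⊆ C′
  step-⊆ st = sweep-⊆ {us = _ ∷ []} (st ∷ [])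

  gsweep-⊆ : ∀ {O C C′} {us : Vec (Fin n) m} → GSweep O us C C′ → C ⊆ C′
  gsweep-⊆ = sweep-⊆ ∘ GSweep⇒Sweep

  -- By the turn of `x`, either the clique of `w` has been touched by another sender, or `w` is
  -- still a target of the first preference and `x` touches a new clique.
  gsweep-shrinks : ∀ {O C C′ x w} {us : Vec (Fin n) m} → GSweep O us C C′ → x Vec.∈ us →
                   x ∈ O → Adj G x w → Good C w → Shrink C C′
  gsweep-shrinks (skip u∉ sw) (here refl) x∈ e g = contradiction x∈ u∉
  gsweep-shrinks (skip u∉ sw) (there i)   x∈ e g = gsweep-shrinks sw i x∈ e g
  gsweep-shrinks (act _ st mv sw) (here refl) x∈ e g with v , v∈ , gv ← Move.to-good mv e g =
    clq v , gv , v , gsweep-⊆ sw v∈ , refl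
  gsweep-shrinks (act {C′ = C₁} _ st mv sw) (there i) x∈ e g with good-or-shrink C₁ g
  ... | inj₁ g′ = shrinkˡ (step-⊆ st) (gsweep-shrinks sw i x∈ e g′)
  ... | inj₂ sh = shrinkʳ (gsweep-⊆ sw) sh

  frontier : ∀ {C C′ x w} → x ∈ C′ → Adj G x w → Good C w → Shrink C C′ ⊎ Frontier C′
  frontier {C′ = C′} x∈ e g with good-or-shrink C′ g
  ... | inj₁ g′ = inj₂ (_ , _ , x∈ , e , g′)
  ... | inj₂ sh = inj₁ sh

  -- If no clique is touched before the turn of `u`, then either `x` is informed already, or `u`
  -- informs a vertex of an untouched clique or a neighbour of one. In the last case, as for `x`, an
  -- informed vertex ends up next to an untouched clique, unless that clique is touched later in the
  -- sweep.
  gsweep-frontier : ∀ {O C C′ u x w} {us : Vec (Fin n) m} → GSweep O us C C′ → u Vec.∈ us →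
                    u ∈ O → Adj G u x → Adj G x w → Good C w → Shrink C C′ ⊎ Frontier C′
  gsweep-frontier (skip u∉ sw) (here refl) u∈ e e′ g = contradiction u∈ u∉
  gsweep-frontier (skip u∉ sw) (there i)   u∈ e e′ g = gsweep-frontier sw i u∈ e e′ g
  gsweep-frontier {C = C} {x = x} (act _ st mv sw) (here refl) u∈ e e′ g with x Subset.∈? C
  ... | yes x∈ = frontier (gsweep-⊆ sw (step-⊆ st x∈)) e′ g
  ... | no x∉ with Move.to-semi mv x∉ e e′ g
  ...   | v , v∈ , inj₁ gv            = inj₁ (clq v , gv , v , gsweep-⊆ sw v∈ , refl)
  ...   | v , v∈ , inj₂ (w′ , e″ , g′) = frontier (gsweep-⊆ sw v∈) e″ g′
  gsweep-frontier (act {C′ = C₁} _ st mv sw) (there i) u∈ e e′ g with good-or-shrink C₁ g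
  ... | inj₂ sh = inj₁ (shrinkʳ (gsweep-⊆ sw) sh)
  ... | inj₁ g′ with gsweep-frontier sw i u∈ e e′ g′
  ...   | inj₁ sh = inj₁ (shrinkˡ (step-⊆ st) sh)
  ...   | inj₂ fr = inj₂ fr

  GRound : Subset n → Subset n → Set
  GRound C C′ = GSweep C (Vec.allFin n) C C′

  data GRounds : ℕ → Subset n → Subset n → Set where
    []  : ∀ {C} → GRounds 0 C C
    _∷_ : ∀ {j C C′ C″} → GRound C C′ → GRounds j C′ C″ → GRounds (suc j) C C″

  crossing : ∀ {C x z vs} → Walk G x z vs → Touched C (clq x) → Good C z →
             ∃₂ λ x w → Adj G x w × Touched C (clq x) × Good C w
  crossing (stop _) t g = contradiction t g
  crossing {C} (step {v = v} e walk) t g with touched? C (clq v)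
  ... | yes t′ = crossing walk t′ g
  ... | no ¬t  = _ , v , e , t , ¬t

  -- A walk from `s` to an untouched clique leaves the touched cliques by an edge from `x` to `w`.
  -- The clique of `x` has an informed vertex `u`, which is `x` or a neighbour of `x`. So the first
  -- round brings the message next to an untouched clique and the second one into it, unless a
  -- clique is touched sooner.
  two-rounds : ∀ {C C′ C″} → GRound C C′ → GRound C′ C″ → s ∈ C →
               (∀ i → Touched C″ i) ⊎ Shrink C C″
  two-rounds {C} {C′} {C″} r r′ s∈ with Fin.all? (touched? C″)
  ... | yes all = inj₁ all
  ... | no ¬all
    with i , ¬t ← Fin.¬∀⟶∃¬ (suc p) (Touched C″) (touched? C″) ¬all
    with z , z∈ ← nonempty i
    with refl ← clq-unique z∈
    with x , w , e , (u , u∈ , cu) , g ← crossing (proj₂ (conn s z)) (s , s∈ , refl)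
           (λ t → ¬t (touched-⊆ (gsweep-⊆ r′ ∘ gsweep-⊆ r) t))
    with u Fin.≟ x
  ... | yes refl = inj₂ (shrinkʳ (gsweep-⊆ r′) (gsweep-shrinks r (Vec.∈-allFin⁺ u) u∈ e g))
  ... | no u≢x with gsweep-frontier r (Vec.∈-allFin⁺ u) u∈ (clique-adj cu u≢x) e g
  ...   | inj₁ sh = inj₂ (shrinkʳ (gsweep-⊆ r′) sh)
  ...   | inj₂ (y , w′ , y∈ , e′ , g′) =
    inj₂ (shrinkˡ (gsweep-⊆ r) (gsweep-shrinks r′ (Vec.∈-allFin⁺ y) y∈ e′ g′))

  -- Counting the touched cliques and filling them

  touchedSet : Subset n → Subset (suc p)
  touchedSet C = Vec.tabulate λ i → does (touched? C i)

  touched⇒∈ : ∀ {C i} → Touched C i → i ∈ touchedSet C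
  touched⇒∈ {C} {i} t = ⇒∈ (trans (Vec.lookup∘tabulate (λ i → does (touched? C i)) i) (dec-true (touched? C i) t))

  ∈⇒touched : ∀ {C i} → i ∈ touchedSet C → Touched C i
  ∈⇒touched {C} {i} i∈ with touched? C i
                          | trans (sym (Vec.lookup∘tabulate (λ i → does (touched? C i)) i))
                              (Vec.[]=⇒lookup i∈)
  ... | yes t | _ = t

  full-touched : ∀ {C} → suc p ≤ ∣ touchedSet C ∣ → ∀ i → Touched C i
  full-touched {C} h i = ∈⇒touched (subst (i ∈_)
    (sym (Subset.∣p∣≡n⇒p≡⊤ (≤-antisym (Subset.∣p∣≤n (touchedSet C)) h))) Subset.∈⊤)

  touched-full : ∀ {C} → (∀ i → Touched C i) → suc p ≤ ∣ touchedSet C ∣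
  touched-full {C} h = ≤-trans (≤-reflexive (sym (Subset.∣⊤∣≡n (suc p))))
    (Subset.p⊆q⇒∣p∣≤∣q∣ {p = ⊤} (λ _ → touched⇒∈ (h _)))

  shrink-card : ∀ {C C′} → C ⊆ C′ → Shrink C C′ → ∣ touchedSet C ∣ < ∣ touchedSet C′ ∣
  shrink-card h (i , ¬t , t) = Subset.p⊂q⇒∣p∣<∣q∣
    ((λ i∈ → touched⇒∈ (touched-⊆ h (∈⇒touched i∈))) , i , touched⇒∈ t , ¬t ∘ ∈⇒touched)

  -- An uninformed vertex of clique `i` is a neighbour of every sender in that clique. As all
  -- cliques are touched, the sender then informs a vertex of its own clique. The second summand
  -- counts the senders of clique `i` among `us`.
  gsweep-doubles : ∀ {O C C′} i {us : Vec (Fin n) m} → GSweep O us C C′ → O ⊆ C →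
                   (∀ i → Touched C i) →
                   part i ⊆ C′ ⊎
                   ∣ part i ∩ C ∣ + ∣ Vec.map (lookup (part i ∩ O)) us ∣ ≤ ∣ part i ∩ C′ ∣
  gsweep-doubles i [] O⊆ all = inj₂ (≤-reflexive (+-identityʳ _))
  gsweep-doubles {O = O} i (skip {u = u} u∉ sw) O⊆ all
    rewrite ∉⇒false {C = part i ∩ O} {u} (λ u∈ → u∉ (Subset.p∩q⊆q (part i) O u∈)) =
    gsweep-doubles i sw O⊆ all
  gsweep-doubles {O = O} {C} {C′} i (act {u = u} {us} {C′ = C₁} u∈O st mv sw) O⊆ all
    with gsweep-doubles i sw (step-⊆ st ∘ O⊆) (λ i → touched-⊆ (step-⊆ st) (all i))
  ... | inj₁ full = inj₁ full
  ... | inj₂ ih with lookup (part i ∩ O) u in eq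
  ...   | false = inj₂ (≤-trans (+-monoˡ-≤ _ (Subset.p⊆q⇒∣p∣≤∣q∣ grow)) ih)
    where
    grow : part i ∩ C ⊆ part i ∩ C₁
    grow v∈ with h₁ , h₂ ← Subset.x∈p∩q⁻ (part i) C v∈ = Subset.x∈p∩q⁺ (h₁ , step-⊆ st h₂)
  ...   | true with Fin.any? (λ v → (v Subset.∈? part i) ×-dec ¬? (v Subset.∈? C))
  ...     | no ¬any = inj₁ λ {v} v∈ → gsweep-⊆ sw (step-⊆ st (decidable-stable (v Subset.∈? C)
              λ v∉ → ¬any (v , v∈ , v∉)))
  ...     | yes (v , v∈ , v∉)
    with refl ← clq-unique (proj₁ (Subset.x∈p∩q⁻ (part i) O (⇒∈ eq)))
    with v′ , v′∉ , v′∈ , e ← Move.to-mate mv all v∉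
           (clique-adj (sym (clq-unique v∈)) λ { refl → v∉ (O⊆ u∈O) }) (sym (clq-unique v∈)) =
    inj₂ (≤-trans (≤-reflexive (+-suc _ _)) (≤-trans (+-monoˡ-≤ _ (Subset.p⊂q⇒∣p∣<∣q∣
      ( (λ w∈ → let h₁ , h₂ = Subset.x∈p∩q⁻ (part i) C w∈ in Subset.x∈p∩q⁺ (h₁ , step-⊆ st h₂))
      , v′
      , Subset.x∈p∩q⁺ (subst (λ j → v′ ∈ part j) (sym e) (clq∈ v′) , v′∈)
      , v′∉ ∘ Subset.p∩q⊆q (part i) C))) ih))

  Saturated : ℕ → Subset n → Set
  Saturated a C = ∀ i → part i ⊆ C ⊎ a ≤ ∣ part i ∩ C ∣

  ground-doubles : ∀ {a C C′} → GRound C C′ → (∀ i → Touched C i) → Saturated a C →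
                   Saturated (a + a) C′
  ground-doubles {C = C} r all sat i with sat i | gsweep-doubles i r id all
  ... | _         | inj₁ full = inj₁ full
  ... | inj₁ full | inj₂ _    = inj₁ (gsweep-⊆ r ∘ full)
  ... | inj₂ a≤   | inj₂ le   = inj₂ (≤-trans
    (+-mono-≤ a≤ (≤-trans a≤ (≤-reflexive (cong ∣_∣ (sym (Vec.map-lookup-allFin (part i ∩ C)))))))
    le)

  saturated-full : ∀ {a C} → n ≤ a → Saturated a C → C ≡ ⊤
  saturated-full {a} {C} n≤a sat = Subset.⊆-antisym (Subset.⊆-max C) λ {v} _ → full v
    where
    full : ∀ v → v ∈ C
    full v with sat (clq v)
    ... | inj₁ h  = h (clq∈ v)
    ... | inj₂ a≤ = Subset.p∩q⊆q (part (clq v)) C (subst (v ∈_) (sym (Subset.∣p∣≡n⇒p≡⊤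
      (≤-antisym (Subset.∣p∣≤n (part (clq v) ∩ C)) (≤-trans n≤a a≤)))) Subset.∈⊤)

  filling : ∀ {a} l {C C′} → GRounds l C C′ → (∀ i → Touched C i) → Saturated a C →
            n ≤ a * 2 ^ l → C′ ≡ ⊤
  filling {a} zero [] all sat n≤ = saturated-full (≤-trans n≤ (≤-reflexive (*-identityʳ a))) sat
  filling {a} (suc l) (r ∷ rs) all sat n≤ =
    filling l rs (λ i → touched-⊆ (gsweep-⊆ r) (all i)) (ground-doubles r all sat)
      (≤-trans n≤ (≤-reflexive (arith a (2 ^ l))))
    where
    arith : ∀ a b → a * (2 * b) ≡ (a + a) * b
    arith = solve-∀

  touched-saturated : ∀ {C} → (∀ i → Touched C i) → Saturated 1 C
  touched-saturated {C} all i with v , v∈ , e ← all i =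
    inj₂ (≤-trans (s≤s z≤n) (Subset.x∈p⇒∣p-x∣<∣p∣
      (Subset.x∈p∩q⁺ (subst (λ j → v ∈ part j) e (clq∈ v) , v∈))))

  -- `j` bounds the number of untouched cliques. Should all be touched early, the remaining pairs of
  -- rounds are merely passed through, so the number of rounds need not adapt to the graph.
  spreading : ∀ j {l C C′} → GRounds (j * 2 + l) C C′ → s ∈ C →
              suc p ≤ ∣ touchedSet C ∣ + j → n ≤ 2 ^ l → C′ ≡ ⊤
  spreading zero {l} rs s∈ h n≤ =
    filling l rs all (touched-saturated all) (≤-trans n≤ (≤-reflexive (sym (+-identityʳ _))))
    where all = full-touched (≤-trans h (≤-reflexive (+-identityʳ _)))
  spreading (suc j) (r ∷ r′ ∷ rs) s∈ h n≤ =
    spreading j rs (gsweep-⊆ r′ (gsweep-⊆ r s∈)) enough n≤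
    where
    enough : suc p ≤ ∣ touchedSet _ ∣ + j
    enough with two-rounds r r′ s∈
    ... | inj₁ all = ≤-trans (touched-full all) (m≤m+n _ j)
    ... | inj₂ sh  = ≤-trans h (≤-trans (≤-reflexive (+-suc _ j))
      (+-monoˡ-≤ j (shrink-card (gsweep-⊆ r′ ∘ gsweep-⊆ r) sh)))

  grounds-full : ∀ {l C′} → n ≤ 2 ^ l → GRounds (p * 2 + l) ⁅ s ⁆ C′ → C′ ≡ ⊤
  -- The clique of `s` is touched at the start, hence `p` pairs of rounds for `suc p` cliques.
  grounds-full n≤ rs = spreading p rs (Subset.x∈⁅x⁆ s)
    (+-monoˡ-≤ p (≤-trans (s≤s z≤n) (Subset.x∈p⇒∣p-x∣<∣p∣
      (touched⇒∈ (s , Subset.x∈⁅x⁆ s , refl))))) n≤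

  -- The search stops at the first full state, which may come before the `j` rounds that the
  -- strategy guarantees.
  greedy : ∀ j {r old cur} → Valid G s r cur → Reach G s r (informed cur) →
           (∀ {C} → GRounds j (informed cur) C → C ≡ ⊤) →
           ∃₂ λ i cur′ → Search 1 adjs qs r ((old , cur) ∷ []) i cur′ × i ≤ j ×
           Valid G s (i + r) cur′ × informed cur′ ≡ ⊤ × Reach G s (i + r) ⊤
  greedy j {r} {old} {cur} v reach h with firstFull ((old , cur) ∷ []) in eq
  ... | just cur′ with e , _ , here refl ← firstFull-just ((old , cur) ∷ []) eq =
    0 , cur′ , found ≤-refl eq , z≤n , v , e , subst (Reach G s r) e reach
  greedy zero    {r} {old} {cur} v reach h | nothing =
    contradiction (here (sym (h []))) (firstFull-nothing ((old , cur) ∷ []) eq)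
  greedy (suc j) {r} {old} {cur} v reach h | nothing
    with cur₁ , e₁ , sw , b ← greedy-sweep {r = suc r} {cur} (Vec.allFin n) cur
    with v₁ ∷ [] ← subst (All (Valid G s (suc r) ∘ proj₂)) e₁ (round-valid {G = G} qs {(old , cur) ∷ []} (v ∷ []))
    with i , cur′ , search , i≤j , v′ , e , reach′ ← greedy j {suc r} {cur} {cur₁} v₁
           (next reach (GSweep⇒Sweep sw)) (λ rs → h (sw ∷ rs)) =
    suc i , cur′ ,
    round ≤-refl eq b (subst (λ l → Search 1 adjs qs (suc r) l i cur′) (sym e₁) search) ,
    s≤s i≤j ,
    subst (λ t → Valid G s t cur′) (+-suc i r) v′ , e ,
    subst (λ t → Reach G s t ⊤) (+-suc i r) reach′

  greedy-first : ∀ {l} → n ≤ 2 ^ l →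
                 ∃₂ λ t cur → Search 1 adjs qs 0 (firstState s ∷ []) t cur × t ≤ p * 2 + l ×
                 Valid G s t cur × informed cur ≡ ⊤ × Reach G s t ⊤
  greedy-first {l} n≤
    with t , cur , search , t≤ , v , e , reach ← greedy (p * 2 + l) {0} {initial s (Vec.allFin n)}
           (initial-valid G s) (subst (Reach G s 0) (sym (informed-initial s)) start)
           (λ rs → grounds-full n≤ (subst (λ C → GRounds _ C _) (informed-initial s) rs)) =
    t , cur , search , t≤ , subst (λ t → Valid G s t cur) (+-identityʳ t) v , e ,
    subst (λ t → Reach G s t ⊤) (+-identityʳ t) reach

-- Bounds

-- One number is both coefficient and exponent, as in the bound `c * n ^ c` to be proved. Positive
-- `n` lets higher powers dominate lower ones.
record Polynomial (f : ℕ → ℕ) : Set where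
  constructor _,_
  field
    degree     : ℕ
    poly-bound : ∀ n → 0 < n → f n ≤ degree * n ^ degree

open Polynomial

poly-≤ : ∀ {c d k n} → 0 < n → c ≤ d → k ≤ d → c * n ^ k ≤ d * n ^ d
poly-≤ {n = n} 0<n c≤d k≤d = *-mono-≤ c≤d (^-monoʳ-≤ n {{>-nonZero 0<n}} k≤d)

const-poly : ∀ k → Polynomial (λ _ → k)
const-poly k = k , λ n 0<n →
  ≤-trans (≤-reflexive (sym (*-identityʳ k))) (poly-≤ {k} {k} {0} 0<n ≤-refl z≤n)

id-poly : Polynomial id
id-poly = 1 , λ n _ → ≤-reflexive (sym (trans (+-identityʳ (n * 1)) (*-identityʳ n)))

infixl 6 _+ᵖ_
infixl 7 _*ᵖ_

_+ᵖ_ : ∀ {f g} → Polynomial f → Polynomial g → Polynomial (λ n → f n + g n)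
(c , p) +ᵖ (d , q) = c + d , λ n 0<n → ≤-trans
  (+-mono-≤ (≤-trans (p n 0<n) (*-monoʳ-≤ c (^-monoʳ-≤ n {{>-nonZero 0<n}} (m≤m+n c d))))
            (≤-trans (q n 0<n) (*-monoʳ-≤ d (^-monoʳ-≤ n {{>-nonZero 0<n}} (m≤n+m d c)))))
  (≤-reflexive (sym (*-distribʳ-+ (n ^ (c + d)) c d)))

_*ᵖ_ : ∀ {f g} → Polynomial f → Polynomial g → Polynomial (λ n → f n * g n)
(c , p) *ᵖ (d , q) = c * d + (c + d) , λ n 0<n → ≤-trans
  (*-mono-≤ (p n 0<n) (q n 0<n)) (≤-trans
    (≤-reflexive (trans (arith c (n ^ c) d (n ^ d))
      (cong (c * d *_) (sym (^-distribˡ-+-* n c d)))))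
    (poly-≤ 0<n (m≤m+n (c * d) (c + d)) (m≤n+m (c + d) (c * d))))
  where
  arith : ∀ a b c d → (a * b) * (c * d) ≡ (a * c) * (b * d)
  arith = solve-∀

steps : ℕ → ℕ → ℕ → ℕ
steps k n ℓ = k + k * mainCalls n ℓ

abstract
  steps-polynomial : ∀ k → Polynomial (λ n → steps k n 1)
  steps-polynomial k = con k +ᵖ con k *ᵖ mainᵖ
    where
    con : ∀ k → Polynomial (λ _ → k)
    con = const-poly
    N : Polynomial id
    N = id-poly
    quad : Polynomial sendsCalls
    quad = N *ᵖ (N +ᵖ con 2)
    chooseᵖ : Polynomial chooseCalls
    chooseᵖ = (con 1 +ᵖ N) *ᵖ (con 2 *ᵖ N +ᵖ con 3) +ᵖ quad +ᵖ quad +ᵖ con 3 *ᵖ quad +ᵖ con 6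
    succsᵖ : Polynomial succsCalls
    succsᵖ = chooseᵖ +ᵖ con 3 *ᵖ N +ᵖ con 5
    insertᵖ : Polynomial (λ n → insertCalls n 1)
    insertᵖ = (con 1 +ᵖ N) *ᵖ (con 1 *ᵖ (con 2 *ᵖ N +ᵖ con 3) +ᵖ con 2)
    expandᵖ : Polynomial (λ n → expandCalls n 1)
    expandᵖ = con 1 *ᵖ (succsᵖ +ᵖ insertᵖ +ᵖ con 3)
    roundᵖ : Polynomial (λ n → roundCalls n 1)
    roundᵖ = con 1 *ᵖ (N +ᵖ con 2) +ᵖ con 1 +ᵖ N *ᵖ (expandᵖ +ᵖ con 2) +ᵖ con 4
    searchᵖ : Polynomial (λ n → searchCalls n 1)
    searchᵖ = con 3 *ᵖ N *ᵖ roundᵖ +ᵖ (con 1 *ᵖ (N +ᵖ con 2) +ᵖ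
              N *ᵖ (N *ᵖ (con 4 *ᵖ N +ᵖ con 7) +ᵖ con 2) +ᵖ con 2)
    mainᵖ : Polynomial (λ n → mainCalls n 1)
    mainᵖ = con 2 *ᵖ (N +ᵖ N) +ᵖ quad +ᵖ N +ᵖ quad +ᵖ searchᵖ +ᵖ con 5

-- Dependence of the cost on the length of the lists

module _ (d : ℕ) (0<d : 0 < d) where

  scale : ∀ x → x ≤ d * x
  scale x = m≤n*m x d {{>-nonZero 0<d}}

  scale-+ : ∀ {x x′ y y′} → x ≤ d * x′ → y ≤ d * y′ → x + y ≤ d * (x′ + y′)
  scale-+ {x′ = x′} {y′ = y′} h h′ =
    ≤-trans (+-mono-≤ h h′) (≤-reflexive (sym (*-distribˡ-+ d x′ y′)))

  scale-* : ∀ k {x x′} → x ≤ d * x′ → k * x ≤ d * (k * x′)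
  scale-* k {x′ = x′} h = ≤-trans (*-monoʳ-≤ k h) (≤-reflexive (arith k d x′))
    where
    arith : ∀ k d x → k * (d * x) ≡ d * (k * x)
    arith = solve-∀

module _ (n ℓ : ℕ) (0<ℓ : 0 < ℓ) where

  private
    0<ℓℓ : 0 < ℓ * ℓ
    0<ℓℓ = *-mono-≤ 0<ℓ 0<ℓ

    infixl 6 _⊹_
    _⊹_ : ∀ {x x′ y y′} → x ≤ ℓ * ℓ * x′ → y ≤ ℓ * ℓ * y′ → x + y ≤ ℓ * ℓ * (x′ + y′)
    _⊹_ = scale-+ (ℓ * ℓ) 0<ℓℓ

    same : ∀ x → x ≤ ℓ * ℓ * x
    same = scale (ℓ * ℓ) 0<ℓℓ

    times : ∀ k {x x′} → x ≤ ℓ * ℓ * x′ → k * x ≤ ℓ * ℓ * (k * x′)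
    times = scale-* (ℓ * ℓ) 0<ℓℓ

    once : ∀ x → ℓ * x ≤ ℓ * ℓ * (1 * x)
    once x = ≤-trans (*-monoˡ-≤ x (scale ℓ 0<ℓ ℓ)) (≤-reflexive (cong (ℓ * ℓ *_) (sym (*-identityˡ x))))

  insertCalls-≤ : insertCalls n ℓ ≤ ℓ * insertCalls n 1
  insertCalls-≤ = scale-* ℓ 0<ℓ (suc n) (scale-+ ℓ 0<ℓ
    (≤-reflexive (cong (ℓ *_) (sym (*-identityˡ (2 * n + 3))))) (scale ℓ 0<ℓ 2))

  expandCalls-≤ : expandCalls n ℓ ≤ ℓ * ℓ * expandCalls n 1
  expandCalls-≤ = ≤-trans
    (*-monoʳ-≤ ℓ (scale-+ ℓ 0<ℓ (scale-+ ℓ 0<ℓ (scale ℓ 0<ℓ (succsCalls n)) insertCalls-≤)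
      (scale ℓ 0<ℓ 3)))
    (≤-reflexive (trans (sym (*-assoc ℓ ℓ X)) (cong (ℓ * ℓ *_) (sym (*-identityˡ X)))))
    where
    X = succsCalls n + insertCalls n 1 + 3

  -- `ℓ` enters quadratically only through `expandCalls`, where the successors of up to `ℓ` states
  -- are compared with up to `ℓ` others. Factoring `ℓ * ℓ` out leaves the polynomial of the greedy
  -- case.
  mainCalls-≤ : mainCalls n ℓ ≤ ℓ * ℓ * mainCalls n 1
  mainCalls-≤ =
    same (testCalls n) ⊹ same (logCalls n) ⊹ same n ⊹ same (n * (n + 2)) ⊹
    (times (3 * n)
      (once (n + 2) ⊹ ≤-trans (scale ℓ 0<ℓ ℓ) (≤-reflexive (sym (*-identityʳ (ℓ * ℓ)))) ⊹
       times n (expandCalls-≤ ⊹ same 2) ⊹ same 4) ⊹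
     (once (n + 2) ⊹ same (n * (rowCalls n + 2)) ⊹ same 2)) ⊹
    same 5

  steps-≤ : ∀ k → steps k n ℓ ≤ ℓ * ℓ * steps k n 1
  steps-≤ k = same k ⊹ times k mainCalls-≤

-- Rational exponents and factors

^-cancelˡ-≤ : ∀ k {m n} → 0 < k → m ^ k ≤ n ^ k → m ≤ n
^-cancelˡ-≤ k 0<k h = ≮⇒≥ λ n<m → <⇒≱ (^-monoˡ-< k {{>-nonZero 0<k}} n<m) h

withinTime-polynomial : ∀ ε p {m k} → k ≤ m → WithinTime ε p m k
withinTime-polynomial ε p {m} k≤m u v _ _ =
  ≤-trans (^-monoˡ-≤ v k≤m) (m≤n*m (m ^ v) (3 ^ (u * p)) {{>-nonZero (m^n>0 3 (u * p))}})

-- The second hypothesis is n ≤ 2 ^ (x/y) cleared of roots, with x/y = 2p/ε. Any u/v ≥ 2 ^ (x/y) is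
-- thus at least n, and after taking v-th powers the exponent `n * p * v` is at most `u * p`.
withinTime-exponential : ∀ ε p n {m k} → 0 < ℤ.∣ ℚ.↥ ε ∣ →
                         n ^ ℤ.∣ ℚ.↥ ε ∣ ≤ 2 ^ (2 * p * ℚ.↧ₙ ε) →
                         k ≤ 3 ^ (n * p) * m → WithinTime ε p m k
withinTime-exponential ε p n {m} {k} 0<y n^y≤ k≤ u v 0<v h = begin
  k ^ v                       ≤⟨ ^-monoˡ-≤ v k≤ ⟩
  (3 ^ (n * p) * m) ^ v       ≡⟨ ^-distribʳ-* v (3 ^ (n * p)) m ⟩
  (3 ^ (n * p)) ^ v * m ^ v   ≡⟨ cong (_* m ^ v) (^-*-assoc 3 (n * p) v) ⟩
  3 ^ (n * p * v) * m ^ v     ≤⟨ *-monoˡ-≤ (m ^ v) (^-monoʳ-≤ 3 exponent) ⟩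
  3 ^ (u * p) * m ^ v         ∎
  where
  open ≤-Reasoning
  y = ℤ.∣ ℚ.↥ ε ∣
  ^-distribʳ-* : ∀ k a b → (a * b) ^ k ≡ a ^ k * b ^ k
  ^-distribʳ-* zero    a b = refl
  ^-distribʳ-* (suc k) a b = trans (cong (a * b *_) (^-distribʳ-* k a b)) (arith a b (a ^ k) (b ^ k))
    where
    arith : ∀ a b c d → a * b * (c * d) ≡ (a * c) * (b * d)
    arith = solve-∀
  nv≤u : n * v ≤ u
  nv≤u = ^-cancelˡ-≤ y 0<y (begin
    (n * v) ^ y                     ≡⟨ ^-distribʳ-* y n v ⟩
    n ^ y * v ^ y                   ≤⟨ *-monoˡ-≤ (v ^ y) n^y≤ ⟩
    2 ^ (2 * p * ℚ.↧ₙ ε) * v ^ y    ≤⟨ h ⟩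
    u ^ y                           ∎)
  exponent : n * p * v ≤ u * p
  exponent = begin
    n * p * v ≡⟨ arith n p v ⟩
    n * v * p ≤⟨ *-monoˡ-≤ p nv≤u ⟩
    u * p     ∎
    where
    arith : ∀ n p v → n * p * v ≡ n * v * p
    arith = solve-∀

numerator>0 : ∀ {ε} → 0ℚ <ℚ ε → 0 < ℤ.∣ ℚ.↥ ε ∣
numerator>0 {mkℚ (ℤ.+ suc _) _ _} _ = s≤s z≤n
numerator>0 {mkℚ (ℤ.+ zero) _ _}  (ℚ.*<* (ℤ.+<+ ()))
numerator>0 {mkℚ ℤ.-[1+ _ ] _ _} (ℚ.*<* ())

withinFactor : ∀ {ε} → 0ℚ <ℚ ε → ∀ b t →
               t * ℚ.↧ₙ ε ≤ (ℚ.↧ₙ ε + ℤ.∣ ℚ.↥ ε ∣) * b → WithinFactor ε b t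
withinFactor {mkℚ (ℤ.+ zero) _ _}  (ℚ.*<* (ℤ.+<+ ()))
withinFactor {mkℚ ℤ.-[1+ _ ] _ _} (ℚ.*<* ())
withinFactor {ε@(mkℚ (ℤ.+ suc k) d _)} _ b t h = ℚ.toℚᵘ-cancel-≤
  (ℚᵘ.≤-respˡ-≃ (ℚᵘ.≃-sym (ℚ.toℚᵘ-fromℚᵘ (natᵘ t)))
    (ℚᵘ.≤-respʳ-≃ (ℚᵘ.≃-sym rhs) goal))
  where
  natᵘ : ℕ → ℚᵘ.ℚᵘ
  natᵘ k = ℚᵘ.mkℚᵘ (ℤ.+ k) 0
  rhs : ℚ.toℚᵘ ((ℚ.1ℚ ℚ.+ ε) ℚ.* ((ℤ.+ b) ℚ./ 1)) ℚᵘ.≃ (ℚᵘ.1ℚᵘ ℚᵘ.+ ℚ.toℚᵘ ε) ℚᵘ.* natᵘ b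
  rhs = ℚᵘ.≃-trans (ℚ.toℚᵘ-homo-* (ℚ.1ℚ ℚ.+ ε) ((ℤ.+ b) ℚ./ 1))
    (ℚᵘ.*-cong (ℚ.toℚᵘ-homo-+ ℚ.1ℚ ε) (ℚ.toℚᵘ-fromℚᵘ (natᵘ b)))
  goal : natᵘ t ℚᵘ.≤ (ℚᵘ.1ℚᵘ ℚᵘ.+ ℚ.toℚᵘ ε) ℚᵘ.* natᵘ b
  goal = ℚᵘ.*≤* (subst₂ ℤ._≤_
    (trans (ℤ.pos-* t (suc d)) (cong (λ x → ℤ.+ t ℤ.* ℤ.+ suc x)
      (sym (trans (*-identityʳ (d + 0)) (+-identityʳ d)))))
    (begin
      ℤ.+ ((suc d + suc k) * b)
        ≡⟨ ℤ.pos-* (suc d + suc k) b ⟩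
      (ℤ.+ suc d ℤ.+ ℤ.+ suc k) ℤ.* ℤ.+ b
        ≡⟨ cong (ℤ._* ℤ.+ b) (cong₂ ℤ._+_ (ℤ.*-identityˡ (ℤ.+ suc d)) (ℤ.*-identityʳ (ℤ.+ suc k))) ⟨
      (ℤ.1ℤ ℤ.* ℤ.+ suc d ℤ.+ ℤ.+ suc k ℤ.* ℤ.1ℤ) ℤ.* ℤ.+ b
        ≡⟨ ℤ.*-identityʳ _ ⟨
      (ℤ.1ℤ ℤ.* ℤ.+ suc d ℤ.+ ℤ.+ suc k ℤ.* ℤ.1ℤ) ℤ.* ℤ.+ b ℤ.* ℤ.1ℤ ∎)
    (ℤ.+≤+ h))
    where open ≡-Reasoning

-- Choice of the strategy and assembly of the bounds

toList-length : ∀ (xs : Vec A n) → length (Vec.toList xs) ≡ n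
toList-length []       = refl
toList-length (x ∷ xs) = cong suc (toList-length xs)

n≤2^n : ∀ n → n ≤ 2 ^ n
n≤2^n zero    = z≤n
n≤2^n (suc n) = ≤-trans (+-mono-≤ (m^n>0 2 n) (n≤2^n n)) (≤-reflexive (doubling n))

cliques-≤ : {G : Graph n} → CliqueCover G p → p ≤ n
cliques-≤ Q = Fin.injective⇒≤ {f = λ i → proj₁ (nonempty i)} λ {i} {j} e →
  disjoint (proj₂ (nonempty i)) (subst (_∈ part j) (sym e) (proj₂ (nonempty j)))
  where open CliqueCover Q

-- Determined by `maxNodes` alone, hence available before `ε` is chosen.
exponent : ℕ
exponent = degree (steps-polynomial maxNodes)

timeBound : ℕ → ℕ
timeBound n = exponent * n ^ exponent

module _ (ε : ℚ) (0<ε : 0ℚ <ℚ ε) where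

  private
    a b : ℕ
    -- With these values `a * p ≤ b * l` means 2p ≤ ε l, where `p` counts all cliques but one.
    a = 2 * ℚ.↧ₙ ε
    b = ℤ.∣ ℚ.↥ ε ∣

    w₀ W : Tree
    w₀ = proj₁ (word a b (numerator>0 0<ε))
    W  = nil ∙ w₀

  open Runs W

  module _ {p : ℕ} {G : Graph n} (conn : Connected G) (s : Fin n) (Q : CliqueCover G (suc p)) where

    private
      A′ : Matrix n n
      A′ = adjacency G

      0<n : 0 < n
      0<n = ≤-trans (s≤s z≤n) (Fin.toℕ<n s)

      p<n : p < n
      p<n = cliques-≤ Q

    record Success (ℓ : ℕ) {p′ : ℕ} (qs : Matrix p′ n) : Set where
      constructor success
      field
        {t}    : ℕ
        {cur}  : Vec (Cell n) n
        search : Search ℓ A′ qs 0 (firstState s ∷ []) t cur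
        t≤     : t ≤ 3 * n
        valid  : Valid G s t cur
        full   : informed cur ≡ ⊤

      result : Protocol G s t
      result = Scheme.protocol (scheme valid full)

    module _ {l : ℕ} (lg : Log n l) where

      l≤n : l ≤ n
      l≤n = log-minimal lg n (n≤2^n n)

      log-computes : encRows A′ ∷ [] ⊩ code log# ↠ encℕ l within logCalls n
      log-computes = weaken (*-monoˡ-≤ (n + 2) l≤n)
        (subst (λ x → x ∷ [] ⊩ code log# ↠ encℕ l within l * (n + 2))
          (sym (encV≡encL (encV encBool) A′))
          (log-run (Vec.toList A′) (encV encBool) (≤-reflexive (toList-length A′))
            (toList-length A′) lg))

      TestResult : Tree → Set
      TestResult mode =
        encRows (Vec.tail (cover Q)) ∷ encℕ l ∷ W ∷ W ∷ encRows (cover Q) ∷ [] ⊩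
        code test# ↠ mode within testCalls n

      test-computes : ∃[ mode ] TestResult mode ×
                      (mode ≡ encRows (cover Q) × a * p ≤ b * l ⊎ mode ≡ nil × b * l < a * p)
      test-computes
        with mode , d , spec ← test-run (encV encBool) (encRows (cover Q)) refl
               (proj₂ (word a b (numerator>0 0<ε)))
               (2 * (p + l)) (Vec.tail (cover Q)) l {W} ≤-refl 0 0
               (proj₂ (word a b (numerator>0 0<ε)))
               (trans (cong (_+ b * 0) (trans (*-zeroʳ a) (sym (*-zeroʳ b))))
                 (cong (b * 0 +_) (trans (*-zeroʳ b) (sym (*-zeroʳ a))))) =
        mode , weaken (*-monoʳ-≤ 2 (+-mono-≤ (<⇒≤ p<n) l≤n)) d , spec

      computes : ∀ {ℓ p′} {qs : Matrix p′ n} → p′ ≤ n → TestResult (encRows qs) →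
                 (r : Success ℓ qs) →
                 ∃[ k ] Computes (program W) (encInput G s Q) (encProtocol (Success.result r)) k ×
                 k ≤ steps maxNodes n ℓ
      computes {ℓ} {qs = qs} p′≤n test-d r
        with run {cost = k} d k≤ ← main-run {A = A′} {qs = cover Q} qs p′≤n 0<n log-computes test-d
               (Success.search r) refl =
        k ,
        subst₂ (λ x y → Computes (program W) x y k)
          (sym (encInput≡ G s Q)) (sym (scheme-output (Success.valid r) (Success.full r))) d ,
        ≤-trans k≤ (+-mono-≤ (start-small W) (*-monoʳ-≤ maxNodes
          (+-monoˡ-≤ 5 (+-monoʳ-≤ (testCalls n + logCalls n + n + n * (n + 2))
            (+-monoˡ-≤ (ℓ * (n + 2) + n * (rowCalls n + 2) + 2)
              (*-monoˡ-≤ (roundCalls n ℓ) (Success.t≤ r)))))))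

      Answer : Set
      Answer =
        ∃[ t ] Σ[ π ∈ Protocol G s t ] ∃[ k ]
          ( Computes (program W) (encInput G s Q) (encProtocol π) k
          × WithinTime ε (suc p) (timeBound n) k
          × (∀ B → IsBroadcastTime G s B → WithinFactor ε B t) )

      reach⇒l≤ : ∀ {B} → Reach G s B ⊤ → l ≤ B
      reach⇒l≤ {B} reach = log-minimal lg B
        (≤-trans (≤-reflexive (sym (Subset.∣⊤∣≡n n))) (∣Reach∣ reach))

      t≤3n : ∀ {t} → t ≤ p * 2 + l → t ≤ 3 * n
      t≤3n t≤ = ≤-trans t≤ (≤-trans (+-mono-≤ (*-monoˡ-≤ 2 (<⇒≤ p<n)) l≤n) (≤-reflexive (arith n)))
        where
        arith : ∀ n → n * 2 + n ≡ 3 * n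
        arith = solve-∀

      answer-from : ∀ {ℓ p′} {qs : Matrix p′ n} → p′ ≤ n → TestResult (encRows qs) →
                    (r : Success ℓ qs) →
                    (∀ {k} → k ≤ steps maxNodes n ℓ → WithinTime ε (suc p) (timeBound n) k) →
                    (∀ B → Reach G s B ⊤ →
                      Success.t r * ℚ.↧ₙ ε ≤ (ℚ.↧ₙ ε + b) * B) →
                    Answer
      answer-from p′≤n test-d r time factor =
        Success.t r , Success.result r , proj₁ c , proj₁ (proj₂ c) , time (proj₂ (proj₂ c)) ,
        λ B bt → withinFactor 0<ε B (Success.t r) (factor B (Informed⇒Reach (proj₁ bt)))
        where
        c = computes p′≤n test-d r

      greedy-success : Σ[ r ∈ Success 1 (cover Q) ]
                       Success.t r ≤ p * 2 + l × Reach G s (Success.t r) ⊤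
      greedy-success
        with t , cur , search , t≤ , valid , full , reach ←
               Greedy.greedy-first conn s Q (n≤2^log lg) =
        success search (t≤3n t≤) valid full , t≤ , reach

      exhaustive-success : Σ[ r ∈ Success (3 ^ n) {0} [] ]
                           (∀ B → Reach G s B ⊤ → Success.t r ≤ B)
      exhaustive-success
        -- The greedy broadcast limits the length of the exhaustive search, which gives both its
        -- termination and the bound 3n on its rounds.
        with r , r≤ , reach ← greedy-success
        with t , cur , search , t≤ , valid , full , least ←
               exhaustive G s (Success.t r) (complete-first G s)
                 (subst (λ t → Reach G s t ⊤) (sym (+-identityʳ (Success.t r))) reach) =
        success search (t≤3n (≤-trans t≤ r≤))
          (subst (λ t → Valid G s t cur) (+-identityʳ t) valid) full ,
        λ B reachB → ≤-trans (≤-reflexive (sym (+-identityʳ t))) (least B reachB z≤n)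

      greedy-answer : TestResult (encRows (cover Q)) → a * p ≤ b * l → Answer
      greedy-answer test-d ap≤bl = answer-from p<n test-d r
        (λ k≤ → withinTime-polynomial ε (suc p)
          (≤-trans k≤ (poly-bound (steps-polynomial maxNodes) n 0<n)))
        λ B reach → begin
          t * den                 ≤⟨ *-monoˡ-≤ den (proj₁ (proj₂ greedy-success)) ⟩
          (p * 2 + l) * den       ≡⟨ arith p l den ⟩
          2 * den * p + den * l   ≤⟨ +-monoˡ-≤ (den * l) ap≤bl ⟩
          b * l + den * l         ≡⟨ trans (+-comm (b * l) (den * l)) (sym (*-distribʳ-+ l den b)) ⟩
          (den + b) * l           ≤⟨ *-monoʳ-≤ (den + b) (reach⇒l≤ reach) ⟩
          (den + b) * B           ∎
        where
        open ≤-Reasoning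
        den = ℚ.↧ₙ ε
        r = proj₁ greedy-success
        t = Success.t r
        arith : ∀ p l d → (p * 2 + l) * d ≡ 2 * d * p + d * l
        arith = solve-∀

      exhaustive-answer : TestResult nil → b * l < a * p → Answer
      exhaustive-answer test-d bl<ap = answer-from z≤n test-d r
        (λ k≤ → withinTime-exponential ε (suc p) n (numerator>0 0<ε) size-bound (time-bound k≤))
        λ B reach → begin
          t * den       ≡⟨ *-comm t den ⟩
          den * t       ≤⟨ *-monoʳ-≤ den (proj₂ exhaustive-success B reach) ⟩
          den * B       ≤⟨ *-monoˡ-≤ B (m≤m+n den b) ⟩
          (den + b) * B ∎
        where
        open ≤-Reasoning
        den = ℚ.↧ₙ ε
        r = proj₁ exhaustive-success
        t = Success.t r
        -- The strict inequality rules out a single clique, for which 9 ^ n would exceed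
        -- `3 ^ (n * suc p)`.
        0<p : 0 < p
        0<p = n≢0⇒n>0 λ { refl → contradiction (≤-trans bl<ap (≤-reflexive (*-zeroʳ a))) λ () }
        size-bound : n ^ b ≤ 2 ^ (2 * suc p * den)
        size-bound = begin
          n ^ b                 ≤⟨ ^-monoˡ-≤ b (n≤2^log lg) ⟩
          (2 ^ l) ^ b           ≡⟨ ^-*-assoc 2 l b ⟩
          2 ^ (l * b)           ≤⟨ ^-monoʳ-≤ 2 (begin
            l * b               ≡⟨ *-comm l b ⟩
            b * l               ≤⟨ <⇒≤ bl<ap ⟩
            2 * den * p         ≤⟨ *-monoʳ-≤ (2 * den) (n≤1+n p) ⟩
            2 * den * suc p     ≡⟨ arith den (suc p) ⟩
            2 * suc p * den     ∎) ⟩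
          2 ^ (2 * suc p * den) ∎
          where
          arith : ∀ d p → 2 * d * p ≡ 2 * p * d
          arith = solve-∀
        time-bound : ∀ {k} → k ≤ steps maxNodes n (3 ^ n) →
                     k ≤ 3 ^ (n * suc p) * timeBound n
        time-bound k≤ = ≤-trans k≤ (≤-trans (steps-≤ n (3 ^ n) (m^n>0 3 n) maxNodes)
          (*-mono-≤ square (poly-bound (steps-polynomial maxNodes) n 0<n)))
          where
          square : 3 ^ n * 3 ^ n ≤ 3 ^ (n * suc p)
          square = begin
            3 ^ n * 3 ^ n   ≡⟨ ^-distribˡ-+-* 3 n n ⟨
            3 ^ (n + n)     ≤⟨ ^-monoʳ-≤ 3 (+-monoʳ-≤ n (m≤m*n n p {{>-nonZero 0<p}})) ⟩
            3 ^ (n + n * p) ≡⟨ cong (3 ^_) (*-suc n p) ⟨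
            3 ^ (n * suc p) ∎

      answer : Answer
      answer with test-computes
      ... | _ , d , inj₁ (refl , h) = greedy-answer d h
      ... | _ , d , inj₂ (refl , h) = exhaustive-answer d h

  solution : ∀ {n p} (G : Graph n) → Connected G → (s : Fin n) (Q : CliqueCover G p) →
             ∃[ t ] Σ[ π ∈ Protocol G s t ] ∃[ k ]
               ( Computes (program W) (encInput G s Q) (encProtocol π) k
               × WithinTime ε p (timeBound n) k
               × (∀ b → IsBroadcastTime G s b → WithinFactor ε b t) )
  solution {p = zero}      G conn s Q = ⊥-elim (Fin.¬Fin0 (proj₁ (CliqueCover.covers Q s)))
  solution {n} {p = suc p} G conn s Q = answer conn s Q (proj₂ (log n n ≤-refl))

theorem27 : ∃[ c ] ∀ (ε : ℚ) → 0ℚ <ℚ ε →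
    Σ[ P ∈ Program ]
    (∀ {n p : ℕ} (G : Graph n) → Connected G →
    (s : Fin n) (Q : CliqueCover G p) →
    ∃[ t ] Σ[ π ∈ Protocol G s t ] ∃[ k ]
    ( Computes P (encInput G s Q) (encProtocol π) k
    × WithinTime ε p (c * n ^ c) k
    × (∀ b → IsBroadcastTime G s b → WithinFactor ε b t) ))
theorem27 = exponent , λ ε 0<ε → _ , solution ε 0<ε
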